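{- Let $E$ be a finite set, let $\mathscr{P}$ be a family of subsets of $E$, ordered by inclusion, all of whose closed intervals are graded, and let $K<L$ be elements of $\mathscr{P}$. If the interval $[K,L]_{\mathscr{P}}=\{F\in\mathscr{P}:K\subseteq F\subseteq L\}$ is the lattice of flats of a matroid (on ground set $L$), then the polynomial $\mathrm{pol}_K^L$, viewed as a polynomial on $\mathscr{E}_K^L$ (i.e. in the variables $t_S$, $K\subset S\subset L$), is $\mathscr{C}_K^L$-Lorentzian.
   Context: Throughout $\subset$ denotes strict inclusion. Lattice of flats: a family $\mathscr{L}$ of subsets of a finite set $X$, ordered by inclusion, is the lattice of flats of a matroid on $X$ if and only if (F1) $X\in\mathscr{L}$; (F2) $F,G\in\mathscr{L}$ implies $F\cap G\in\mathscr{L}$; (F3) for each $H\in\mathscr{L}$ the sets $A\setminus H$, where $A$ ranges over the elements of $\mathscr{L}$ covering $H$, partition $X\setminus H$. Here $X=L$, so $K$ is the set of loops. Spaces and cones: for finite sets $K\subset L$ let $\mathscr{E}_K^L=\{(y_S)_{K\subset S\subset L}:y_S\in\mathbb{R}\}\cong\mathbb{R}^{2^{|L\setminus K|}-2}$, indexed by all sets $S$ strictly between $K$ and $L$. $\mathscr{C}_K^L$ is the open convex cone of strictly submodular $\mathbf{y}\in\mathscr{E}_K^L$, i.e. $y_S+y_T>y_{S\cap T}+y_{S\cup T}$ for all incomparable $S,T$ with $K\subset S,T\subset L$, where $y_K=y_L=0$. Projections: for $K\subseteq F\subset G\subseteq L$ define the linear map $\pi_F^G:\mathscr{E}_K^L\to\mathscr{E}_F^G$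 by $$\pi_F^G(\mathbf{t})=\Big(t_S-t_G\frac{|S\setminus F|}{|G\setminus F|}-t_F\frac{|G\setminus S|}{|G\setminus F|}\Big)_{F\subset S\subset G},\qquad t_K=t_L=0.$$ The polynomials: for $K<L$ in $\mathscr{P}$ let $r(K,L)$ be the rank (length of a maximal chain) of $[K,L]_{\mathscr{P}}$ and $d(K,L)=r(K,L)-1$. The polynomial $\mathrm{pol}_K^L(\mathbf{t})$, homogeneous of degree $d(K,L)$ in the variables $\{t_F:F\in\mathscr{P},\,K<F<L\}$, is defined recursively: $\mathrm{pol}_K^L=1$ if $d(K,L)=0$, and if $d(K,L)\ge1$, $$d(K,L)\cdot\mathrm{pol}_K^L(\mathbf{t})=\sum_{F\in\mathscr{P},\,K<F<L}t_F\cdot\mathrm{pol}_K^F(\pi_K^F(\mathbf{t}))\cdot\mathrm{pol}_F^L(\pi_F^L(\mathbf{t})).$$ $\mathscr{C}$-Lorentzian: for $\mathbf{u}\in\mathbb{R}^n$ let $D_{\mathbf{u}}=\sum_i u_i\partial_i$. For an open convex cone $\mathscr{C}\subseteq\mathbb{R}^n$, a homogeneous polynomial $g$ of degree $d$ is $\mathscr{C}$-Lorentzian if for all $\mathbf{v}_1,\ldots,\mathbf{v}_d\in\mathscr{C}$: (P) $D_{\mathbf{v}_1}\cdots D_{\mathbf{v}_d}g>0$, and (H) the symmetric bilinear form $(\mathbf{x},\mathbf{y})\mapsto D_{\mathbf{x}}D_{\mathbf{y}}D_{\mathbf{v}_3}\cdots D_{\mathbf{v}_d}g$ has exactly one positive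 eigenvalue, counted with multiplicity (vacuous if $d\le1$). The zero polynomial is by convention $\mathscr{C}$-Lorentzian. -}

module Defs where

open import Level using (Level; _⊔_) renaming (suc to lsuc)
open import Algebra.Bundles using (CommutativeRing; Semiring)
import Algebra.Definitions.RawSemiring as RawSemiringOps
import Algebra.Properties.Ring as RingProperties
import Relation.Binary.Reasoning.Setoid as SetoidReasoning
import Data.Bool.Properties as Bool
open import Data.Bool.Base using (if_then_else_)
open import Data.Empty using (⊥-elim)
open import Data.Fin.Subset
  using (Subset; inside; outside; _∈_; _∉_; _⊆_; _⊂_; _∩_; _∪_; _─_; ∣_∣)
open import Data.Fin.Subset.Properties using (_⊂?_; p⊂q⇒p⊆q; ⊆-trans; ⊂-irref)
open import Data.Nat.Base as ℕ using (ℕ; zero; suc; _∸_; z≤n; s≤s)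
import Data.Nat.Properties as ℕ
open import Data.Product using (∃; _×_; _,_)
open import Data.Sum using (_⊎_)
open import Data.Unit.Polymorphic using (⊤)
open import Data.Vec using (Vec; []; _∷_; foldr′)
open import Data.Vec.Properties using (≡-dec)
open import Data.Vec.Relation.Unary.All using (All)
open import Relation.Binary.Definitions using (tri<; tri≈; tri>)
open import Relation.Binary.PropositionalEquality as ≡ using (_≡_)
open import Relation.Binary.Structures using (IsStrictTotalOrder)
open import Relation.Nullary using (¬_; yes; no; does)
open import Relation.Unary using (Pred; Decidable)

private
  variable
    c ℓ₁ ℓ₂ p : Level
    n : ℕ

------------------------------------------------------------------------
-- The real numbers, axiomatised as a Dedekind-complete ordered field.
-- Up to isomorphism ℝ is the only classical model.  The inverse is
-- total; its value at zero is unspecified.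

record RealNumbers c ℓ₁ ℓ₂ : Set (lsuc (c ⊔ ℓ₁ ⊔ ℓ₂)) where
  infix  4 _<_ _≤_
  infix  8 _⁻¹
  field
    commutativeRing : CommutativeRing c ℓ₁

  open CommutativeRing commutativeRing public

  field
    _<_                : Carrier → Carrier → Set ℓ₂
    isStrictTotalOrder : IsStrictTotalOrder _≈_ _<_
    1≉0                : ¬ 1# ≈ 0#
    +-monoˡ-<          : ∀ z {x y} → x < y → x + z < y + z
    *-pos              : ∀ {x y} → 0# < x → 0# < y → 0# < x * y
    _⁻¹                : Carrier → Carrier
    *-inverseʳ         : ∀ {x} → ¬ x ≈ 0# → x * x ⁻¹ ≈ 1#

  _≤_ : Carrier → Carrier → Set ℓ₂
  x ≤ y = ¬ y < x

  UpperBound : Pred Carrier (c ⊔ ℓ₁ ⊔ ℓ₂) → Carrier → Set (c ⊔ ℓ₁ ⊔ ℓ₂)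
  UpperBound A b = ∀ x → A x → x ≤ b

  field
    supremum : (A : Pred Carrier (c ⊔ ℓ₁ ⊔ ℓ₂)) → ∃ A → ∃ (UpperBound A) →
               ∃ λ s → UpperBound A s × (∀ b → UpperBound A b → s ≤ b)

  open RawSemiringOps (Semiring.rawSemiring semiring) public using (_^_) renaming (_×_ to _·_)

  fromℕ : ℕ → Carrier
  fromℕ m = m · 1#

  private
    module R = RingProperties ring
    module O = IsStrictTotalOrder isStrictTotalOrder

  0<1 : 0# < 1#
  0<1 with O.compare 0# 1#
  ... | tri< 0<1 _ _ = 0<1
  ... | tri≈ _ 0≈1 _ = ⊥-elim (1≉0 (sym 0≈1))
  ... | tri> _ _ 1<0 = O.<-respʳ-≈ -1*-1≈1 (*-pos 0<-1 0<-1)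
    where
    0<-1 : 0# < - 1#
    0<-1 = O.<-respʳ-≈ (+-identityˡ (- 1#))
             (O.<-respˡ-≈ (-‿inverseʳ 1#) (+-monoˡ-< (- 1#) 1<0))
    -1*-1≈1 : - 1# * - 1# ≈ 1#
    -1*-1≈1 = trans (R.-1*x≈-x (- 1#)) (R.-‿involutive 1#)

  0<fromℕ : ∀ m → 0# < fromℕ (suc m)
  0<fromℕ zero    = O.<-respʳ-≈ (sym (+-identityʳ 1#)) 0<1
  0<fromℕ (suc m) = O.trans (0<fromℕ m)
    (O.<-respˡ-≈ (+-identityˡ _) (+-monoˡ-< (fromℕ (suc m)) 0<1))

  fromℕ≉0 : ∀ m → ¬ fromℕ (suc m) ≈ 0#
  fromℕ≉0 m eq = O.irrefl (sym eq) (0<fromℕ m)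

------------------------------------------------------------------------

Interval : Pred (Subset n) p → (K L : Subset n) → Pred (Subset n) p
Interval 𝒫 K L F = 𝒫 F × K ⊆ F × F ⊆ L

Covers : Pred (Subset n) p → (H A : Subset n) → Set p
Covers 𝒫 H A = 𝒫 H × 𝒫 A × H ⊂ A × (∀ B → 𝒫 B → H ⊂ B → ¬ B ⊂ A)

-- The maximal chains of [K , L] are the chains K = F₀ ⋖ F₁ ⋖ ⋯ ⋖ Fᵣ = L;
-- the last index is the length r.

data MaximalChain (𝒫 : Pred (Subset n) p) (K : Subset n) : Subset n → ℕ → Set p where
  []  : MaximalChain 𝒫 K K 0
  _∷_ : ∀ {F L r} → MaximalChain 𝒫 K F r → Covers 𝒫 F L → MaximalChain 𝒫 K L (suc r)

-- All maximal chains of [K , L] have the same length, which is `rank K L`.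
-- The values of `rank` at other pairs carry no information.

record IntervalsGraded (𝒫 : Pred (Subset n) p) : Set p where
  field
    rank         : (K L : Subset n) → ℕ
    chain        : ∀ {K L} → 𝒫 K → 𝒫 L → K ⊆ L → MaximalChain 𝒫 K L (rank K L)
    chain-length : ∀ {K L r} → 𝒫 K → 𝒫 L → K ⊆ L → MaximalChain 𝒫 K L r → r ≡ rank K L

  degree : (K L : Subset n) → ℕ
  degree K L = rank K L ∸ 1

  _++_ : ∀ {K F L r s} → MaximalChain 𝒫 K F r → MaximalChain 𝒫 F L s →
         MaximalChain 𝒫 K L (s ℕ.+ r)
  xs ++ []       = xs
  xs ++ (ys ∷ y) = (xs ++ ys) ∷ y

  length-positive : ∀ {K L r} → K ⊂ L → MaximalChain 𝒫 K L r → 0 ℕ.< r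
  length-positive K⊂K []      = ⊥-elim (⊂-irref ≡.refl K⊂K)
  length-positive _   (_ ∷ _) = s≤s z≤n

  rank-positive : ∀ {K L} → 𝒫 K → 𝒫 L → K ⊂ L → 0 ℕ.< rank K L
  rank-positive PK PL K⊂L = length-positive K⊂L (chain PK PL (p⊂q⇒p⊆q K⊂L))

  rank-additive : ∀ {K F L} → 𝒫 K → 𝒫 F → 𝒫 L → K ⊂ F → F ⊂ L →
                  rank F L ℕ.+ rank K F ≡ rank K L
  rank-additive PK PF PL (K⊆F , _) (F⊆L , _) =
    chain-length PK PL (⊆-trans K⊆F F⊆L) (chain PK PF K⊆F ++ chain PF PL F⊆L)

  pred-<ʳ : ∀ {a b s} → 0 ℕ.< a → 0 ℕ.< b → a ℕ.+ b ≡ s → b ∸ 1 ℕ.< s ∸ 1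
  pred-<ʳ {suc a} {suc b} _ _ ≡.refl rewrite ℕ.+-suc a b = s≤s (ℕ.m≤n+m b a)

  degree-<ʳ : ∀ {K F L} → 𝒫 K → 𝒫 F → 𝒫 L → K ⊂ F → F ⊂ L → degree K F ℕ.< degree K L
  degree-<ʳ PK PF PL K⊂F F⊂L = pred-<ʳ (rank-positive PF PL F⊂L)
    (rank-positive PK PF K⊂F) (rank-additive PK PF PL K⊂F F⊂L)

  degree-<ˡ : ∀ {K F L} → 𝒫 K → 𝒫 F → 𝒫 L → K ⊂ F → F ⊂ L → degree F L ℕ.< degree K L
  degree-<ˡ PK PF PL K⊂F F⊂L = pred-<ʳ (rank-positive PK PF K⊂F)
    (rank-positive PF PL F⊂L)
    (≡.trans (ℕ.+-comm (rank _ _) _) (rank-additive PK PF PL K⊂F F⊂L))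

-- In `F3-cover` and `F3-disjoint`: the sets A ∖ H with A covering H in ℒ
-- exhaust X ∖ H and are pairwise disjoint.  They are nonempty because H ⊂ A.

record IsLatticeOfFlats (X : Subset n) (ℒ : Pred (Subset n) p) : Set p where
  field
    ℒ⊆X         : ∀ {F} → ℒ F → F ⊆ X
    F1          : ℒ X
    F2          : ∀ {F G} → ℒ F → ℒ G → ℒ (F ∩ G)
    F3-cover    : ∀ {H} → ℒ H → ∀ {x} → x ∈ X → x ∉ H → ∃ λ A → Covers ℒ H A × x ∈ A
    F3-disjoint : ∀ {H A B} → Covers ℒ H A → Covers ℒ H B →
                  ∀ {x} → x ∉ H → x ∈ A → x ∈ B → A ≡ B

------------------------------------------------------------------------
-- The proofs are irrelevant, so that elements are determined by the
-- underlying sets.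

record Between (K L : Subset n) : Set where
  constructor between
  field
    set    : Subset n
    .lower : K ⊂ set
    .upper : set ⊂ L

open Between public using (set)

extend : ∀ {a} {A : Set a} {K L : Subset n} → A → (Between K L → A) → Subset n → A
extend {K = K} {L} z f S with K ⊂? S | S ⊂? L
... | yes K⊂S | yes S⊂L = f (between S K⊂S S⊂L)
... | _       | _       = z

sumSubsets : ∀ {a} {A : Set a} → (A → A → A) → (Subset n → A) → A
sumSubsets {n = zero}  _∙_ f = f []
sumSubsets {n = suc _} _∙_ f =
  sumSubsets _∙_ (λ S → f (outside ∷ S)) ∙ sumSubsets _∙_ (λ S → f (inside ∷ S))

extend-cong : ∀ {a} {A : Set a} {K L : Subset n} (z : A) {f g : Between K L → A} S →
              ((K⊂S : K ⊂ S) (S⊂L : S ⊂ L) → f (between S K⊂S S⊂L) ≡ g (between S K⊂S S⊂L)) →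
              extend z f S ≡ extend z g S
extend-cong {K = K} {L} z S f≡g with K ⊂? S | S ⊂? L
... | yes K⊂S | yes S⊂L = f≡g K⊂S S⊂L
... | yes _   | no _    = ≡.refl
... | no _    | _       = ≡.refl

sumSubsets-cong : ∀ {a} {A : Set a} (_∙_ : A → A → A) {f g : Subset n → A} →
                  (∀ S → f S ≡ g S) → sumSubsets _∙_ f ≡ sumSubsets _∙_ g
sumSubsets-cong {n = zero}  _∙_ f≡g = f≡g []
sumSubsets-cong {n = suc _} _∙_ f≡g = ≡.cong₂ _∙_
  (sumSubsets-cong _∙_ λ S → f≡g (outside ∷ S)) (sumSubsets-cong _∙_ λ S → f≡g (inside ∷ S))

------------------------------------------------------------------------

module Lorentz (ℝ : RealNumbers c ℓ₁ ℓ₂) where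

  open RealNumbers ℝ

  -- Real polynomials in variables I, as expressions up to `_≋_`.

  infixl 6 _⊕_ _⊖_
  infixl 7 _⊗_
  infix  4 _≋_
  infix  9 _[_]

  data Poly (I : Set) : Set c where
    con     : Carrier → Poly I
    var     : I → Poly I
    _⊕_ _⊗_ : Poly I → Poly I → Poly I

  _⊖_ : ∀ {I} → Poly I → Poly I → Poly I
  f ⊖ g = f ⊕ con (- 1#) ⊗ g

  eval : ∀ {I} → Poly I → (I → Carrier) → Carrier
  eval (con a) x = a
  eval (var i) x = x i
  eval (f ⊕ g) x = eval f x + eval g x
  eval (f ⊗ g) x = eval f x * eval g x

  -- ℝ is infinite, so this is equality of polynomials.

  _≋_ : ∀ {I} → Poly I → Poly I → Set (c ⊔ ℓ₁)
  f ≋ g = ∀ x → eval f x ≈ eval g x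

  _[_] : ∀ {I J} → Poly I → (I → Poly J) → Poly J
  con a   [ σ ] = con a
  var i   [ σ ] = σ i
  (f ⊕ g) [ σ ] = f [ σ ] ⊕ g [ σ ]
  (f ⊗ g) [ σ ] = f [ σ ] ⊗ g [ σ ]

  Homogeneous : ∀ {I} → ℕ → Poly I → Set (c ⊔ ℓ₁)
  Homogeneous d f = ∀ a x → eval f (λ i → a * x i) ≈ a ^ d * eval f x

  D : ∀ {I} → (I → Carrier) → Poly I → Poly I
  D u (con a) = con 0#
  D u (var i) = con (u i)
  D u (f ⊕ g) = D u f ⊕ D u g
  D u (f ⊗ g) = D u f ⊗ g ⊕ f ⊗ D u g

  Ds : ∀ {I m} → Vec (I → Carrier) m → Poly I → Poly I
  Ds us f = foldr′ D f us

  -- Used only for polynomials that are constant.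

  constant : ∀ {I} → Poly I → Carrier
  constant f = eval f (λ _ → 0#)

  ----------------------------------------------------------------------

  𝓔 : (K L : Subset n) → Set c
  𝓔 K L = Between K L → Carrier

  -- y_S, with y_K = y_L = 0.

  _⟨_⟩ : {K L : Subset n} → 𝓔 K L → Subset n → Carrier
  y ⟨ S ⟩ = extend 0# y S

  𝓒 : (K L : Subset n) → Pred (𝓔 K L) ℓ₂
  𝓒 K L y = ∀ S T → K ⊂ S → S ⊂ L → K ⊂ T → T ⊂ L → ¬ S ⊆ T → ¬ T ⊆ S →
            y ⟨ S ∩ T ⟩ + y ⟨ S ∪ T ⟩ < y ⟨ S ⟩ + y ⟨ T ⟩

  ----------------------------------------------------------------------
  -- Eigenvalues of symmetric matrices with rows and columns indexed by
  -- the coordinates of 𝓔 K L.  For these the multiplicity of an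
  -- eigenvalue is the dimension of its eigenspace.

  module _ {K L : Subset n} where

    Matrix : Set c
    Matrix = Between K L → Between K L → Carrier

    ∑ : (Between K L → Carrier) → Carrier
    ∑ f = sumSubsets _+_ (extend 0# f)

    InEigenspace : Matrix → Carrier → 𝓔 K L → Set ℓ₁
    InEigenspace M μ w = ∀ S → ∑ (λ T → M S T * w T) ≈ μ * w S

    NonZero : 𝓔 K L → Set ℓ₁
    NonZero w = ¬ (∀ S → w S ≈ 0#)

    IsEigenvalue : Matrix → Carrier → Set (c ⊔ ℓ₁)
    IsEigenvalue M μ = ∃ λ w → NonZero w × InEigenspace M μ w

    HasMultiplicityOne : Matrix → Carrier → Set (c ⊔ ℓ₁)
    HasMultiplicityOne M μ = ∃ λ w → NonZero w × InEigenspace M μ w ×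
      (∀ v → InEigenspace M μ v → ∃ λ a → ∀ S → v S ≈ a * w S)

    ExactlyOnePositiveEigenvalue : Matrix → Set (c ⊔ ℓ₁ ⊔ ℓ₂)
    ExactlyOnePositiveEigenvalue M = ∃ λ μ → 0# < μ × HasMultiplicityOne M μ ×
      (∀ ν → 0# < ν → IsEigenvalue M ν → ν ≈ μ)

    basis : Between K L → 𝓔 K L
    basis S T = if does (≡-dec Bool._≟_ (set S) (set T)) then 1# else 0#

    matrixOf : (𝓔 K L → 𝓔 K L → Carrier) → Matrix
    matrixOf B S T = B (basis S) (basis T)

    --------------------------------------------------------------------

    PropertyP : ∀ {d} → Poly (Between K L) → Vec (𝓔 K L) d → Set ℓ₂
    PropertyP g vs = 0# < constant (Ds vs g)

    PropertyH : ∀ {d} → Poly (Between K L) → Vec (𝓔 K L) d → Set (c ⊔ ℓ₁ ⊔ ℓ₂)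
    PropertyH g []           = ⊤
    PropertyH g (_ ∷ [])     = ⊤
    PropertyH g (_ ∷ _ ∷ vs) =
      ExactlyOnePositiveEigenvalue (matrixOf λ x y → constant (D x (D y (Ds vs g))))

    -- C is meant to be an open convex cone.  The disjunct g ≋ con 0# is the
    -- convention on the zero polynomial.

    Lorentzian : Pred (𝓔 K L) ℓ₂ → ℕ → Poly (Between K L) → Set (c ⊔ ℓ₁ ⊔ ℓ₂)
    Lorentzian C d g = Homogeneous d g ×
      (g ≋ con 0# ⊎ ((vs : Vec (𝓔 K L) d) → All C vs → PropertyP g vs × PropertyH g vs))

  ----------------------------------------------------------------------
  -- The projections, as families of linear forms in the coordinates t.

  t : {K L : Subset n} → Subset n → Poly (Between K L)
  t = extend (con 0#) var

  π : {K L : Subset n} (F G : Subset n) → Between F G → Poly (Between K L)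
  π F G S = t (set S) ⊖ con (ratio ∣ set S ─ F ∣) ⊗ t G ⊖ con (ratio ∣ G ─ set S ∣) ⊗ t F
    where
    ratio : ℕ → Carrier
    ratio m = fromℕ m * fromℕ ∣ G ─ F ∣ ⁻¹

  ----------------------------------------------------------------------

  module Pol {𝒫 : Pred (Subset n) p} (𝒫? : Decidable 𝒫) (graded : IntervalsGraded 𝒫) where

    open IntervalsGraded graded

    -- Σ t_F · rec K F (π t) · rec F L (π t), over F ∈ 𝒫 with K ⊂ F ⊂ L

    recursionTerm : ((K L : Subset n) → Poly (Between K L)) →
                    (K L F : Subset n) → Poly (Between K L)
    recursionTerm rec K L F = if does (𝒫? F)
      then extend (con 0#) (λ G → var G ⊗ rec K F [ π K F ] ⊗ rec F L [ π F L ]) F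
      else con 0#

    recursionSum : ((K L : Subset n) → Poly (Between K L)) →
                   (K L : Subset n) → Poly (Between K L)
    recursionSum rec K L = sumSubsets _⊕_ (recursionTerm rec K L)

    divideBy : ∀ {I} → ℕ → Poly I → Poly I
    divideBy zero    f = con 1#
    divideBy (suc d) f = con (fromℕ (suc d) ⁻¹) ⊗ f

    -- `polUpTo m` is correct on intervals of degree at most m; see
    -- `pol-zero` and `pol-recursion`.

    polUpTo : ℕ → (K L : Subset n) → Poly (Between K L)
    polUpTo zero    K L = con 1#
    polUpTo (suc m) K L = divideBy (degree K L) (recursionSum (polUpTo m) K L)

    pol : (K L : Subset n) → Poly (Between K L)
    pol K L = polUpTo (degree K L) K L

    private
      polUpTo-stable : ∀ a b {K L} → 𝒫 K → 𝒫 L → degree K L ℕ.≤ a → degree K L ℕ.≤ b →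
                       polUpTo a K L ≡ polUpTo b K L

      recursionTerm-stable :
        ∀ (rec rec′ : (K L : Subset n) → Poly (Between K L)) {K L} → 𝒫 K → 𝒫 L →
        (∀ {G H} → 𝒫 G → 𝒫 H → degree G H ℕ.< degree K L → rec G H ≡ rec′ G H) →
        ∀ F → recursionTerm rec K L F ≡ recursionTerm rec′ K L F
      recursionTerm-stable rec rec′ {K} {L} PK PL same F with 𝒫? F
      ... | no  _  = ≡.refl
      ... | yes PF = extend-cong (con 0#) F λ K⊂F F⊂L → ≡.cong₂
        (λ f g → var (between F K⊂F F⊂L) ⊗ f [ π K F ] ⊗ g [ π F L ])
        (same PK PF (degree-<ʳ PK PF PL K⊂F F⊂L)) (same PF PL (degree-<ˡ PK PF PL K⊂F F⊂L))

      polUpTo-stable zero    zero    _ _ _ _ = ≡.refl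
      polUpTo-stable zero    (suc b) {K} {L} _ _ d≤a _ rewrite ℕ.n≤0⇒n≡0 d≤a = ≡.refl
      polUpTo-stable (suc a) zero    {K} {L} _ _ _ d≤b rewrite ℕ.n≤0⇒n≡0 d≤b = ≡.refl
      polUpTo-stable (suc a) (suc b) {K} {L} PK PL d≤a d≤b =
        ≡.cong (divideBy (degree K L)) (sumSubsets-cong _⊕_
          (recursionTerm-stable (polUpTo a) (polUpTo b) PK PL λ PG PH d<d →
            polUpTo-stable a b PG PH (ℕ.≤-pred (ℕ.≤-trans d<d d≤a))
                                     (ℕ.≤-pred (ℕ.≤-trans d<d d≤b))))

    pol-zero : ∀ {K L} → degree K L ≡ 0 → pol K L ≡ con 1#
    pol-zero eq rewrite eq = ≡.refl

    pol-recursion : ∀ {K L} → 𝒫 K → 𝒫 L → 0 ℕ.< degree K L →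
                    con (fromℕ (degree K L)) ⊗ pol K L ≋ recursionSum pol K L
    pol-recursion {K} {L} PK PL 0<d x with degree K L in eq
    pol-recursion {K} {L} PK PL 0<d x | suc d rewrite eq = begin
      m * (m ⁻¹ * eval (recursionSum (polUpTo d) K L) x) ≈⟨ *-assoc m (m ⁻¹) _ ⟨
      m * m ⁻¹ * eval (recursionSum (polUpTo d) K L) x   ≈⟨ *-congʳ (*-inverseʳ (fromℕ≉0 d)) ⟩
      1# * eval (recursionSum (polUpTo d) K L) x         ≈⟨ *-identityˡ _ ⟩
      eval (recursionSum (polUpTo d) K L) x
        ≡⟨ ≡.cong (λ f → eval f x) (sumSubsets-cong _⊕_
             (recursionTerm-stable (polUpTo d) pol PK PL λ PG PH d<d →
               polUpTo-stable d _ PG PH (ℕ.≤-pred (ℕ.≤-trans d<d (ℕ.≤-reflexive eq))) ℕ.≤-refl)) ⟩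
      eval (recursionSum pol K L) x                      ∎
      where
      open SetoidReasoning setoid
      m = fromℕ (suc d)

{-# OPTIONS --safe #-}
-- Write P K L for pol K L precomposed with the projection onto [K , L], so that all
-- these polynomials live on functions of arbitrary subsets.  By induction on the
-- recursion, ∂_F (P K L) = P K F · P F L, and since the atoms partition L ∖ K, modular
-- functions act trivially.  Every strictly submodular direction can therefore be
-- shifted by a modular function so that all its coordinates strictly between K and L
-- become positive, which gives (P).
--
-- For (H), one proves by induction on the degree, for all products of polynomials P
-- over the intervals of a flag, that the Hessian form after differentiating along the
-- cone is nonpositive on a hyperplane.  In degree 2 this is a direct computation.  In
-- degree at least 3 let w be the first cone direction, with positive coordinates, and
-- A the Hessian matrix.  By Euler's formula A is the sum over flats F of w_F times the
-- Hessian for the refined flag, and reverse Cauchy-Schwarz for these gives the Bochner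
-- inequality ⟨x, A x⟩ ≤ Σ w_F (A x)_F² / (A w)_F: in a suitable inner product the
-- eigenvalues are ≤ 0 or ≥ 1.  As A w > 0, A has nonnegative off-diagonal entries and
-- the graph of flats is connected, 1 is the largest eigenvalue and is simple.

module Submission where

open import Defs
import Algebra.Properties.AbelianGroup as AbelianGroupProperties
import Algebra.Properties.Ring as RingProperties
import Algebra.Properties.Semiring.Exp as Exp
import Algebra.Properties.Semiring.Mult.TCOptimised as Mult
import Algebra.Properties.Semiring.Sum as SemiringSum
import Algebra.Solver.Ring as RingSolver
open import Algebra.Solver.Ring.AlmostCommutativeRing using (AlmostCommutativeRing; fromCommutativeRing; _-Raw-AlmostCommutative⟶_)
open import Data.Bool.Base using (if_then_else_; true; false)
import Data.Bool.Properties as Bool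
open import Data.Empty using (⊥-elim; ⊥)
import Data.Empty.Irrelevant as Irrelevant
open import Data.Fin.Base as Fin using (Fin; zero; suc; splitAt; _↑ˡ_; _↑ʳ_)
import Data.Fin.Properties as Fin
open import Data.Fin.Subset using (Subset; inside; outside; _∈_; _∉_; _⊆_; _⊂_; _∩_; _∪_; _─_; ∣_∣)
open import Data.Fin.Subset.Properties using (_∈?_; _⊂?_; drop-∷-⊆; out⊆; in⊆in; s⊆s; ⊆-refl; ⊆-antisym; p⊂q⇒p⊆q; p∩q⊆p; q⊆p∪q; x∈p∩q⁺; x∈p∪q⁻; ∩-comm; ∪-comm; ⊆-trans; ⊂-trans; ⊂-⊆-trans; ⊆-⊂-trans; ⊂-irref; _⊆?_; p∩q⊆q)
open import Data.Integer.Base as ℤ using (ℤ; +_; -[1+_])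
import Data.Integer.Properties as ℤ
open import Data.List.Base using (List; []; _∷_)
open import Data.List.Relation.Unary.All as All using ([]; _∷_)
open import Data.List.Relation.Unary.AllPairs using (AllPairs; []; _∷_)
open import Data.List.Relation.Unary.Any as Any using (Any; here; there; any?)
open import Data.Maybe.Base using (Maybe; just; nothing)
open import Data.Nat.Base as ℕ using (ℕ; zero; suc; z≤n; s≤s)
import Data.Nat.Properties as ℕ
open import Data.Product using (∃; _×_; _,_; proj₁; proj₂; ∃₂)
import Data.Sign.Base as Sign
open import Data.Sum using (_⊎_; inj₁; inj₂; [_,_]′; swap)
open import Data.Vec using (Vec; []; _∷_; map; here; there)
open import Data.Vec.Functional using () renaming (_∷_ to _◂_)
open import Data.Vec.Properties using (≡-dec; ∷-injectiveʳ)
open import Data.Vec.Relation.Unary.All using (All; []; _∷_)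
open import Function.Base using (_∘_; case_of_)
open import Level using (Level; _⊔_; Lift; lift)
open import Relation.Binary.Definitions using (tri<; tri≈; tri>)
open import Relation.Binary.PropositionalEquality as ≡ using (_≡_)
import Relation.Binary.Reasoning.Setoid as SetoidReasoning
open import Relation.Binary.Structures using (IsStrictTotalOrder)
open import Relation.Nullary using (¬_; Dec; yes; no; does)
open import Relation.Nullary.Decidable using (_×-dec_; ¬?)
open import Relation.Unary using (Pred; Decidable)

-- Flags are forced by the formula for ∂_F: a derivative of one `P K L` is a product of two such
-- polynomials, so induction on the degree needs a class of products closed under this splitting.
-- The formula itself rests on a symmetry: differentiating the recursion leaves a double sum over
-- chains G ⊂ F in which the direction and the point can be exchanged. The positive representative
-- of a cone direction is glued from different modular shifts on the different intervals of a flag;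
-- it replaces the direction only in its action on the polynomial of that flag, which suffices
-- because derivatives commute. The signature is carried as a hyperplane on which the form is
-- nonpositive, since hyperplanes pull back along linear maps. Eigenvectors arise only as maximisers
-- of Rayleigh quotients, and compactness is replaced by a dichotomy: a positive semidefinite form
-- has a null vector or dominates a positive multiple of the squared norm. One eigenvector is
-- enough: for Bochner, `w` is split off first, and in the final count everything orthogonal to the
-- eigenvector is nonpositive.

-- Arithmetic and order of the real numbers.

module OrderedField {c ℓ₁ ℓ₂} (ℝ : RealNumbers c ℓ₁ ℓ₂) where

  open RealNumbers ℝ public hiding (zero)
  open IsStrictTotalOrder isStrictTotalOrder public using (compare; _≟_; _<?_)
    renaming (trans to <-trans; irrefl to <-irrefl; asym to <-asym;
              <-respʳ-≈ to <-respʳ; <-respˡ-≈ to <-respˡ)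
  open RingProperties ring public
    using (-‿involutive; -‿distribˡ-*; -‿distribʳ-*; -0#≈0#; x∙y⁻¹≈ε⇒x≈y)

  -- The ring solver needs coefficients whose zero test computes.

  private
    open Mult semiring renaming (_×_ to _×′_)
    module S = SetoidReasoning setoid
    open AbelianGroupProperties +-abelianGroup using (⁻¹-∙-comm)

    ⟦_⟧ℤ : ℤ → Carrier
    ⟦ + m ⟧ℤ     = m ×′ 1#
    ⟦ -[1+ m ] ⟧ℤ = - (suc m ×′ 1#)

    ⟦⊖⟧ : ∀ m k → ⟦ m ℤ.⊖ k ⟧ℤ ≈ m ×′ 1# - k ×′ 1#
    ⟦⊖⟧ m       zero    = sym (trans (+-congˡ -0#≈0#) (+-identityʳ _))
    ⟦⊖⟧ zero    (suc k) = sym (+-identityˡ _)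
    ⟦⊖⟧ (suc m) (suc k) = S.begin
      ⟦ suc m ℤ.⊖ suc k ⟧ℤ                S.≡⟨ ≡.cong ⟦_⟧ℤ (ℤ.[1+m]⊖[1+n]≡m⊖n m k) ⟩
      ⟦ m ℤ.⊖ k ⟧ℤ                        S.≈⟨ ⟦⊖⟧ m k ⟩
      m ×′ 1# - k ×′ 1#                     S.≈⟨ +-congˡ (+-identityˡ _) ⟨
      m ×′ 1# + (0# - k ×′ 1#)              S.≈⟨ +-congˡ (+-congʳ (-‿inverseʳ 1#)) ⟨
      m ×′ 1# + (1# - 1# - k ×′ 1#)         S.≈⟨ +-congˡ (+-assoc _ _ _) ⟩
      m ×′ 1# + (1# + (- 1# - k ×′ 1#))     S.≈⟨ +-assoc _ _ _ ⟨
      m ×′ 1# + 1# + (- 1# - k ×′ 1#)       S.≈⟨ +-cong (+-comm _ _) (⁻¹-∙-comm _ _) ⟩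
      1# + m ×′ 1# - (1# + k ×′ 1#)         S.≈⟨ +-cong (1+× m 1#) (-‿cong (1+× k 1#)) ⟨
      suc m ×′ 1# - suc k ×′ 1#             S.∎

    ⟦◃⟧ : ∀ m → ⟦ Sign.- ℤ.◃ m ⟧ℤ ≈ - (m ×′ 1#)
    ⟦◃⟧ zero    = sym -0#≈0#
    ⟦◃⟧ (suc m) = refl

    ⟦+◃⟧ : ∀ m → ⟦ Sign.+ ℤ.◃ m ⟧ℤ ≈ m ×′ 1#
    ⟦+◃⟧ zero    = refl
    ⟦+◃⟧ (suc m) = refl

    +-homo : ∀ i j → ⟦ i ℤ.+ j ⟧ℤ ≈ ⟦ i ⟧ℤ + ⟦ j ⟧ℤ
    +-homo (+ m)    (+ k)    = ×-homo-+ 1# m k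
    +-homo (+ m)    -[1+ k ] = ⟦⊖⟧ m (suc k)
    +-homo -[1+ m ] (+ k)    = trans (⟦⊖⟧ k (suc m)) (+-comm _ _)
    +-homo -[1+ m ] -[1+ k ] = trans
      (-‿cong (trans (reflexive (≡.cong (_×′ 1#) (≡.cong suc (≡.sym (ℕ.+-suc m k))))) (×-homo-+ 1# (suc m) (suc k))))
      (sym (⁻¹-∙-comm _ _))

    *-homo : ∀ i j → ⟦ i ℤ.* j ⟧ℤ ≈ ⟦ i ⟧ℤ * ⟦ j ⟧ℤ
    *-homo (+ m)    (+ k)    = trans (⟦+◃⟧ (m ℕ.* k)) (×1-homo-* m k)
    *-homo (+ m)    -[1+ k ] = trans (⟦◃⟧ (m ℕ.* suc k))
      (trans (-‿cong (×1-homo-* m (suc k))) (-‿distribʳ-* _ _))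
    *-homo -[1+ m ] (+ k)    = trans (⟦◃⟧ (suc m ℕ.* k))
      (trans (-‿cong (×1-homo-* (suc m) k)) (-‿distribˡ-* _ _))
    *-homo -[1+ m ] -[1+ k ] = trans (×1-homo-* (suc m) (suc k))
      (sym (trans (sym (-‿distribˡ-* _ _))
        (trans (-‿cong (sym (-‿distribʳ-* _ _))) (-‿involutive _))))

    -‿homo : ∀ i → ⟦ ℤ.- i ⟧ℤ ≈ - ⟦ i ⟧ℤ
    -‿homo (+ zero)  = sym -0#≈0#
    -‿homo (+ suc m) = refl
    -‿homo -[1+ m ]  = sym (-‿involutive _)

    almostCommutativeRing : AlmostCommutativeRing c ℓ₁
    almostCommutativeRing = fromCommutativeRing commutativeRing

    morphism : ℤ.+-*-rawRing -Raw-AlmostCommutative⟶ almostCommutativeRing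
    morphism = record
      { ⟦_⟧ = ⟦_⟧ℤ ; +-homo = +-homo ; *-homo = *-homo ; -‿homo = -‿homo
      ; 0-homo = refl ; 1-homo = refl }

    coefficient≟ : (i j : ℤ) → Maybe (⟦ i ⟧ℤ ≈ ⟦ j ⟧ℤ)
    coefficient≟ i j with i ℤ.≟ j
    ... | yes i≡j = just (reflexive (≡.cong ⟦_⟧ℤ i≡j))
    ... | no  _   = nothing

  open RingSolver ℤ.+-*-rawRing almostCommutativeRing morphism coefficient≟ public
    using (solve; _:=_; _:+_; _:*_; :-_; _:-_) renaming (con to num)

  module ≈-Reasoning = SetoidReasoning setoid

  -- As `_≤_` is the negation of the reversed strict order, asymmetry is already the claim.
  <⇒≤ : ∀ {x y} → x < y → x ≤ y
  <⇒≤ = <-asym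

  ≤-reflexive : ∀ {x y} → x ≈ y → x ≤ y
  ≤-reflexive eq y<x = <-irrefl (sym eq) y<x

  ≤-refl : ∀ {x} → x ≤ x
  ≤-refl = ≤-reflexive refl

  ≰⇒> : ∀ {x y} → ¬ x ≤ y → y < x
  ≰⇒> {x} {y} x≰y with y <? x
  ... | yes y<x = y<x
  ... | no  y≮x = ⊥-elim (x≰y y≮x)

  ≈-stable : ∀ {x y} → ¬ ¬ x ≈ y → x ≈ y
  ≈-stable {x} {y} ¬¬x≈y with x ≟ y
  ... | yes x≈y = x≈y
  ... | no  x≉y = ⊥-elim (¬¬x≈y x≉y)

  <-≤-trans : ∀ {x y z} → x < y → y ≤ z → x < z
  <-≤-trans {x} {y} {z} x<y y≤z with compare x z
  ... | tri< x<z _ _ = x<z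
  ... | tri≈ _ x≈z _ = ⊥-elim (y≤z (<-respˡ x≈z x<y))
  ... | tri> _ _ z<x = ⊥-elim (y≤z (<-trans z<x x<y))

  ≤-<-trans : ∀ {x y z} → x ≤ y → y < z → x < z
  ≤-<-trans {x} {y} {z} x≤y y<z with compare x z
  ... | tri< x<z _ _ = x<z
  ... | tri≈ _ x≈z _ = ⊥-elim (x≤y (<-respʳ (sym x≈z) y<z))
  ... | tri> _ _ z<x = ⊥-elim (x≤y (<-trans y<z z<x))

  ≤-trans : ∀ {x y z} → x ≤ y → y ≤ z → x ≤ z
  ≤-trans x≤y y≤z z<x = y≤z (<-≤-trans z<x x≤y)

  ≤-antisym : ∀ {x y} → x ≤ y → y ≤ x → x ≈ y
  ≤-antisym {x} {y} x≤y y≤x with compare x y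
  ... | tri< x<y _ _ = ⊥-elim (y≤x x<y)
  ... | tri≈ _ x≈y _ = x≈y
  ... | tri> _ _ y<x = ⊥-elim (x≤y y<x)

  ≤-respʳ : ∀ {x y z} → y ≈ z → x ≤ y → x ≤ z
  ≤-respʳ y≈z x≤y = ≤-trans x≤y (≤-reflexive y≈z)

  ≤-respˡ : ∀ {x y z} → x ≈ y → x ≤ z → y ≤ z
  ≤-respˡ x≈y x≤z = ≤-trans (≤-reflexive (sym x≈y)) x≤z

  ≤-split : ∀ {x y} → x ≤ y → x < y ⊎ x ≈ y
  ≤-split {x} {y} x≤y with compare x y
  ... | tri< x<y _ _ = inj₁ x<y
  ... | tri≈ _ x≈y _ = inj₂ x≈y
  ... | tri> _ _ y<x = ⊥-elim (x≤y y<x)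

  +-monoʳ-< : ∀ z {x y} → x < y → z + x < z + y
  +-monoʳ-< z x<y = <-respʳ (+-comm _ _) (<-respˡ (+-comm _ _) (+-monoˡ-< z x<y))

  0<y-x : ∀ {x y} → x < y → 0# < y - x
  0<y-x {x} x<y = <-respˡ (-‿inverseʳ x) (+-monoˡ-< (- x) x<y)

  private
    y-x+x : ∀ x y → y - x + x ≈ y
    y-x+x = solve 2 (λ x y → y :- x :+ x := y) refl

  diff⇒< : ∀ {x y} → 0# < y - x → x < y
  diff⇒< {x} {y} p = <-respʳ (y-x+x x y) (<-respˡ (+-identityˡ x) (+-monoˡ-< x p))

  0≤y-x : ∀ {x y} → x ≤ y → 0# ≤ y - x
  0≤y-x {x} {y} x≤y y-x<0 = x≤y (<-respʳ (+-identityˡ x) (<-respˡ (y-x+x x y) (+-monoˡ-< x y-x<0)))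

  diff⇒≤ : ∀ {x y} → 0# ≤ y - x → x ≤ y
  diff⇒≤ {x} {y} p y<x = p (<-respʳ (-‿inverseʳ x) (+-monoˡ-< (- x) y<x))

  +-mono-<-≤ : ∀ {x y u v} → x < y → u ≤ v → x + u < y + v
  +-mono-<-≤ {x} {y} {u} {v} x<y u≤v with ≤-split u≤v
  ... | inj₁ u<v = <-trans (+-monoˡ-< u x<y) (+-monoʳ-< y u<v)
  ... | inj₂ u≈v = <-respʳ (+-congˡ u≈v) (+-monoˡ-< u x<y)

  +-mono-≤-< : ∀ {x y u v} → x ≤ y → u < v → x + u < y + v
  +-mono-≤-< p q = <-respʳ (+-comm _ _) (<-respˡ (+-comm _ _) (+-mono-<-≤ q p))

  +-mono-≤ : ∀ {x y u v} → x ≤ y → u ≤ v → x + u ≤ y + v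
  +-mono-≤ {x} {y} {u} {v} x≤y u≤v with ≤-split x≤y
  ... | inj₁ x<y = <⇒≤ (+-mono-<-≤ x<y u≤v)
  ... | inj₂ x≈y with ≤-split u≤v
  ...   | inj₁ u<v = <⇒≤ (+-mono-≤-< x≤y u<v)
  ...   | inj₂ u≈v = ≤-reflexive (+-cong x≈y u≈v)

  0≤+ : ∀ {x y} → 0# ≤ x → 0# ≤ y → 0# ≤ x + y
  0≤+ p q = ≤-respˡ (+-identityˡ 0#) (+-mono-≤ p q)

  0<+ : ∀ {x y} → 0# < x → 0# ≤ y → 0# < x + y
  0<+ p q = <-respˡ (+-identityˡ 0#) (+-mono-<-≤ p q)

  0<+ʳ : ∀ {x y} → 0# ≤ x → 0# < y → 0# < x + y
  0<+ʳ p q = <-respˡ (+-identityˡ 0#) (+-mono-≤-< p q)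

  0<- : ∀ {x} → x < 0# → 0# < - x
  0<- {x} p = <-respʳ (+-identityˡ (- x)) (0<y-x p)

  0≤- : ∀ {x} → x ≤ 0# → 0# ≤ - x
  0≤- {x} p = ≤-respʳ (+-identityˡ (- x)) (0≤y-x p)

  -≤0 : ∀ {x} → 0# ≤ x → - x ≤ 0#
  -≤0 {x} p = diff⇒≤ (≤-respʳ (solve 1 (λ x → x := num (+ 0) :- (:- x)) refl x) p)

  0≤* : ∀ {x y} → 0# ≤ x → 0# ≤ y → 0# ≤ x * y
  0≤* p q with ≤-split p | ≤-split q
  ... | inj₁ 0<x | inj₁ 0<y = <⇒≤ (*-pos 0<x 0<y)
  ... | inj₂ 0≈x | _        = ≤-reflexive (sym (trans (*-congʳ (sym 0≈x)) (zeroˡ _)))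
  ... | inj₁ _   | inj₂ 0≈y = ≤-reflexive (sym (trans (*-congˡ (sym 0≈y)) (zeroʳ _)))

  0<² : ∀ {x} → ¬ x ≈ 0# → 0# < x * x
  0<² {x} x≉0 with compare x 0#
  ... | tri< x<0 _ _ = <-respʳ (solve 1 (λ x → (:- x) :* (:- x) := x :* x) refl x)
                         (*-pos (0<- x<0) (0<- x<0))
  ... | tri≈ _ x≈0 _ = ⊥-elim (x≉0 x≈0)
  ... | tri> _ _ 0<x = *-pos 0<x 0<x

  0≤² : ∀ x → 0# ≤ x * x
  0≤² x with x ≟ 0#
  ... | yes x≈0 = ≤-reflexive (sym (trans (*-congʳ x≈0) (zeroˡ x)))
  ... | no  x≉0 = <⇒≤ (0<² x≉0)

  >⇒≉ : ∀ {x} → 0# < x → ¬ x ≈ 0#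
  >⇒≉ 0<x x≈0 = <-irrefl (sym x≈0) 0<x

  ²≈0 : ∀ {x} → x * x ≤ 0# → x ≈ 0#
  ²≈0 {x} p with x ≟ 0#
  ... | yes x≈0 = x≈0
  ... | no  x≉0 = ⊥-elim (p (0<² x≉0))

  0<⁻¹ : ∀ {x} → 0# < x → 0# < x ⁻¹
  0<⁻¹ {x} 0<x with compare (x ⁻¹) 0#
  ... | tri> _ _ p = p
  ... | tri≈ _ p _ = ⊥-elim (1≉0 (trans (sym (*-inverseʳ (>⇒≉ 0<x))) (trans (*-congˡ p) (zeroʳ x))))
  -- A negative inverse would make `x * - x ⁻¹` positive, but this product is minus one.
  ... | tri< p _ _ = ⊥-elim (<-asym 0<1 (diff⇒< (<-respʳ
          (trans (sym (-‿distribʳ-* _ _)) (trans (-‿cong (*-inverseʳ (>⇒≉ 0<x))) (sym (+-identityˡ _))))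
          (*-pos 0<x (0<- p)))))

  *-inverseˡ : ∀ {x} → ¬ x ≈ 0# → x ⁻¹ * x ≈ 1#
  *-inverseˡ p = trans (*-comm _ _) (*-inverseʳ p)

  *-cancelˡ : ∀ {a x y} → ¬ a ≈ 0# → a * x ≈ a * y → x ≈ y
  *-cancelˡ {a} {x} {y} a≉0 eq = begin
    x              ≈⟨ *-identityˡ x ⟨
    1# * x         ≈⟨ *-congʳ (*-inverseˡ a≉0) ⟨
    a ⁻¹ * a * x   ≈⟨ *-assoc _ _ _ ⟩
    a ⁻¹ * (a * x) ≈⟨ *-congˡ eq ⟩
    a ⁻¹ * (a * y) ≈⟨ *-assoc _ _ _ ⟨
    a ⁻¹ * a * y   ≈⟨ *-congʳ (*-inverseˡ a≉0) ⟩
    1# * y         ≈⟨ *-identityˡ y ⟩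
    y              ∎
    where open ≈-Reasoning

  *-zero-cancel : ∀ {a x} → ¬ a ≈ 0# → a * x ≈ 0# → x ≈ 0#
  *-zero-cancel {a} a≉0 eq = *-cancelˡ a≉0 (trans eq (sym (zeroʳ a)))

  0≤*-cancel : ∀ {a x} → 0# < a → 0# ≤ a * x → 0# ≤ x
  0≤*-cancel {a} {x} 0<a 0≤ax x<0 = 0≤ax (diff⇒< (<-respʳ
    (solve 2 (λ a x → a :* (:- x) := num (+ 0) :- a :* x) refl a x) (*-pos 0<a (0<- x<0))))

  *-monoˡ-≤ : ∀ {a x y} → 0# ≤ a → x ≤ y → a * x ≤ a * y
  *-monoˡ-≤ {a} {x} {y} 0≤a p = diff⇒≤ (≤-respʳ
    (solve 3 (λ a x y → a :* (y :- x) := a :* y :- a :* x) refl a x y) (0≤* 0≤a (0≤y-x p)))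

  *-monoˡ-< : ∀ {a x y} → 0# < a → x < y → a * x < a * y
  *-monoˡ-< {a} {x} {y} 0<a p = diff⇒< (<-respʳ
    (solve 3 (λ a x y → a :* (y :- x) := a :* y :- a :* x) refl a x y) (*-pos 0<a (0<y-x p)))

  ≈⇒-≈0 : ∀ {x y} → x ≈ y → x - y ≈ 0#
  ≈⇒-≈0 {x} {y} eq = trans (+-congʳ eq) (-‿inverseʳ y)

  -≈0⇒≈ : ∀ {x y} → x - y ≈ 0# → x ≈ y
  -≈0⇒≈ = x∙y⁻¹≈ε⇒x≈y _ _

-- Linear forms, symmetric bilinear forms and Rayleigh quotients.

module LinearAlgebra {c ℓ₁ ℓ₂} (ℝ : RealNumbers c ℓ₁ ℓ₂) where

  open OrderedField ℝ
  open SemiringSum semiring public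
    using (sum; sum-cong-≋; ∑-distrib-+; ∑-comm; *-distribˡ-sum; *-distribʳ-sum; sum-replicate-zero)

  lin : ∀ {I : Set} → Carrier → (I → Carrier) → Carrier → (I → Carrier) → I → Carrier
  lin s x r y i = s * x i + r * y i

  -- Vectors are functions compared pointwise up to `≈`, so respecting this relation has to be part
  -- of linearity.
  record IsLinear {I : Set} (f : (I → Carrier) → Carrier) : Set (c ⊔ ℓ₁) where
    field
      cong   : ∀ {x y} → (∀ i → x i ≈ y i) → f x ≈ f y
      linear : ∀ s x r y → f (lin s x r y) ≈ s * f x + r * f y

    vanish : ∀ {x} → (∀ i → x i ≈ 0#) → f x ≈ 0#
    vanish {x} x≈0 = trans
      (cong λ i → trans (x≈0 i) (sym (trans (+-cong (zeroˡ _) (zeroˡ _)) (+-identityˡ 0#))))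
      (trans (linear 0# x 0# x) (trans (+-cong (zeroˡ _) (zeroˡ _)) (+-identityˡ 0#)))

    scale : ∀ s x → f (λ i → s * x i) ≈ s * f x
    scale s x = trans (cong λ i → sym (trans (+-congˡ (zeroˡ _)) (+-identityʳ _)))
      (trans (linear s x 0# x) (trans (+-congˡ (zeroˡ _)) (+-identityʳ _)))

  Pairing : Set → Set c
  Pairing I = (I → Carrier) → (I → Carrier) → Carrier

  record IsForm {I : Set} (B : Pairing I) : Set (c ⊔ ℓ₁) where
    field
      symmetric : ∀ x y → B x y ≈ B y x
      linearˡ   : ∀ y → IsLinear (λ x → B x y)

    linearʳ : ∀ x → IsLinear (B x)
    linearʳ x = record
      { cong   = λ e → trans (symmetric _ _) (trans (IsLinear.cong (linearˡ x) e) (symmetric _ _))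
      ; linear = λ s y r z → trans (symmetric _ _) (trans (IsLinear.linear (linearˡ x) s y r z)
          (+-cong (*-congˡ (symmetric _ _)) (*-congˡ (symmetric _ _)))) }

    cong₂ : ∀ {x x′ y y′} → (∀ i → x i ≈ x′ i) → (∀ i → y i ≈ y′ i) → B x y ≈ B x′ y′
    cong₂ e e′ = trans (IsLinear.cong (linearˡ _) e) (IsLinear.cong (linearʳ _) e′)

    expand : ∀ s x r y → B (lin s x r y) (lin s x r y) ≈
             s * s * B x x + (s * r + s * r) * B x y + r * r * B y y
    expand s x r y = begin
      B (lin s x r y) (lin s x r y)
        ≈⟨ IsLinear.linear (linearˡ _) s x r y ⟩
      s * B x (lin s x r y) + r * B y (lin s x r y)
        ≈⟨ +-cong (*-congˡ (IsLinear.linear (linearʳ x) s x r y))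
                  (*-congˡ (trans (IsLinear.linear (linearʳ y) s x r y) (+-congʳ (*-congˡ (symmetric y x))))) ⟩
      s * (s * B x x + r * B x y) + r * (s * B x y + r * B y y)
        ≈⟨ solve 5 (λ s r a b c → s :* (s :* a :+ r :* b) :+ r :* (s :* b :+ r :* c) :=
             s :* s :* a :+ (s :* r :+ s :* r) :* b :+ r :* r :* c) refl s r (B x x) (B x y) (B y y) ⟩
      s * s * B x x + (s * r + s * r) * B x y + r * r * B y y ∎
      where open ≈-Reasoning

    -- B (r y + s z, r y + s z) ≥ 0 at r = c + 1, s = - b with b = B y z and c = B z z.
    null⇒kernel : (∀ x → 0# ≤ B x x) → ∀ {y} → B y y ≈ 0# → ∀ z → B y z ≈ 0#
    null⇒kernel psd {y} Byy≈0 z = ²≈0 λ 0<bb → psd v (diff⇒< (<-respʳ (sym value)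
        (*-pos 0<bb (0<+ʳ (psd z) (0<+ 0<1 (<⇒≤ 0<1))))))
      where
      b = B y z
      c′ = B z z
      v = lin (c′ + 1#) y (- b) z
      value : 0# - B v v ≈ b * b * (c′ + (1# + 1#))
      value = trans (+-congˡ (-‿cong (trans (expand (c′ + 1#) y (- b) z)
                (+-congʳ (+-congʳ (trans (*-congˡ Byy≈0) (zeroʳ _)))))))
              (solve 2 (λ b c → num (+ 0) :- (num (+ 0) :+ ((c :+ num (+ 1)) :* (:- b) :+ (c :+ num (+ 1)) :* (:- b)) :* b
                 :+ (:- b) :* (:- b) :* c) := b :* b :* (c :+ (num (+ 1) :+ num (+ 1)))) refl b c′)

  -- A coordinate-free bound on the positive index of inertia. The index set may be infinite in
  -- principle, and no eigenvalues are mentioned. The form `f` may be zero, and then `B` is negative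
  -- semidefinite.
  AtMostOnePositive : {I : Set} → Pairing I → Set (c ⊔ ℓ₁ ⊔ ℓ₂)
  AtMostOnePositive B = ∃ λ f → IsLinear f × (∀ x → f x ≈ 0# → B x x ≤ 0#)

  module _ {I : Set} {B : Pairing I} (form : IsForm B)
           (amop : AtMostOnePositive B) where

    open IsForm form
    private
      f = proj₁ amop
      f-linear = proj₁ (proj₂ amop)
      nonpos = proj₂ (proj₂ amop)

    -- If `B z z` were positive, so would be the value of `B` at the combination of `w` and `z` that
    -- `f` kills, as the cross term is zero. If `f w` vanishes, `w` itself already contradicts the
    -- hypothesis on `f`.
    nonpositive-on-orthogonal : ∀ {w z} → 0# < B w w → B w z ≈ 0# → B z z ≤ 0#
    nonpositive-on-orthogonal {w} {z} 0<Bww Bwz≈0 0<Bzz = case f w ≟ 0# of λ where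
        (yes fw≈0) → nonpos w fw≈0 0<Bww
        (no  fw≉0) → nonpos v fv≈0 (<-respʳ (sym value)
          (0<+ (*-pos (0<² fw≉0) 0<Bzz) (0≤* (0≤² (f z)) (<⇒≤ 0<Bww))))
      where
      v = lin (f z) w (- f w) z
      fv≈0 : f v ≈ 0#
      fv≈0 = trans (IsLinear.linear f-linear _ _ _ _)
        (solve 2 (λ a b → a :* b :+ (:- b) :* a := num (+ 0)) refl (f z) (f w))
      value : B v v ≈ f w * f w * B z z + f z * f z * B w w
      value = trans (expand _ _ _ _) (trans (+-congʳ (+-congˡ (trans (*-congˡ Bwz≈0) (zeroʳ _))))
        (solve 4 (λ a b p q → b :* b :* p :+ num (+ 0) :+ (:- a) :* (:- a) :* q := a :* a :* q :+ b :* b :* p)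
          refl (f w) (f z) (B w w) (B z z)))

    -- The component of `x` orthogonal to `w`, scaled by `B w w` to avoid a division, has a
    -- nonpositive value, and this value is `B w w` times the difference of the two sides.
    reverse-Cauchy-Schwarz : ∀ {w} → 0# < B w w → ∀ x → B w w * B x x ≤ B x w * B x w
    reverse-Cauchy-Schwarz {w} 0<Bww x = diff⇒≤ (0≤*-cancel 0<Bww (≤-respʳ value
        (0≤- (nonpositive-on-orthogonal 0<Bww ortho))))
      where
      v = lin (B w w) x (- B x w) w
      ortho : B w v ≈ 0#
      ortho = trans (IsLinear.linear (linearʳ w) _ _ _ _) (trans (+-congʳ (*-congˡ (symmetric w x)))
        (solve 2 (λ a b → a :* b :+ (:- b) :* a := num (+ 0)) refl (B w w) (B x w)))
      value : - B v v ≈ B w w * (B x w * B x w - B w w * B x x)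
      value = trans (-‿cong (expand _ _ _ _))
        (solve 3 (λ a b d → :- (a :* a :* d :+ (a :* (:- b) :+ a :* (:- b)) :* b :+ (:- b) :* (:- b) :* a)
           := a :* (b :* b :- a :* d)) refl (B w w) (B x w) (B x x))

  0≤sum : ∀ {n} {f : Fin n → Carrier} → (∀ i → 0# ≤ f i) → 0# ≤ sum f
  0≤sum {zero}  p = ≤-refl
  0≤sum {suc n} p = 0≤+ (p zero) (0≤sum (p ∘ suc))

  sum-mono : ∀ {n} {f g : Fin n → Carrier} → (∀ i → f i ≤ g i) → sum f ≤ sum g
  sum-mono {zero}  p = ≤-refl
  sum-mono {suc n} p = +-mono-≤ (p zero) (sum-mono (p ∘ suc))

  term≤sum : ∀ {n} {f : Fin n → Carrier} → (∀ i → 0# ≤ f i) → ∀ i → f i ≤ sum f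
  term≤sum {suc n} p zero    = ≤-respˡ (+-identityʳ _) (+-mono-≤ ≤-refl (0≤sum (p ∘ suc)))
  term≤sum {suc n} p (suc i) = ≤-trans (term≤sum (p ∘ suc) i)
    (≤-respˡ (+-identityˡ _) (+-mono-≤ (p zero) ≤-refl))

  sum-zero⇒zero : ∀ {n} {f : Fin n → Carrier} → (∀ i → 0# ≤ f i) → sum f ≤ 0# → ∀ i → f i ≈ 0#
  sum-zero⇒zero p q i = ≤-antisym (≤-trans (term≤sum p i) q) (p i)

  0<sum : ∀ {n} {f : Fin n → Carrier} → (∀ i → 0# ≤ f i) → ∀ i → 0# < f i → 0# < sum f
  0<sum p i q = <-≤-trans q (term≤sum p i)

  sum-zero : ∀ {n} {f : Fin n → Carrier} → (∀ i → f i ≈ 0#) → sum f ≈ 0#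
  sum-zero {n} p = trans (sum-cong-≋ p) (sum-replicate-zero n)

  sum-linear : ∀ {n} (g : Fin n → Carrier) → IsLinear (λ x → sum (λ i → x i * g i))
  sum-linear {n} g = record
    { cong   = λ e → sum-cong-≋ λ i → *-congʳ (e i)
    ; linear = λ s x r y → trans (sum-cong-≋ λ i →
          solve 5 (λ s x r y g → (s :* x :+ r :* y) :* g := s :* (x :* g) :+ r :* (y :* g)) refl s (x i) r (y i) (g i))
        (trans (∑-distrib-+ (λ i → s * (x i * g i)) (λ i → r * (y i * g i)))
               (sym (+-cong (*-distribˡ-sum s (λ i → x i * g i)) (*-distribˡ-sum r (λ i → y i * g i))))) }

  -- Only squares of norms occur, so no square roots are needed. Positivity of this number is also
  -- the form in which a vector is said to be nonzero.
  ∥_∥² : ∀ {n} → (Fin n → Carrier) → Carrier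
  ∥ x ∥² = sum (λ i → x i * x i)

  0≤∥∥² : ∀ {n} (x : Fin n → Carrier) → 0# ≤ ∥ x ∥²
  0≤∥∥² x = 0≤sum λ i → 0≤² (x i)

  e : ∀ {n} → Fin n → Fin n → Carrier
  e zero    zero    = 1#
  e zero    (suc j) = 0#
  e (suc i) zero    = 0#
  e (suc i) (suc j) = e i j

  private
    split : ∀ {n} (x : Fin (suc n) → Carrier) i → x i ≈ lin (x zero) (e zero) 1# (0# ◂ (x ∘ suc)) i
    split x zero    = sym (trans (+-cong (*-identityʳ _) (*-identityˡ 0#)) (+-identityʳ _))
    split x (suc i) = sym (trans (+-cong (zeroʳ _) (*-identityˡ _)) (+-identityˡ _))

    0◂lin : ∀ {n} s (x : Fin n → Carrier) r y i → (0# ◂ lin s x r y) i ≈ lin s (0# ◂ x) r (0# ◂ y) i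
    0◂lin s x r y zero    = sym (trans (+-cong (zeroʳ s) (zeroʳ r)) (+-identityˡ 0#))
    0◂lin s x r y (suc i) = refl

    0◂cong : ∀ {n} {x y : Fin n → Carrier} → (∀ i → x i ≈ y i) → ∀ i → (0# ◂ x) i ≈ (0# ◂ y) i
    0◂cong p zero    = refl
    0◂cong p (suc i) = p i

    tail-linear : ∀ {n} {f : (Fin (suc n) → Carrier) → Carrier} → IsLinear f → IsLinear (λ y → f (0# ◂ y))
    tail-linear f-linear = record
      { cong   = λ p → IsLinear.cong f-linear (0◂cong p)
      ; linear = λ s x r y → trans (IsLinear.cong f-linear (0◂lin s x r y)) (IsLinear.linear f-linear s _ r _) }

    tail-form : ∀ {n} {B : Pairing (Fin (suc n))} →
                IsForm B → IsForm (λ x y → B (0# ◂ x) (0# ◂ y))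
    tail-form form = record
      { symmetric = λ x y → IsForm.symmetric form _ _
      ; linearˡ   = λ y → tail-linear (IsForm.linearˡ form (0# ◂ y)) }

    expand-head : ∀ {n} {B : Pairing (Fin (suc n))} →
                  IsForm B → ∀ x → B x x ≈ x zero * x zero * B (e zero) (e zero) +
                    (x zero + x zero) * B (e zero) (0# ◂ (x ∘ suc)) + B (0# ◂ (x ∘ suc)) (0# ◂ (x ∘ suc))
    expand-head {B = B} form x = trans (IsForm.cong₂ form (split x) (split x))
      (trans (IsForm.expand form _ _ _ _)
        (solve 4 (λ x a b d → x :* x :* a :+ (x :* num (+ 1) :+ x :* num (+ 1)) :* b :+ num (+ 1) :* num (+ 1) :* d
            := x :* x :* a :+ (x :+ x) :* b :+ d) refl (x zero) (B (e zero) (e zero)) _ _))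

  linear-basis : ∀ {n} {f : (Fin n → Carrier) → Carrier} → IsLinear f → ∀ x → f x ≈ sum (λ i → x i * f (e i))
  linear-basis {zero}  {f} f-linear x = IsLinear.vanish f-linear λ ()
  linear-basis {suc n} {f} f-linear x = begin
    f x                                                   ≈⟨ IsLinear.cong f-linear (split x) ⟩
    f (lin (x zero) (e zero) 1# (0# ◂ (x ∘ suc)))          ≈⟨ IsLinear.linear f-linear _ _ _ _ ⟩
    x zero * f (e zero) + 1# * f (0# ◂ (x ∘ suc))
      ≈⟨ +-congˡ (trans (*-identityˡ _) (linear-basis (tail-linear f-linear) (x ∘ suc))) ⟩
    x zero * f (e zero) + sum (λ i → x (suc i) * f (0# ◂ e i))
      ≈⟨ +-congˡ (sum-cong-≋ {n} λ i → *-congˡ (IsLinear.cong f-linear {0# ◂ e i} {e (suc i)} λ { zero → refl ; (suc j) → refl })) ⟩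
    x zero * f (e zero) + sum (λ i → x (suc i) * f (e (suc i))) ∎
    where open ≈-Reasoning

  2x²+2y² : ∀ x y → (x + y) * (x + y) ≤ (x * x + x * x) + (y * y + y * y)
  2x²+2y² x y = diff⇒≤ (≤-respʳ (solve 2 (λ x y → (x :- y) :* (x :- y) :=
    (x :* x :+ x :* x) :+ (y :* y :+ y :* y) :- (x :+ y) :* (x :+ y)) refl x y) (0≤² (x - y)))

  linear-bounded : ∀ {n} {f : (Fin n → Carrier) → Carrier} → IsLinear f →
                   ∃ λ k → 0# ≤ k × (∀ x → f x * f x ≤ k * ∥ x ∥²)
  linear-bounded {zero} {f} f-linear = 0# , ≤-refl , λ x → ≤-reflexive
    (trans (*-congʳ (IsLinear.vanish f-linear λ ())) (trans (zeroˡ _) (sym (zeroˡ _))))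
  linear-bounded {suc n} {f} f-linear with linear-bounded (tail-linear f-linear)
  ... | k , 0≤k , bound = (a * a + a * a) + (k + k) , 0≤+ (0≤+ (0≤² a) (0≤² a)) (0≤+ 0≤k 0≤k) , λ x →
    let x₀ = x zero ; y = x ∘ suc ; g = f (0# ◂ y) in
    ≤-trans (≤-reflexive (*-cong (fx≈ x) (fx≈ x))) (≤-trans (2x²+2y² (x₀ * a) g)
      (≤-trans (+-mono-≤ ≤-refl (+-mono-≤ (bound y) (bound y))) (diff⇒≤ (≤-respʳ
        (solve 4 (λ x a k Y → (k :+ k) :* (x :* x) :+ (a :* a :+ a :* a) :* Y :=
          ((a :* a :+ a :* a) :+ (k :+ k)) :* (x :* x :+ Y) :-
          ((x :* a :* (x :* a) :+ x :* a :* (x :* a)) :+ (k :* Y :+ k :* Y))) refl x₀ a k ∥ y ∥²)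
        (0≤+ (0≤* (0≤+ 0≤k 0≤k) (0≤² x₀)) (0≤* (0≤+ (0≤² a) (0≤² a)) (0≤∥∥² y)))))))
    where
    a = f (e zero)
    fx≈ : ∀ x → f x ≈ x zero * a + f (0# ◂ (x ∘ suc))
    fx≈ x = trans (IsLinear.cong f-linear (split x)) (trans (IsLinear.linear f-linear _ _ _ _)
      (+-congˡ (*-identityˡ _)))

  form-bounded : ∀ {n} {B : Pairing (Fin n)} → IsForm B →
                 ∃ λ k → 0# < k × (∀ x → B x x ≤ k * ∥ x ∥²)
  form-bounded {zero} form = 1# , 0<1 , λ x → ≤-reflexive
    (trans (IsLinear.vanish (IsForm.linearˡ form x) λ ()) (sym (zeroʳ 1#)))
  form-bounded {suc n} {B} form
    with form-bounded (tail-form form) | linear-bounded (tail-linear (IsForm.linearʳ form (e zero)))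
  ... | k , 0<k , bound | h , 0≤h , bound′ = k′ , 0<k′ , λ x →
    let x₀ = x zero ; Y = ∥ x ∘ suc ∥² ; b = B (e zero) (0# ◂ (x ∘ suc)) ; d = B (0# ◂ (x ∘ suc)) (0# ◂ (x ∘ suc))
    in ≤-trans (≤-reflexive (expand-head form x)) (diff⇒≤ (≤-respʳ
      (solve 7 (λ x a b d h k Y →
          (x :- b) :* (x :- b) :+ (h :* Y :- b :* b) :+ (k :* Y :- d) :+ (h :+ k) :* (x :* x)
            :+ (a :* a :+ num (+ 2)) :* Y :+ (a :* a :- a :+ num (+ 1)) :* (x :* x)
          := (a :* a :+ num (+ 2) :+ h :+ k) :* (x :* x :+ Y) :- (x :* x :* a :+ (x :+ x) :* b :+ d))
        refl x₀ (B (e zero) (e zero)) b d h k Y)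
      (0≤+ (0≤+ (0≤+ (0≤+ (0≤+ (0≤² _) (0≤y-x (bound′ _))) (0≤y-x (bound _)))
        (0≤* (0≤+ 0≤h (<⇒≤ 0<k)) (0≤² x₀))) (0≤* (0≤+ (0≤² _) 0≤2) (0≤∥∥² (x ∘ suc))))
        (0≤* (0≤a²-a+1 _) (0≤² x₀)))))
    where
    a = B (e zero) (e zero)
    0≤2 : 0# ≤ 1# + 1#
    0≤2 = 0≤+ (<⇒≤ 0<1) (<⇒≤ 0<1)
    -- `k` bounds the form on the tail and `h` the square of the mixed term, which enters through
    -- `2 x b ≤ x² + b²`. Whatever the sign of `a`, `a * a` plus two exceeds `a` plus one.
    k′ = a * a + (1# + 1#) + h + k
    0<k′ : 0# < k′
    0<k′ = 0<+ʳ (0≤+ (0≤+ (0≤² a) 0≤2) 0≤h) 0<k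
    0≤a²-a+1 : ∀ a → 0# ≤ a * a - a + 1#
    0≤a²-a+1 a = 0≤*-cancel (0<+ 0<1 (<⇒≤ 0<1)) (≤-respʳ
      (solve 1 (λ a → (a :- num (+ 1)) :* (a :- num (+ 1)) :+ a :* a :+ num (+ 1) :=
        num (+ 2) :* (a :* a :- a :+ num (+ 1))) refl a)
      (0≤+ (0≤+ (0≤² _) (0≤² a)) (<⇒≤ 0<1)))

  -- Completing the square in the first coordinate reduces to its Schur complement.
  null-or-coercive : ∀ {n} {B : Pairing (Fin n)} → IsForm B →
                     (∀ x → 0# ≤ B x x) →
                     (∃ λ x → 0# < ∥ x ∥² × B x x ≈ 0#) ⊎
                     (∃ λ ε → 0# < ε × (∀ x → ε * ∥ x ∥² ≤ B x x))
  null-or-coercive {zero}  form psd = inj₂ (1# , 0<1 , λ x → ≤-trans (≤-reflexive (zeroʳ 1#)) (psd x))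
  null-or-coercive {suc n} {B} form psd with ≤-split (psd (e zero))
  ... | inj₂ 0≈q = inj₁ (e zero , 0<+ (*-pos 0<1 0<1) (0≤∥∥² (λ i → e {suc n} zero (suc i))) , sym 0≈q)
  ... | inj₁ 0<q = conclude (null-or-coercive schur-form schur-psd)
    where
    q = B (e zero) (e zero)
    q⁻¹ = q ⁻¹
    qq⁻¹≈1 = *-inverseʳ (>⇒≉ 0<q)
    b : (Fin n → Carrier) → Carrier
    b y = B (e zero) (0# ◂ y)
    b-linear : IsLinear b
    b-linear = tail-linear (IsForm.linearʳ form (e zero))
    schur : Pairing (Fin n)
    schur x y = B (0# ◂ x) (0# ◂ y) - q⁻¹ * (b x * b y)
    schur-form : IsForm schur
    schur-form = record
      { symmetric = λ x y → +-cong (IsForm.symmetric form _ _) (-‿cong (*-congˡ (*-comm _ _)))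
      ; linearˡ   = λ y → let L = IsForm.linearˡ (tail-form form) y in record
        { cong   = λ p → +-cong (IsLinear.cong L p) (-‿cong (*-congˡ (*-congʳ (IsLinear.cong b-linear p))))
        ; linear = λ s x r z → trans
            (+-cong (IsLinear.linear L s x r z) (-‿cong (*-congˡ (*-congʳ (IsLinear.linear b-linear s x r z)))))
            (solve 8 (λ s r B₁ B₂ q b₁ b₂ b₃ →
                (s :* B₁ :+ r :* B₂) :- q :* ((s :* b₁ :+ r :* b₂) :* b₃) :=
                s :* (B₁ :- q :* (b₁ :* b₃)) :+ r :* (B₂ :- q :* (b₂ :* b₃)))
              refl s r _ _ q⁻¹ (b x) (b z) (b y)) } }
    square : ∀ x → B x x ≈ q * ((x zero + q⁻¹ * b (x ∘ suc)) * (x zero + q⁻¹ * b (x ∘ suc))) + schur (x ∘ suc) (x ∘ suc)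
    square x = begin
      B x x                                          ≈⟨ expand-head form x ⟩
      x₀ * x₀ * q + (x₀ + x₀) * β + d                 ≈⟨ +-congʳ (+-congˡ (trans (sym (*-identityˡ _)) (*-congʳ (sym qq⁻¹≈1)))) ⟩
      x₀ * x₀ * q + q * q⁻¹ * ((x₀ + x₀) * β) + d
        ≈⟨ solve 5 (λ x q r β d → x :* x :* q :+ q :* r :* ((x :+ x) :* β) :+ d :=
             q :* ((x :+ r :* β) :* (x :+ r :* β)) :+ (d :- q :* r :* (r :* (β :* β)))) refl x₀ q q⁻¹ β d ⟩
      q * ((x₀ + q⁻¹ * β) * (x₀ + q⁻¹ * β)) + (d - q * q⁻¹ * (q⁻¹ * (β * β)))
        ≈⟨ +-congˡ (+-congˡ (-‿cong (trans (*-congʳ qq⁻¹≈1) (*-identityˡ _)))) ⟩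
      q * ((x₀ + q⁻¹ * β) * (x₀ + q⁻¹ * β)) + schur (x ∘ suc) (x ∘ suc) ∎
      where
      open ≈-Reasoning
      x₀ = x zero
      β = b (x ∘ suc)
      d = B (0# ◂ (x ∘ suc)) (0# ◂ (x ∘ suc))
    lift-vector : (Fin n → Carrier) → Fin (suc n) → Carrier
    lift-vector y = (- (q⁻¹ * b y)) ◂ y
    B-lift : ∀ y → B (lift-vector y) (lift-vector y) ≈ schur y y
    B-lift y = trans (square (lift-vector y)) (trans (+-congʳ
      (trans (*-congˡ (trans (*-congʳ (-‿inverseˡ _)) (zeroˡ _))) (zeroʳ q))) (+-identityˡ _))
    schur-psd : ∀ y → 0# ≤ schur y y
    schur-psd y = ≤-respʳ (B-lift y) (psd (lift-vector y))
    conclude : (∃ λ x → 0# < ∥ x ∥² × schur x x ≈ 0#) ⊎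
               (∃ λ ε → 0# < ε × (∀ x → ε * ∥ x ∥² ≤ schur x x)) → _
    conclude (inj₁ (y , 0<y , null)) = inj₁ (lift-vector y , 0<+ʳ (0≤² _) 0<y , trans (B-lift y) null)
    conclude (inj₂ (ε , 0<ε , coercive)) with linear-bounded b-linear
    ... | h , 0≤h , bound = inj₂ (q * ε * D ⁻¹ , *-pos (*-pos 0<q 0<ε) (0<⁻¹ 0<D) , λ x →
        let x₀ = x zero ; Y = ∥ x ∘ suc ∥² ; β = q⁻¹ * b (x ∘ suc) ; z = x₀ + β ; σ = schur (x ∘ suc) (x ∘ suc) in
        diff⇒≤ (0≤*-cancel 0<D (≤-respʳ (begin
          q * ε * (2z²+2k z Y - x₀ * x₀) + q * q * (k + k + 1#) * (z * z) + (ε + ε) * (ε * Y) + D * (σ - ε * Y)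
            ≈⟨ solve 7 (λ q ε k z x Y σ →
                 q :* ε :* (z :* z :+ z :* z :+ (k :* Y :+ k :* Y) :- x :* x) :+
                   q :* q :* (k :+ k :+ num (+ 1)) :* (z :* z) :+ (ε :+ ε) :* (ε :* Y) :+
                   (ε :+ ε :+ q :* (k :+ k :+ num (+ 1))) :* (σ :- ε :* Y)
                 := (ε :+ ε :+ q :* (k :+ k :+ num (+ 1))) :* (q :* (z :* z) :+ σ) :- q :* ε :* (x :* x :+ Y))
               refl q ε k z x₀ Y σ ⟩
          D * (q * (z * z) + σ) - q * ε * ∥ x ∥²
            ≈⟨ +-cong (*-congˡ (square x)) (-‿cong (trans (*-congˡ (trans (*-congʳ (*-inverseʳ (>⇒≉ 0<D))) (*-identityˡ _))) refl)) ⟨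
          D * B x x - q * ε * (D * D ⁻¹ * ∥ x ∥²)
            ≈⟨ solve 6 (λ D B q ε E N → D :* B :- q :* ε :* (D :* E :* N) := D :* (B :- q :* ε :* E :* N))
                 refl D (B x x) q ε (D ⁻¹) ∥ x ∥² ⟩
          D * (B x x - q * ε * D ⁻¹ * ∥ x ∥²) ∎)
        (0≤+ (0≤+ (0≤+ (0≤* (<⇒≤ (*-pos 0<q 0<ε)) (0≤y-x (x₀²≤ x)))
          (0≤* (0≤* (<⇒≤ (*-pos 0<q 0<q)) (<⇒≤ 0<2k+1)) (0≤² z)))
          (0≤* (0≤+ (<⇒≤ 0<ε) (<⇒≤ 0<ε)) (0≤* (<⇒≤ 0<ε) (0≤∥∥² (x ∘ suc)))))
          (0≤* (<⇒≤ 0<D) (0≤y-x (coercive (x ∘ suc))))))))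
      where
      open ≈-Reasoning
      k = q⁻¹ * q⁻¹ * h
      0≤k : 0# ≤ k
      0≤k = 0≤* (0≤² q⁻¹) 0≤h
      0<2k+1 : 0# < k + k + 1#
      0<2k+1 = 0<+ʳ (0≤+ 0≤k 0≤k) 0<1
      -- With `z = x₀ + β` one has `x₀² ≤ 2 z² + 2 β²`, and `β²` is at most `k` times the norm of
      -- the tail. `D` is chosen so that this bound and coercivity on the tail together control
      -- `q ε` times the whole norm.
      D = ε + ε + q * (k + k + 1#)
      0<D : 0# < D
      0<D = 0<+ (0<+ 0<ε (<⇒≤ 0<ε)) (<⇒≤ (*-pos 0<q 0<2k+1))
      2z²+2k : Carrier → Carrier → Carrier
      2z²+2k z Y = z * z + z * z + (k * Y + k * Y)
      x₀²≤ : ∀ x → x zero * x zero ≤ 2z²+2k (x zero + q⁻¹ * b (x ∘ suc)) ∥ x ∘ suc ∥²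
      x₀²≤ x = ≤-trans (≤-reflexive (solve 2 (λ x β → x :* x := ((x :+ β) :+ (:- β)) :* ((x :+ β) :+ (:- β)))
                 refl x₀ β)) (≤-trans (2x²+2y² (x₀ + β) (- β)) (+-mono-≤ ≤-refl (+-mono-≤ β² β²)))
        where
        x₀ = x zero
        β = q⁻¹ * b (x ∘ suc)
        β² : - β * - β ≤ k * ∥ x ∘ suc ∥²
        β² = ≤-trans (≤-reflexive (solve 2 (λ r b → (:- (r :* b)) :* (:- (r :* b)) := r :* r :* (b :* b)) refl q⁻¹ (b (x ∘ suc))))
          (≤-trans (*-monoˡ-≤ (0≤² q⁻¹) (bound (x ∘ suc))) (≤-reflexive (sym (*-assoc _ _ _))))

  module _ {n : ℕ} {B G : Pairing (Fin n)}
           (B-form : IsForm B) (G-form : IsForm G)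
           (G-positive : ∀ x → 0# < ∥ x ∥² → 0# < G x x) where

    private
      -- The numbers lying below some quotient of `B x x` by `G x x`, written without division. The
      -- lift only adjusts the universe level to that of `supremum`.
      Quotient : Pred Carrier (c ⊔ ℓ₁ ⊔ ℓ₂)
      Quotient t = Lift (c ⊔ ℓ₁ ⊔ ℓ₂) (∃ λ x → 0# < ∥ x ∥² × t * G x x ≤ B x x)

      difference : Carrier → Pairing (Fin n)
      difference μ x y = μ * G x y - B x y

      difference-form : ∀ μ → IsForm (difference μ)
      difference-form μ = record
        { symmetric = λ x y → +-cong (*-congˡ (IsForm.symmetric G-form x y)) (-‿cong (IsForm.symmetric B-form x y))
        ; linearˡ   = λ y → record
          { cong   = λ p → +-cong (*-congˡ (IsLinear.cong (IsForm.linearˡ G-form y) p))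
                                  (-‿cong (IsLinear.cong (IsForm.linearˡ B-form y) p))
          ; linear = λ s x r z → trans
              (+-cong (*-congˡ (IsLinear.linear (IsForm.linearˡ G-form y) s x r z))
                      (-‿cong (IsLinear.linear (IsForm.linearˡ B-form y) s x r z)))
              (solve 7 (λ μ s r a b d f → μ :* (s :* a :+ r :* b) :- (s :* d :+ r :* f) :=
                 s :* (μ :* a :- d) :+ r :* (μ :* b :- f)) refl μ s r _ _ _ _) } }

      G-psd : ∀ x → 0# ≤ G x x
      G-psd x with ≤-split (0≤∥∥² x)
      ... | inj₁ 0<x = <⇒≤ (G-positive x 0<x)
      ... | inj₂ 0≈x = ≤-reflexive (sym (IsLinear.vanish (IsForm.linearˡ G-form x) λ i →
                         ²≈0 (≤-reflexive (sum-zero⇒zero (λ i → 0≤² (x i)) (≤-reflexive (sym 0≈x)) i))))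

      G-coercive : ∃ λ γ → 0# < γ × (∀ x → γ * ∥ x ∥² ≤ G x x)
      G-coercive with null-or-coercive G-form G-psd
      ... | inj₁ (x , 0<x , Gxx≈0) = ⊥-elim (>⇒≉ (G-positive x 0<x) Gxx≈0)
      ... | inj₂ coercive           = coercive

      scale-cancel : ∀ {t s x} → 0# < ∥ x ∥² → t * G x x ≤ s * G x x → t ≤ s
      scale-cancel {t} {s} {x} 0<x p = diff⇒≤ (0≤*-cancel (G-positive x 0<x) (≤-respʳ
        (solve 3 (λ g s t → s :* g :- t :* g := g :* (s :- t)) refl (G x x) s t) (0≤y-x p)))

      quotient : ∀ {x} → 0# < ∥ x ∥² → Quotient (B x x * G x x ⁻¹)
      quotient {x} 0<x = lift (x , 0<x , ≤-reflexive (trans (*-assoc _ _ _)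
        (trans (*-congˡ (*-inverseˡ (>⇒≉ (G-positive x 0<x)))) (*-identityʳ _))))

      bounded : ∃ (UpperBound Quotient)
      bounded with form-bounded B-form | G-coercive
      ... | k , 0<k , bound | γ , 0<γ , coercive = k * γ ⁻¹ , λ t → λ { (lift (x , 0<x , p)) →
        scale-cancel 0<x (≤-trans p (≤-trans (bound x) (≤-trans (≤-reflexive (begin
          k * ∥ x ∥²                 ≈⟨ *-congˡ (trans (*-congʳ (*-inverseˡ (>⇒≉ 0<γ))) (*-identityˡ _)) ⟨
          k * (γ ⁻¹ * γ * ∥ x ∥²)     ≈⟨ solve 4 (λ k g h N → k :* (g :* h :* N) := k :* g :* (h :* N)) refl k (γ ⁻¹) γ ∥ x ∥² ⟩
          k * γ ⁻¹ * (γ * ∥ x ∥²)     ∎))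
          (*-monoˡ-≤ (<⇒≤ (*-pos 0<k (0<⁻¹ 0<γ))) (coercive x))))) }
        where open ≈-Reasoning

    -- The supremum of the Rayleigh quotients is attained: otherwise μ G - B would be
    -- coercive and μ could be lowered.
    top-eigenvalue : ∀ {x : Fin n → Carrier} → 0# < ∥ x ∥² →
      ∃₂ λ μ (y : Fin n → Carrier) → 0# < ∥ y ∥² × (∀ z → B y z ≈ μ * G y z) × (∀ z → B z z ≤ μ * G z z)
    top-eigenvalue {x₀} 0<x₀ with supremum Quotient (_ , quotient {x₀} 0<x₀) bounded
    ... | μ , upper , least = attained (null-or-coercive (difference-form μ) λ z → 0≤y-x (dominates z))
      where
      dominates : ∀ z → B z z ≤ μ * G z z
      dominates z with ≤-split (0≤∥∥² z)
      ... | inj₁ 0<z = ≤-trans (≤-reflexive (sym (trans (*-assoc _ _ _)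
                (trans (*-congˡ (*-inverseˡ (>⇒≉ (G-positive z 0<z)))) (*-identityʳ _)))))
              (≤-trans (≤-reflexive (*-comm _ _)) (≤-trans (*-monoˡ-≤ (G-psd z) (upper _ (quotient {z} 0<z))) (≤-reflexive (*-comm _ _))))
      ... | inj₂ 0≈z = ≤-reflexive (trans (IsLinear.vanish (IsForm.linearˡ B-form z) z≈0)
              (sym (trans (*-congˡ (IsLinear.vanish (IsForm.linearˡ G-form z) z≈0)) (zeroʳ μ))))
        where
        z≈0 : ∀ i → z i ≈ 0#
        z≈0 i = ²≈0 (≤-reflexive (sum-zero⇒zero (λ i → 0≤² (z i)) (≤-reflexive (sym 0≈z)) i))
      attained : (∃ λ x → 0# < ∥ x ∥² × difference μ x x ≈ 0#) ⊎
                 (∃ λ ε → 0# < ε × (∀ x → ε * ∥ x ∥² ≤ difference μ x x)) →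
                 ∃₂ λ μ (y : Fin n → Carrier) → 0# < ∥ y ∥² × (∀ z → B y z ≈ μ * G y z) × (∀ z → B z z ≤ μ * G z z)
      -- A null vector of a positive semidefinite form lies in its kernel; for `μ G - B` this is the
      -- eigenvector equation.
      attained (inj₁ (y , 0<y , null)) = μ , y , 0<y ,
        (λ z → sym (-≈0⇒≈ (IsForm.null⇒kernel (difference-form μ) (λ z → 0≤y-x (dominates z)) null z))) , dominates
      attained (inj₂ (ε , 0<ε , coercive)) with form-bounded G-form
      ... | k , 0<k , bound = ⊥-elim (least (μ - δ) lower (diff⇒< (<-respʳ
              (solve 2 (λ m d → d := m :- (m :- d)) refl μ δ) 0<δ)))
        where
        -- `G` is at most `k` times the squared norm, so `δ G` stays below `ε` times the squared
        -- norm and `μ - δ` is still an upper bound.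
        δ : Carrier
        δ = ε * k ⁻¹
        0<δ : 0# < δ
        0<δ = *-pos 0<ε (0<⁻¹ 0<k)
        δG≤ : ∀ x → δ * G x x ≤ μ * G x x - B x x
        δG≤ x = ≤-trans (*-monoˡ-≤ (<⇒≤ 0<δ) (bound x)) (≤-trans (≤-reflexive
          (trans (solve 4 (λ e k l N → e :* l :* (k :* N) := e :* (k :* l :* N)) refl ε k (k ⁻¹) ∥ x ∥²)
            (*-congˡ (trans (*-congʳ (*-inverseʳ (>⇒≉ 0<k))) (*-identityˡ _))))) (coercive x))
        lower : UpperBound Quotient (μ - δ)
        lower t (lift (x , 0<x , p)) = scale-cancel 0<x (≤-trans p (diff⇒≤ (≤-respʳ
          (solve 4 (λ m d g b → m :* g :- b :- d :* g := (m :- d) :* g :- b) refl μ δ (G x x) (B x x))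
          (0≤y-x (δG≤ x)))))

-- Counting positive eigenvalues, and the Bochner argument.

module Signature {c ℓ₁ ℓ₂} (ℝ : RealNumbers c ℓ₁ ℓ₂) where

  open OrderedField ℝ
  open LinearAlgebra ℝ

  ∥∥²-zero : ∀ {n} {x : Fin n → Carrier} → ∥ x ∥² ≤ 0# → ∀ i → x i ≈ 0#
  ∥∥²-zero {x = x} p i = ²≈0 (≤-reflexive (sum-zero⇒zero (λ i → 0≤² (x i)) p i))

  ∥∥²-positive : ∀ {n} {x : Fin n → Carrier} → ¬ (∀ i → x i ≈ 0#) → 0# < ∥ x ∥²
  ∥∥²-positive {x = x} x≉0 with ≤-split (0≤∥∥² x)
  ... | inj₁ 0<x = 0<x
  ... | inj₂ 0≈x = ⊥-elim (x≉0 (∥∥²-zero {x = x} (≤-reflexive (sym 0≈x))))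

  zero⇒∥∥²≈0 : ∀ {n} (x : Fin n → Carrier) → (∀ i → x i ≈ 0#) → ∥ x ∥² ≈ 0#
  zero⇒∥∥²≈0 x x≈0 = sum-zero λ i → trans (*-congʳ (x≈0 i)) (zeroˡ _)

  form-positive⇒nonzero : ∀ {n} {B : Pairing (Fin n)} → IsForm B →
                          ∀ {x} → 0# < B x x → 0# < ∥ x ∥²
  form-positive⇒nonzero form {x} 0<Bxx = ∥∥²-positive {x = x} λ x≈0 →
    >⇒≉ 0<Bxx (IsLinear.vanish (IsForm.linearˡ form x) x≈0)

  diagonal-form : ∀ {n} (ρ : Fin n → Carrier) → IsForm (λ x y → sum (λ i → x i * (ρ i * y i)))
  diagonal-form ρ = record
    { symmetric = λ x y → sum-cong-≋ λ i →
        solve 3 (λ x r y → x :* (r :* y) := y :* (r :* x)) refl (x i) (ρ i) (y i)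
    ; linearˡ = λ y → sum-linear (λ i → ρ i * y i) }

  diagonal-positive : ∀ {n} (ρ : Fin n → Carrier) → (∀ i → 0# < ρ i) →
                      ∀ x → 0# < ∥ x ∥² → 0# < sum (λ i → x i * (ρ i * x i))
  diagonal-positive ρ 0<ρ x 0<x = ≰⇒> λ sum≤0 → >⇒≉ 0<x (zero⇒∥∥²≈0 x λ i →
      ²≈0 (≤-reflexive (*-zero-cancel (>⇒≉ (0<ρ i)) (trans (swap-factors i) (sum-zero⇒zero nonneg sum≤0 i)))))
    where
    swap-factors : ∀ i → ρ i * (x i * x i) ≈ x i * (ρ i * x i)
    swap-factors i = solve 2 (λ x r → r :* (x :* x) := x :* (r :* x)) refl (x i) (ρ i)
    nonneg : ∀ i → 0# ≤ x i * (ρ i * x i)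
    nonneg i = ≤-respʳ (swap-factors i) (0≤* (<⇒≤ (0<ρ i)) (0≤² (x i)))

  module _ {n : ℕ} {B dot : Pairing (Fin n)}
           (form : IsForm B) (dot-form : IsForm dot)
           (dot-positive : ∀ x → 0# < ∥ x ∥² → 0# < dot x x) where

    Eigenvector : Carrier → (Fin n → Carrier) → Set (c ⊔ ℓ₁)
    Eigenvector μ x = ∀ z → B x z ≈ μ * dot x z

    -- The maximiser `w` of the Rayleigh quotient has a positive eigenvalue because `B v v` is
    -- positive. An eigenvector orthogonal to `w` with positive eigenvalue would contradict
    -- nonpositivity on the complement of `w`. Applied to an eigenvector minus its projection to
    -- `w`, this gives multiplicity one; applied to eigenvectors of another eigenvalue, which are
    -- orthogonal to `w`, it gives uniqueness.
    one-positive-eigenvalue : AtMostOnePositive B → ∀ {v} → 0# < B v v →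
      ∃₂ λ μ w → 0# < μ × 0# < ∥ w ∥² × Eigenvector μ w ×
        (∀ x → Eigenvector μ x → ∃ λ a → ∀ i → x i ≈ a * w i) ×
        (∀ ν x → 0# < ν → 0# < ∥ x ∥² → Eigenvector ν x → ν ≈ μ)
    one-positive-eigenvalue amop {v} 0<Bvv = μ , w , 0<μ , 0<w , eigen , multiplicity , unique
      where
      top : ∃₂ λ μ y → 0# < ∥ y ∥² × (∀ z → B y z ≈ μ * dot y z) × (∀ z → B z z ≤ μ * dot z z)
      top = top-eigenvalue form dot-form dot-positive {v} (form-positive⇒nonzero form {v} 0<Bvv)
      μ = proj₁ top
      w = proj₁ (proj₂ top)
      0<w = proj₁ (proj₂ (proj₂ top))
      eigen = proj₁ (proj₂ (proj₂ (proj₂ top)))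
      dominates = proj₂ (proj₂ (proj₂ (proj₂ top)))
      0<dot-v : 0# < dot v v
      0<dot-v = dot-positive v (form-positive⇒nonzero form {v} 0<Bvv)
      0<μ : 0# < μ
      0<μ = ≰⇒> λ μ≤0 → ≤-trans (dominates v) (≤-trans (≤-reflexive (*-comm _ _))
              (≤-trans (*-monoˡ-≤ (<⇒≤ 0<dot-v) μ≤0) (≤-reflexive (zeroʳ _)))) 0<Bvv
      0<Bww : 0# < B w w
      0<Bww = <-respʳ (sym (eigen w)) (*-pos 0<μ (dot-positive w 0<w))
      orthogonal⇒zero : ∀ ν x → 0# < ν → Eigenvector ν x → dot w x ≈ 0# → ∀ i → x i ≈ 0#
      orthogonal⇒zero ν x 0<ν eigen-x wx≈0 = ∥∥²-zero {x = x} λ 0<x →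
        nonpositive-on-orthogonal form amop 0<Bww (trans (eigen x) (trans (*-congˡ wx≈0) (zeroʳ μ)))
          (<-respʳ (sym (eigen-x x)) (*-pos 0<ν (dot-positive x 0<x)))
      multiplicity : ∀ x → Eigenvector μ x → ∃ λ a → ∀ i → x i ≈ a * w i
      multiplicity x eigen-x = a , λ i → -≈0⇒≈ (trans
          (solve 3 (λ x a w → x :- a :* w := num (+ 1) :* x :+ (:- a) :* w) refl (x i) a (w i))
          (orthogonal⇒zero μ z 0<μ eigen-z wz≈0 i))
        where
        a = dot w x * dot w w ⁻¹
        z = lin 1# x (- a) w
        eigen-z : Eigenvector μ z
        eigen-z y = begin
          B z y                           ≈⟨ IsLinear.linear (IsForm.linearˡ form y) 1# x (- a) w ⟩
          1# * B x y + - a * B w y        ≈⟨ +-cong (*-congˡ (eigen-x y)) (*-congˡ (eigen y)) ⟩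
          1# * (μ * dot x y) + - a * (μ * dot w y)
            ≈⟨ solve 4 (λ m a p q → num (+ 1) :* (m :* p) :+ (:- a) :* (m :* q) := m :* (num (+ 1) :* p :+ (:- a) :* q))
                 refl μ a (dot x y) (dot w y) ⟩
          μ * (1# * dot x y + - a * dot w y) ≈⟨ *-congˡ (IsLinear.linear (IsForm.linearˡ dot-form y) 1# x (- a) w) ⟨
          μ * dot z y                     ∎
          where open ≈-Reasoning
        wz≈0 : dot w z ≈ 0#
        wz≈0 = begin
          dot w z                          ≈⟨ IsLinear.linear (IsForm.linearʳ dot-form w) 1# x (- a) w ⟩
          1# * dot w x + - a * dot w w
            ≈⟨ solve 3 (λ p g q → num (+ 1) :* p :+ (:- (p :* g)) :* q := p :- p :* (g :* q)) refl (dot w x) (dot w w ⁻¹) (dot w w) ⟩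
          dot w x - dot w x * (dot w w ⁻¹ * dot w w)
            ≈⟨ +-congˡ (-‿cong (trans (*-congˡ (*-inverseˡ (>⇒≉ (dot-positive w 0<w)))) (*-identityʳ _))) ⟩
          dot w x - dot w x                ≈⟨ -‿inverseʳ _ ⟩
          0#                               ∎
          where open ≈-Reasoning
      unique : ∀ ν x → 0# < ν → 0# < ∥ x ∥² → Eigenvector ν x → ν ≈ μ
      unique ν x 0<ν 0<x eigen-x = ≈-stable λ ν≉μ →
        >⇒≉ 0<x (zero⇒∥∥²≈0 x (orthogonal⇒zero ν x 0<ν eigen-x (wx≈0 ν≉μ)))
        where
        wx≈0 : ¬ ν ≈ μ → dot w x ≈ 0#
        wx≈0 ν≉μ = *-zero-cancel (λ p → ν≉μ (-≈0⇒≈ p)) (begin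
          (ν - μ) * dot w x             ≈⟨ solve 3 (λ n m d → (n :- m) :* d := n :* d :- m :* d) refl ν μ (dot w x) ⟩
          ν * dot w x - μ * dot w x     ≈⟨ +-congʳ (*-congˡ (IsForm.symmetric dot-form w x)) ⟩
          ν * dot x w - μ * dot w x     ≈⟨ +-cong (eigen-x w) (-‿cong (eigen x)) ⟨
          B x w - B w x                 ≈⟨ ≈⇒-≈0 (IsForm.symmetric form x w) ⟩
          0#                            ∎)
          where open ≈-Reasoning

  ∑∑ : ∀ {n} → (Fin n → Fin n → Carrier) → Carrier
  ∑∑ f = sum λ i → sum (f i)

  ∑∑-cong : ∀ {n} {f g : Fin n → Fin n → Carrier} → (∀ i j → f i j ≈ g i j) → ∑∑ f ≈ ∑∑ g
  ∑∑-cong {n} p = sum-cong-≋ {n} λ i → sum-cong-≋ {n} (p i)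

  ∑∑-+ : ∀ {n} (f g : Fin n → Fin n → Carrier) → ∑∑ (λ i j → f i j + g i j) ≈ ∑∑ f + ∑∑ g
  ∑∑-+ {n} f g = trans (sum-cong-≋ {n} λ i → ∑-distrib-+ (f i) (g i)) (∑-distrib-+ (λ i → sum (f i)) (λ i → sum (g i)))

  -- Let T be the operator with B x y = G (T x) y, where G is the diagonal form with
  -- weights B (e i) w / w i.  Then T w = w, the hypothesis `bochner` says T ≤ T², and
  -- G - B is the Dirichlet form of the weighted graph B (e i) (e j).  So every
  -- eigenvalue μ > 0 of T is 1, with eigenvectors proportional to w by connectedness.
  module _ {n : ℕ} {B : Pairing (Fin n)} (form : IsForm B)
           {w : Fin n → Carrier} (0<w : ∀ i → 0# < w i) (0<Bw : ∀ i → 0# < B (e i) w)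
           (off-diagonal : ∀ i j → ¬ i ≡ j → 0# ≤ B (e i) (e j))
           (connected : ∀ (ξ : Fin n → Carrier) → (∀ i j → ¬ i ≡ j → 0# < B (e i) (e j) → ξ i ≈ ξ j) →
                        ∀ i j → ξ i ≈ ξ j)
           (bochner : ∀ x → B x x ≤ sum (λ i → w i * B (e i) w ⁻¹ * B (e i) x * B (e i) x)) where

    private
      w⁻¹ : Fin n → Carrier
      w⁻¹ i = w i ⁻¹
      u : Fin n → Carrier
      u i = B (e i) w
      ww⁻¹ : ∀ i → w i * w⁻¹ i ≈ 1#
      ww⁻¹ i = *-inverseʳ (>⇒≉ (0<w i))
      ρ : Fin n → Carrier
      ρ i = u i * w⁻¹ i
      G : (x y : Fin n → Carrier) → Carrier
      G x y = sum (λ i → x i * (ρ i * y i))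
      G-form : IsForm G
      G-form = diagonal-form ρ
      G-positive : ∀ x → 0# < ∥ x ∥² → 0# < G x x
      G-positive = diagonal-positive ρ λ i → *-pos (0<Bw i) (0<⁻¹ (0<w i))

      B-basis : ∀ x y → B x y ≈ sum (λ i → x i * B (e i) y)
      B-basis x y = linear-basis (IsForm.linearˡ form y) x

      -- This is `T w = w`. It also shows that being orthogonal to `w` means the same for both
      -- forms.
      Gw≈Bw : ∀ x → G x w ≈ B x w
      Gw≈Bw x = trans (sum-cong-≋ λ i → *-congˡ (begin
          u i * w⁻¹ i * w i   ≈⟨ solve 3 (λ u v w → u :* v :* w := u :* (w :* v)) refl (u i) (w⁻¹ i) (w i) ⟩
          u i * (w i * w⁻¹ i) ≈⟨ *-congˡ (ww⁻¹ i) ⟩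
          u i * 1#            ≈⟨ *-identityʳ _ ⟩
          u i                 ∎)) (sym (B-basis x w))
        where open ≈-Reasoning

      module Dirichlet (x : Fin n → Carrier) where
        ξ : Fin n → Carrier
        ξ i = x i * w⁻¹ i
        x≈ : ∀ i → x i ≈ w i * ξ i
        x≈ i = sym (trans (solve 3 (λ w x v → w :* (x :* v) := x :* (w :* v)) refl (w i) (x i) (w⁻¹ i))
          (trans (*-congˡ (ww⁻¹ i)) (*-identityʳ _)))
        m : Fin n → Fin n → Carrier
        m i j = w i * w j * B (e i) (e j)
        m-sym : ∀ i j → m i j ≈ m j i
        m-sym i j = *-cong (*-comm _ _) (IsForm.symmetric form _ _)
        G≈ : G x x ≈ ∑∑ λ i j → m i j * (ξ i * ξ i)
        G≈ = sum-cong-≋ λ i → begin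
          x i * (u i * w⁻¹ i * x i)
            ≈⟨ *-congʳ (x≈ i) ⟩
          w i * ξ i * (u i * w⁻¹ i * x i)
            ≈⟨ solve 5 (λ w ξ u v x → w :* ξ :* (u :* v :* x) := u :* (w :* (ξ :* (x :* v)))) refl (w i) (ξ i) (u i) (w⁻¹ i) (x i) ⟩
          u i * (w i * (ξ i * ξ i))
            ≈⟨ *-congʳ (linear-basis (IsForm.linearʳ form (e i)) w) ⟩
          sum (λ j → w j * B (e i) (e j)) * (w i * (ξ i * ξ i))
            ≈⟨ *-distribʳ-sum _ (λ j → w j * B (e i) (e j)) ⟩
          sum (λ j → w j * B (e i) (e j) * (w i * (ξ i * ξ i)))
            ≈⟨ sum-cong-≋ {n} (λ j → solve 4 (λ v b w z → v :* b :* (w :* z) := w :* v :* b :* z) refl (w j) (B (e i) (e j)) (w i) (ξ i * ξ i)) ⟩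
          sum (λ j → m i j * (ξ i * ξ i)) ∎
          where open ≈-Reasoning
        G≈′ : G x x ≈ ∑∑ λ i j → m i j * (ξ j * ξ j)
        G≈′ = trans G≈ (trans (∑-comm (λ i j → m i j * (ξ i * ξ i))) (∑∑-cong λ i j → *-congʳ (m-sym j i)))
        B≈ : B x x ≈ ∑∑ λ i j → m i j * (ξ i * ξ j)
        B≈ = trans (B-basis x x) (sum-cong-≋ λ i → begin
          x i * B (e i) x                         ≈⟨ *-congˡ (linear-basis (IsForm.linearʳ form (e i)) x) ⟩
          x i * sum (λ j → x j * B (e i) (e j))    ≈⟨ *-distribˡ-sum (x i) (λ j → x j * B (e i) (e j)) ⟩
          sum (λ j → x i * (x j * B (e i) (e j)))
            ≈⟨ sum-cong-≋ {n} (λ j → *-cong (x≈ i) (*-congʳ (x≈ j))) ⟩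
          sum (λ j → w i * ξ i * (w j * ξ j * B (e i) (e j)))
            ≈⟨ sum-cong-≋ {n} (λ j → solve 5 (λ w a v b q → w :* a :* (v :* b :* q) := w :* v :* q :* (a :* b))
                 refl (w i) (ξ i) (w j) (ξ j) (B (e i) (e j))) ⟩
          sum (λ j → m i j * (ξ i * ξ j))          ∎)
          where open ≈-Reasoning
        term : Fin n → Fin n → Carrier
        term i j = m i j * ((ξ i - ξ j) * (ξ i - ξ j))
        -- With `x i = w i * ξ i` both forms become double sums with the weights `m`: for `G`
        -- because `u i` is the sum of `w j * B (e i) (e j)` over `j`. Everything is doubled since
        -- each pair of indices occurs in both orders.
        dirichlet : ∑∑ term + (B x x + B x x) ≈ G x x + G x x
        dirichlet = begin
          ∑∑ term + (B x x + B x x)   ≈⟨ +-congˡ (+-cong B≈ B≈) ⟩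
          ∑∑ term + (∑∑ f + ∑∑ f)     ≈⟨ +-congˡ (∑∑-+ f f) ⟨
          ∑∑ term + ∑∑ (λ i j → f i j + f i j) ≈⟨ ∑∑-+ term _ ⟨
          ∑∑ (λ i j → term i j + (f i j + f i j))
            ≈⟨ ∑∑-cong (λ i j → solve 3 (λ m a b → m :* ((a :- b) :* (a :- b)) :+ (m :* (a :* b) :+ m :* (a :* b)) :=
                 m :* (a :* a) :+ m :* (b :* b)) refl (m i j) (ξ i) (ξ j)) ⟩
          ∑∑ (λ i j → m i j * (ξ i * ξ i) + m i j * (ξ j * ξ j))
            ≈⟨ ∑∑-+ (λ i j → m i j * (ξ i * ξ i)) (λ i j → m i j * (ξ j * ξ j)) ⟩
          ∑∑ (λ i j → m i j * (ξ i * ξ i)) + ∑∑ (λ i j → m i j * (ξ j * ξ j)) ≈⟨ +-cong G≈ G≈′ ⟨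
          G x x + G x x               ∎
          where
          open ≈-Reasoning
          f : Fin n → Fin n → Carrier
          f i j = m i j * (ξ i * ξ j)
        0≤term : ∀ i j → 0# ≤ term i j
        0≤term i j with i Fin.≟ j
        -- Diagonal entries of `B` may have either sign, but the difference of the `ξ` is zero
        -- there.
        ... | yes ≡.refl = ≤-reflexive (sym (trans (*-congˡ (trans (*-congʳ (-‿inverseʳ _)) (zeroˡ _))) (zeroʳ _)))
        ... | no  i≢j    = 0≤* (0≤* (<⇒≤ (*-pos (0<w i) (0<w j))) (off-diagonal i j i≢j)) (0≤² _)
        -- By `dirichlet` the terms then add up to at most zero; being nonnegative they all vanish,
        -- and connectedness spreads the equality.
        constant-if : G x x ≤ B x x → ∀ i j → ξ i ≈ ξ j
        constant-if G≤B = connected ξ λ i j i≢j 0<b → -≈0⇒≈ (²≈0 (≤-reflexive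
            (*-zero-cancel (>⇒≉ (*-pos (*-pos (0<w i) (0<w j)) 0<b)) (term≈0 i j))))
          where
          sum≤0 : ∑∑ term ≤ 0#
          sum≤0 = diff⇒≤ (≤-respʳ
              (solve 2 (λ s b → (b :+ b) :- (s :+ (b :+ b)) := num (+ 0) :- s) refl (∑∑ term) (B x x))
            (0≤y-x (≤-trans (≤-reflexive dirichlet) (+-mono-≤ G≤B G≤B))))
          term≈0 : ∀ i j → term i j ≈ 0#
          term≈0 i = sum-zero⇒zero (0≤term i) (≤-reflexive (sum-zero⇒zero (λ i → 0≤sum (0≤term i)) sum≤0 i))

      -- Removing the rank-one part of `B` along `w` puts `w` into the kernel. The top eigenvalue of
      -- the rest is positive because of `x`, so its eigenvector is orthogonal to `w`, where both
      -- forms agree. Bochner and the Dirichlet form make this eigenvector a multiple of `w`, and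
      -- orthogonality then forces it to be zero.
      impossible : ∀ {x} → B x w ≈ 0# → 0# < B x x → 0# < B w w → Fin n → ⊥
      impossible {x} Bxw≈0 0<Bxx 0<Bww k =
        conclude (top-eigenvalue deflated-form G-form G-positive {x} (form-positive⇒nonzero form {x} 0<Bxx))
        where
        γ = B w w ⁻¹
        deflated : (x y : Fin n → Carrier) → Carrier
        deflated x y = B x y - γ * (B x w * B y w)
        deflated-form : IsForm deflated
        deflated-form = record
          { symmetric = λ x y → +-cong (IsForm.symmetric form x y) (-‿cong (*-congˡ (*-comm _ _)))
          ; linearˡ = λ y → record
            { cong = λ p → +-cong (IsLinear.cong (IsForm.linearˡ form y) p)
                (-‿cong (*-congˡ (*-congʳ (IsLinear.cong (IsForm.linearˡ form w) p))))
            ; linear = λ s x r z → trans (+-cong (IsLinear.linear (IsForm.linearˡ form y) s x r z)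
                (-‿cong (*-congˡ (*-congʳ (IsLinear.linear (IsForm.linearˡ form w) s x r z)))))
                (solve 8 (λ s r a b g p q t → (s :* a :+ r :* b) :- g :* ((s :* p :+ r :* q) :* t) :=
                  s :* (a :- g :* (p :* t)) :+ r :* (b :- g :* (q :* t)))
                  refl s r (B x y) (B z y) γ (B x w) (B z w) (B y w)) } }
        deflated≈ : ∀ {y} → B y w ≈ 0# → ∀ z → deflated y z ≈ B y z
        deflated≈ {y} Byw≈0 z = trans (+-congˡ (-‿cong (*-congˡ (*-congʳ Byw≈0))))
          (solve 3 (λ b g t → b :- g :* (num (+ 0) :* t) := b) refl (B y z) γ (B z w))
        deflated-w : ∀ y → deflated y w ≈ 0#
        deflated-w y = trans (solve 3 (λ b g q → b :- g :* (b :* q) := b :- (g :* q) :* b) refl (B y w) γ (B w w))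
          (trans (+-congˡ (-‿cong (trans (*-congʳ (*-inverseˡ (>⇒≉ 0<Bww))) (*-identityˡ _)))) (-‿inverseʳ _))
        conclude : (∃₂ λ μ y → 0# < ∥ y ∥² × (∀ z → deflated y z ≈ μ * G y z) × (∀ z → deflated z z ≤ μ * G z z)) → ⊥
        conclude (μ , y , 0<y , eigen , dominates) = >⇒≉ 0<y (zero⇒∥∥²≈0 y y≈0)
          where
          0<μ : 0# < μ
          0<μ = ≰⇒> λ p → ≤-trans (≤-reflexive (sym (deflated≈ Bxw≈0 x))) (≤-trans (dominates x)
                  (≤-trans (≤-reflexive (*-comm _ _)) (≤-trans
                    (*-monoˡ-≤ (<⇒≤ (G-positive x (form-positive⇒nonzero form {x} 0<Bxx))) p) (≤-reflexive (zeroʳ _))))) 0<Bxx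
          Byw≈0 : B y w ≈ 0#
          Byw≈0 = trans (sym (Gw≈Bw y)) (*-zero-cancel (>⇒≉ 0<μ) (trans (sym (eigen w)) (deflated-w y)))
          B-eigen : ∀ z → B y z ≈ μ * G y z
          B-eigen z = trans (sym (deflated≈ Byw≈0 z)) (eigen z)
          -- This is `T y`, so that the right side of `bochner` becomes `B v y`.
          v : Fin n → Carrier
          v i = w i * u i ⁻¹ * B (e i) y
          bochner-sum : sum (λ i → v i * B (e i) y) ≈ μ * B y y
          bochner-sum = begin
            sum (λ i → v i * B (e i) y) ≈⟨ B-basis v y ⟨
            B v y                       ≈⟨ IsForm.symmetric form v y ⟩
            B y v                       ≈⟨ B-eigen v ⟩
            μ * G y v                   ≈⟨ *-congˡ (sum-cong-≋ λ i → *-congˡ (trans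
                 (solve 5 (λ u r w q b → u :* r :* (w :* q :* b) := (w :* r) :* ((u :* q) :* b)) refl (u i) (w⁻¹ i) (w i) (u i ⁻¹) (B (e i) y))
                 (trans (*-cong (ww⁻¹ i) (*-congʳ (*-inverseʳ (>⇒≉ (0<Bw i)))))
                   (trans (*-identityˡ _) (*-identityˡ _))))) ⟩
            μ * sum (λ i → y i * B (e i) y) ≈⟨ *-congˡ (B-basis y y) ⟨
            μ * B y y                   ∎
            where open ≈-Reasoning
          G≤B : G y y ≤ B y y
          -- Bochner now reads `B y y ≤ μ * B y y`, and the left side is `μ * G y y`; the positive
          -- factor `μ` cancels.
          G≤B = diff⇒≤ (0≤*-cancel 0<μ (≤-respʳ
            (trans (+-congˡ (-‿cong (B-eigen y))) (solve 3 (λ m b g → m :* b :- m :* g := m :* (b :- g)) refl μ (B y y) (G y y)))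
            (0≤y-x (≤-trans (bochner y) (≤-reflexive bochner-sum)))))
          open Dirichlet y
          y≈ : ∀ i → y i ≈ ξ k * w i
          y≈ i = trans (x≈ i) (trans (*-comm _ _) (*-congʳ (constant-if G≤B i k)))
          ξk≈0 : ξ k ≈ 0#
          ξk≈0 = *-zero-cancel (>⇒≉ 0<Bww) (trans (*-comm _ _) (trans
            (sym (IsLinear.scale (IsForm.linearˡ form w) (ξ k) w))
            (trans (IsLinear.cong (IsForm.linearˡ form w) (λ i → sym (y≈ i))) Byw≈0)))
          y≈0 : ∀ i → y i ≈ 0#
          y≈0 i = trans (y≈ i) (trans (*-congʳ ξk≈0) (zeroˡ _))

    connected-bochner : AtMostOnePositive B
    connected-bochner = (λ x → B x w) , IsForm.linearˡ form w , λ x Bxw≈0 0<Bxx →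
      let k = index (form-positive⇒nonzero form {x} 0<Bxx) in
      impossible Bxw≈0 0<Bxx (<-respʳ (sym (B-basis w w))
        (0<sum (λ i → <⇒≤ (*-pos (0<w i) (0<Bw i))) k (*-pos (0<w k) (0<Bw k)))) k
      where
      -- A nonzero vector shows that there is a coordinate at all, on which the positivity of
      -- `B w w` depends.
      index : ∀ {m} {x : Fin m → Carrier} → 0# < ∥ x ∥² → Fin m
      index {zero}  0<0 = ⊥-elim (<-irrefl refl 0<0)
      index {suc m} _   = zero

-- Derivatives of polynomial expressions.

module Polynomials {c ℓ₁ ℓ₂} (ℝ : RealNumbers c ℓ₁ ℓ₂) where

  open OrderedField ℝ
  open LinearAlgebra ℝ hiding (e)
  open Lorentz ℝ

  module _ {I : Set} where

    eval-cong : ∀ (f : Poly I) {x y} → (∀ i → x i ≈ y i) → eval f x ≈ eval f y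
    eval-cong (con a) e = refl
    eval-cong (var i) e = e i
    eval-cong (f ⊕ g) e = +-cong (eval-cong f e) (eval-cong g e)
    eval-cong (f ⊗ g) e = *-cong (eval-cong f e) (eval-cong g e)

    D-linear : ∀ (f : Poly I) x → IsLinear (λ u → eval (D u f) x)
    D-linear f x = record { cong = cong f ; linear = linear f }
      where
      cong : ∀ f {u v} → (∀ i → u i ≈ v i) → eval (D u f) x ≈ eval (D v f) x
      cong (con a) e = refl
      cong (var i) e = e i
      cong (f ⊕ g) e = +-cong (cong f e) (cong g e)
      cong (f ⊗ g) e = +-cong (*-congʳ (cong f e)) (*-congˡ (cong g e))
      linear : ∀ f s u r v → eval (D (lin s u r v) f) x ≈ s * eval (D u f) x + r * eval (D v f) x
      linear (con a) s u r v = sym (trans (+-cong (zeroʳ s) (zeroʳ r)) (+-identityˡ 0#))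
      linear (var i) s u r v = refl
      linear (f ⊕ g) s u r v = trans (+-cong (linear f s u r v) (linear g s u r v))
        (solve 6 (λ s r a b p q → (s :* a :+ r :* b) :+ (s :* p :+ r :* q) := s :* (a :+ p) :+ r :* (b :+ q))
          refl s r (eval (D u f) x) (eval (D v f) x) (eval (D u g) x) (eval (D v g) x))
      linear (f ⊗ g) s u r v = trans (+-cong (*-congʳ (linear f s u r v)) (*-congˡ (linear g s u r v)))
        (solve 8 (λ s r a b p q f g → (s :* a :+ r :* b) :* g :+ f :* (s :* p :+ r :* q) :=
            s :* (a :* g :+ f :* p) :+ r :* (b :* g :+ f :* q))
          refl s r (eval (D u f) x) (eval (D v f) x) (eval (D u g) x) (eval (D v g) x) (eval f x) (eval g x))

    D-comm : ∀ u v (f : Poly I) → D u (D v f) ≋ D v (D u f)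
    D-comm u v (con a) x = refl
    D-comm u v (var i) x = refl
    D-comm u v (f ⊕ g) x = +-cong (D-comm u v f x) (D-comm u v g x)
    D-comm u v (f ⊗ g) x = trans
      (+-cong (+-congʳ (*-congʳ (D-comm u v f x))) (+-congˡ (*-congˡ (D-comm u v g x))))
      (solve 8 (λ a g b p q r f h → (a :* g :+ b :* p) :+ (q :* r :+ f :* h) :=
          (a :* g :+ q :* r) :+ (b :* p :+ f :* h))
        refl (eval (D v (D u f)) x) (eval g x) (eval (D v f) x) (eval (D u g) x)
             (eval (D u f) x) (eval (D v g) x) (eval f x) (eval (D v (D u g)) x))

  private
    -- Boundedness on the unit interval, with the square in place of the absolute value.
    Bounded : (Carrier → Carrier) → Set (c ⊔ ℓ₂)
    Bounded h = ∃ λ C → 0# ≤ C × (∀ s → 0# ≤ s → s ≤ 1# → h s * h s ≤ C)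

    bounded-+ : ∀ {h k} → Bounded h → Bounded k → Bounded (λ s → h s + k s)
    bounded-+ {h} {k} (C , 0≤C , p) (E , 0≤E , q) = (C + C) + (E + E) , 0≤+ (0≤+ 0≤C 0≤C) (0≤+ 0≤E 0≤E) ,
      λ s l u → ≤-trans (2x²+2y² (h s) (k s)) (+-mono-≤ (+-mono-≤ (p s l u) (p s l u)) (+-mono-≤ (q s l u) (q s l u)))

    bounded-* : ∀ {h k} → Bounded h → Bounded k → Bounded (λ s → h s * k s)
    bounded-* {h} {k} (C , 0≤C , p) (E , 0≤E , q) = C * E , 0≤* 0≤C 0≤E , λ s l u →
      ≤-respˡ (solve 2 (λ h k → (h :* h) :* (k :* k) := h :* k :* (h :* k)) refl (h s) (k s))
        (≤-trans (*-monoˡ-≤ (0≤² (h s)) (q s l u)) (≤-trans (≤-reflexive (*-comm _ _))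
          (≤-trans (*-monoˡ-≤ 0≤E (p s l u)) (≤-reflexive (*-comm _ _)))))

    bounded-const : ∀ a → Bounded (λ _ → a)
    bounded-const a = a * a , 0≤² a , λ _ _ _ → ≤-refl

    bounded-id : Bounded (λ s → s)
    bounded-id = 1# , <⇒≤ 0<1 , λ s 0≤s s≤1 → ≤-trans (*-monoˡ-≤ 0≤s s≤1) (≤-trans (≤-reflexive (*-identityʳ s)) s≤1)

    module Taylor {I : Set} (x u : I → Carrier) where

      path : Carrier → I → Carrier
      path s i = x i + s * u i

      -- The remainder is built along the expression. That it stays bounded near `s = 0` is what
      -- lets values determine the derivative.
      taylor : ∀ f → ∃ λ R → Bounded R × (∀ s → eval f (path s) ≈ eval f x + s * eval (D u f) x + s * s * R s)
      taylor (con a) = (λ _ → 0#) , bounded-const 0# , λ s →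
        solve 2 (λ a s → a := a :+ s :* num (+ 0) :+ s :* s :* num (+ 0)) refl a s
      taylor (var i) = (λ _ → 0#) , bounded-const 0# , λ s →
        solve 3 (λ a s b → a :+ s :* b := a :+ s :* b :+ s :* s :* num (+ 0)) refl (x i) s (u i)
      taylor (f ⊕ g) with taylor f | taylor g
      ... | R , R-bounded , p | T , T-bounded , q = (λ s → R s + T s) , bounded-+ R-bounded T-bounded , λ s →
        trans (+-cong (p s) (q s))
          (solve 7 (λ s a b r d e t → (a :+ s :* b :+ s :* s :* r) :+ (d :+ s :* e :+ s :* s :* t) :=
              (a :+ d) :+ s :* (b :+ e) :+ s :* s :* (r :+ t))
            refl s (eval f x) (eval (D u f) x) (R s) (eval g x) (eval (D u g) x) (T s))
      taylor (f ⊗ g) with taylor f | taylor g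
      ... | R , R-bounded , p | T , T-bounded , q =
        (λ s → b * e + (R s * (d + s * e + s * s * T s) + (a + s * b) * T s)) ,
        bounded-+ (bounded-const _) (bounded-+
          (bounded-* R-bounded (bounded-+ (bounded-+ (bounded-const d) (bounded-* bounded-id (bounded-const e)))
            (bounded-* (bounded-* bounded-id bounded-id) T-bounded)))
          (bounded-* (bounded-+ (bounded-const a) (bounded-* bounded-id (bounded-const b))) T-bounded)) , λ s →
        trans (*-cong (p s) (q s))
          (solve 7 (λ s a b r d e t → (a :+ s :* b :+ s :* s :* r) :* (d :+ s :* e :+ s :* s :* t) :=
              a :* d :+ s :* (b :* d :+ a :* e) :+
              s :* s :* (b :* e :+ (r :* (d :+ s :* e :+ s :* s :* t) :+ (a :+ s :* b) :* t)))
            refl s a b (R s) d e (T s))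
        where
        a = eval f x
        b = eval (D u f) x
        d = eval g x
        e = eval (D u g) x

      -- `D` acts on expressions while `≋` compares values, so this needs an argument. Along the
      -- line the expansion gives `d + s * R s = 0` for every positive `s`, hence `d² ≤ s² C` on the
      -- unit interval, which fails for a suitable `s` unless `d` is zero.
      D-zero : ∀ f → f ≋ con 0# → eval (D u f) x ≈ 0#
      D-zero f f≋0 with taylor f
      ... | R , (C , 0≤C , bound) , expansion = ²≈0 λ 0<dd →
        let E    = d * d + C
            0<E  = 0<+ 0<dd 0≤C
            -- This `s` satisfies `d² = s d² + s C`. Hence `s C < d²`, and `s² C < s d² ≤ d²`
            -- contradicts the bound.
            s    = d * d * E ⁻¹
            0<s  = *-pos 0<dd (0<⁻¹ 0<E)
            E≈   = trans (solve 3 (λ d E F → E :* (d :* F) := d :* (E :* F)) refl (d * d) E (E ⁻¹))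
                     (trans (*-congˡ (*-inverseʳ (>⇒≉ 0<E))) (*-identityʳ _))
            s≤1  = diff⇒≤ (0≤*-cancel 0<E (≤-respʳ (trans
                     (solve 3 (λ E d C → C := E :- d :+ (d :+ C :- E)) refl E (d * d) C)
                     (trans (+-cong (+-congˡ (-‿cong (sym E≈))) (-‿inverseʳ _))
                       (solve 2 (λ E s → E :- E :* s :+ num (+ 0) := E :* (num (+ 1) :- s)) refl E s))) 0≤C))
            slope : d + s * R s ≈ 0#
            slope = *-zero-cancel (>⇒≉ 0<s) (trans
                     (solve 3 (λ s d r → s :* (d :+ s :* r) := num (+ 0) :+ s :* d :+ s :* s :* r) refl s d (R s))
                     (trans (+-congʳ (+-congʳ (sym (f≋0 x)))) (trans (sym (expansion s)) (f≋0 (path s)))))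
            d²≤  : d * d ≤ s * s * C
            d²≤  = ≤-trans (≤-reflexive (trans
                     (solve 3 (λ s d r → d :* d := (d :+ s :* r) :* (d :- s :* r) :+ s :* s :* (r :* r)) refl s d (R s))
                     (trans (+-congʳ (trans (*-congʳ slope) (zeroˡ _))) (+-identityˡ _))))
                     (*-monoˡ-≤ (0≤² s) (bound s (<⇒≤ 0<s) s≤1))
            sC<d² : s * C < d * d
            sC<d² = diff⇒< (<-respʳ (trans (solve 3 (λ s q C → s :* q := s :* (q :+ C) :- s :* C) refl s (d * d) C)
                     (+-congʳ (trans (*-comm _ _) E≈))) (*-pos 0<s 0<dd))
        in <-irrefl refl (≤-<-trans (≤-respʳ (*-assoc s s C) d²≤) (<-≤-trans (*-monoˡ-< 0<s sC<d²)
             (≤-respʳ (*-identityʳ _) (≤-respˡ (*-comm _ _) (*-monoˡ-≤ (<⇒≤ 0<dd) s≤1)))))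
        where
        d = eval (D u f) x

  module _ {I : Set} where

    D-cong : ∀ u {f g : Poly I} → f ≋ g → D u f ≋ D u g
    D-cong u {f} {g} f≋g x = -≈0⇒≈ (trans
      (solve 3 (λ a b z → a :- b := a :+ (num (+ 0) :* z :+ (:- num (+ 1)) :* b)) refl
        (eval (D u f) x) (eval (D u g) x) (eval g x))
      (Taylor.D-zero x u (f ⊖ g) λ y →
        trans (+-congʳ (f≋g y)) (solve 1 (λ a → a :+ (:- num (+ 1)) :* a := num (+ 0)) refl (eval g y))))

    Ds-cong : ∀ {m} (us : Vec (I → Carrier) m) {f g : Poly I} → f ≋ g → Ds us f ≋ Ds us g
    Ds-cong []       f≋g = f≋g
    Ds-cong (u ∷ us) {f} {g} f≋g = D-cong u {Ds us f} {Ds us g} (Ds-cong us {f} {g} f≋g)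

    D-Ds : ∀ {m} u (us : Vec (I → Carrier) m) (f : Poly I) → D u (Ds us f) ≋ Ds us (D u f)
    D-Ds u []       f x = refl
    D-Ds u (v ∷ us) f x = trans (D-comm u v (Ds us f) x)
      (D-cong v {D u (Ds us f)} {Ds us (D u f)} (D-Ds u us f) x)

    D-form : ∀ (f : Poly I) → IsForm (λ x y → constant (D x (D y f)))
    D-form f = record
      { symmetric = λ x y → D-comm x y f _
      ; linearˡ   = λ y → D-linear (D y f) _ }

  module _ {I : Set} where

    eval-[] : ∀ {J : Set} (f : Poly I) (σ : I → Poly J) x → eval (f [ σ ]) x ≡ eval f (λ i → eval (σ i) x)
    eval-[] (con a) σ x = ≡.refl
    eval-[] (var i) σ x = ≡.refl
    eval-[] (f ⊕ g) σ x = ≡.cong₂ _+_ (eval-[] f σ x) (eval-[] g σ x)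
    eval-[] (f ⊗ g) σ x = ≡.cong₂ _*_ (eval-[] f σ x) (eval-[] g σ x)

    -- When all derivatives of the substituted polynomials are constants, they form a single new
    -- direction, and no sum over the variables arises.
    chain-rule : ∀ {J : Set} (f : Poly I) (σ : I → Poly J) {u v} → (∀ i → D u (σ i) ≋ con (v i)) →
                 D u (f [ σ ]) ≋ D v f [ σ ]
    chain-rule (con a) σ lin x = refl
    chain-rule (var i) σ lin x = lin i x
    chain-rule (f ⊕ g) σ lin x = +-cong (chain-rule f σ lin x) (chain-rule g σ lin x)
    chain-rule (f ⊗ g) σ lin x = +-cong (*-congʳ (chain-rule f σ lin x)) (*-congˡ (chain-rule g σ lin x))

    Ds-chain-rule : ∀ {J : Set} (f : Poly I) (σ : I → Poly J) (τ : (J → Carrier) → I → Carrier) →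
                    (∀ u i → D u (σ i) ≋ con (τ u i)) → ∀ {m} (us : Vec (J → Carrier) m) →
                    Ds us (f [ σ ]) ≋ Ds (map τ us) f [ σ ]
    Ds-chain-rule f σ τ lin []       x = refl
    Ds-chain-rule f σ τ lin (u ∷ us) x = trans
      (D-cong u {Ds us (f [ σ ])} {Ds (map τ us) f [ σ ]} (Ds-chain-rule f σ τ lin us) x)
      (chain-rule (Ds (map τ us) f) σ (lin u) x)

-- Sums over subsets, modular functions and submodularity.

module SubsetSums {c ℓ₁ ℓ₂} (ℝ : RealNumbers c ℓ₁ ℓ₂) where

  open OrderedField ℝ
  open LinearAlgebra ℝ hiding (e)

  when : ∀ {a} {A : Set a} → Dec A → Carrier → Carrier
  when d x = if does d then x else 0#

  module _ {a} {A : Set a} where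

    when-yes : (d : Dec A) → A → ∀ {x} → when d x ≈ x
    when-yes (yes _) _ = refl
    when-yes (no ¬p) p = ⊥-elim (¬p p)

    when-no : (d : Dec A) → ¬ A → ∀ {x} → when d x ≈ 0#
    when-no (yes p) ¬p = ⊥-elim (¬p p)
    when-no (no _)  _  = refl

    when-cong : (d : Dec A) → ∀ {x y} → (A → x ≈ y) → when d x ≈ when d y
    when-cong (yes p) e = e p
    when-cong (no _)  e = refl

    when-zero : (d : Dec A) → ∀ {x} → (A → x ≈ 0#) → when d x ≈ 0#
    when-zero (yes p) e = e p
    when-zero (no _)  e = refl

    when-+ : (d : Dec A) → ∀ x y → when d (x + y) ≈ when d x + when d y
    when-+ (yes _) x y = refl
    when-+ (no _)  x y = sym (+-identityˡ 0#)

    when-* : (d : Dec A) → ∀ x y → when d (x * y) ≈ x * when d y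
    when-* (yes _) x y = refl
    when-* (no _)  x y = sym (zeroʳ x)

    0≤when : (d : Dec A) → ∀ {x} → (A → 0# ≤ x) → 0# ≤ when d x
    0≤when (yes p) q = q p
    0≤when (no _)  q = ≤-refl

  when-⇔ : ∀ {a b} {A : Set a} {B : Set b} (d : Dec A) (d′ : Dec B) → (A → B) → (B → A) →
           ∀ {x} → when d x ≈ when d′ x
  when-⇔ (yes p) d′ f g = sym (when-yes d′ (f p))
  when-⇔ (no ¬p) d′ f g = sym (when-no d′ (¬p ∘ g))

  ∑ₛ : ∀ {n} → (Subset n → Carrier) → Carrier
  ∑ₛ = sumSubsets _+_

  ∑ₛ-cong : ∀ {n} {f g : Subset n → Carrier} → (∀ S → f S ≈ g S) → ∑ₛ f ≈ ∑ₛ g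
  ∑ₛ-cong {zero}  p = p []
  ∑ₛ-cong {suc n} p = +-cong (∑ₛ-cong {n} λ S → p (outside ∷ S)) (∑ₛ-cong {n} λ S → p (inside ∷ S))

  ∑ₛ-+ : ∀ {n} (f g : Subset n → Carrier) → ∑ₛ (λ S → f S + g S) ≈ ∑ₛ f + ∑ₛ g
  ∑ₛ-+ {zero}  f g = refl
  ∑ₛ-+ {suc n} f g = trans (+-cong (∑ₛ-+ (f ∘ (outside ∷_)) (g ∘ (outside ∷_))) (∑ₛ-+ (f ∘ (inside ∷_)) (g ∘ (inside ∷_))))
    (solve 4 (λ a b d e → (a :+ b) :+ (d :+ e) := (a :+ d) :+ (b :+ e)) refl _ _ _ _)

  ∑ₛ-* : ∀ {n} a (f : Subset n → Carrier) → ∑ₛ (λ S → a * f S) ≈ a * ∑ₛ f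
  ∑ₛ-* {zero}  a f = refl
  ∑ₛ-* {suc n} a f = trans (+-cong (∑ₛ-* a (f ∘ (outside ∷_))) (∑ₛ-* a (f ∘ (inside ∷_)))) (sym (distribˡ a _ _))

  ∑ₛ-zero : ∀ {n} {f : Subset n → Carrier} → (∀ S → f S ≈ 0#) → ∑ₛ f ≈ 0#
  ∑ₛ-zero {zero}  p = p []
  ∑ₛ-zero {suc n} p = trans (+-cong (∑ₛ-zero {n} λ S → p (outside ∷ S)) (∑ₛ-zero {n} λ S → p (inside ∷ S))) (+-identityˡ 0#)

  ∑ₛ-comm : ∀ {m n} (f : Subset m → Subset n → Carrier) → ∑ₛ (λ S → ∑ₛ (f S)) ≈ ∑ₛ (λ T → ∑ₛ (λ S → f S T))
  ∑ₛ-comm {zero}  f = refl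
  ∑ₛ-comm {suc m} f = trans (+-cong (∑ₛ-comm (f ∘ (outside ∷_))) (∑ₛ-comm (f ∘ (inside ∷_)))) (sym (∑ₛ-+ (λ T → ∑ₛ (λ S → f (outside ∷ S) T)) (λ T → ∑ₛ (λ S → f (inside ∷ S) T))))

  ∑ₛ-sum : ∀ {m n} (f : Subset m → Fin n → Carrier) → ∑ₛ (λ S → sum (f S)) ≈ sum (λ i → ∑ₛ (λ S → f S i))
  ∑ₛ-sum {zero}  f = refl
  ∑ₛ-sum {suc m} {n} f = trans (+-cong (∑ₛ-sum (f ∘ (outside ∷_))) (∑ₛ-sum (f ∘ (inside ∷_))))
    (sym (∑-distrib-+ (λ i → ∑ₛ (λ S → f (outside ∷ S) i)) (λ i → ∑ₛ (λ S → f (inside ∷ S) i))))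

  ∑ₛ-single : ∀ {n} {f : Subset n → Carrier} S₀ → (∀ S → ¬ S ≡ S₀ → f S ≈ 0#) → ∑ₛ f ≈ f S₀
  ∑ₛ-single {zero}  []             p = refl
  ∑ₛ-single {suc n} (outside ∷ S₀) p = trans
    (+-cong (∑ₛ-single {n} S₀ λ S S≢S₀ → p (outside ∷ S) λ { ≡.refl → S≢S₀ ≡.refl }) (∑ₛ-zero {n} λ S → p (inside ∷ S) λ ()))
    (+-identityʳ _)
  ∑ₛ-single {suc n} (inside ∷ S₀)  p = trans
    (+-cong (∑ₛ-zero {n} λ S → p (outside ∷ S) λ ()) (∑ₛ-single {n} S₀ λ S S≢S₀ → p (inside ∷ S) λ { ≡.refl → S≢S₀ ≡.refl }))
    (+-identityˡ _)

  0≤∑ₛ : ∀ {n} {f : Subset n → Carrier} → (∀ S → 0# ≤ f S) → 0# ≤ ∑ₛ f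
  0≤∑ₛ {zero}  p = p []
  0≤∑ₛ {suc n} p = 0≤+ (0≤∑ₛ {n} λ S → p (outside ∷ S)) (0≤∑ₛ {n} λ S → p (inside ∷ S))

  -- The modular functions that vanish on the empty set.
  weight : ∀ {n} → (Fin n → Carrier) → Subset n → Carrier
  weight a []            = 0#
  weight a (outside ∷ S) = weight (a ∘ suc) S
  weight a (inside ∷ S)  = a zero + weight (a ∘ suc) S

  weight-+ : ∀ {n} (a b : Fin n → Carrier) S → weight (λ i → a i + b i) S ≈ weight a S + weight b S
  weight-+ a b []            = sym (+-identityˡ 0#)
  weight-+ a b (outside ∷ S) = weight-+ (a ∘ suc) (b ∘ suc) S
  weight-+ a b (inside ∷ S)  = trans (+-congˡ (weight-+ (a ∘ suc) (b ∘ suc) S))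
    (solve 4 (λ a b p q → (a :+ b) :+ (p :+ q) := (a :+ p) :+ (b :+ q)) refl _ _ _ _)

  weight-* : ∀ {n} r (a : Fin n → Carrier) S → weight (λ i → r * a i) S ≈ r * weight a S
  weight-* r a []            = sym (zeroʳ r)
  weight-* r a (outside ∷ S) = weight-* r (a ∘ suc) S
  weight-* r a (inside ∷ S)  = trans (+-congˡ (weight-* r (a ∘ suc) S)) (sym (distribˡ r _ _))

  _∈∖?_,_ : ∀ {n} (i : Fin n) (S K : Subset n) → Dec (i ∈ S × i ∉ K)
  i ∈∖? S , K = (i ∈? S) ×-dec ¬? (i ∈? K)

  weight-difference : ∀ {n} (a : Fin n → Carrier) {K S : Subset n} → K ⊆ S →
                      weight a S - weight a K ≈ sum (λ i → when (i ∈∖? S , K) (a i))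
  weight-difference a {[]}          {[]}          _   = -‿inverseʳ 0#
  weight-difference a {outside ∷ K} {outside ∷ S} K⊆S = trans (weight-difference (a ∘ suc) (drop-∷-⊆ K⊆S)) (sym (+-identityˡ _))
  weight-difference a {outside ∷ K} {inside ∷ S}  K⊆S = trans (+-assoc _ _ _) (+-congˡ (weight-difference (a ∘ suc) (drop-∷-⊆ K⊆S)))
  weight-difference a {inside ∷ K}  {outside ∷ S} K⊆S with () ← K⊆S here
  weight-difference a {inside ∷ K}  {inside ∷ S}  K⊆S = trans
    (solve 3 (λ a p q → (a :+ p) :- (a :+ q) := num (+ 0) :+ (p :- q)) refl (a zero) (weight (a ∘ suc) S) (weight (a ∘ suc) K))
    (+-congˡ (weight-difference (a ∘ suc) (drop-∷-⊆ K⊆S)))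

  size : ∀ {n} → Subset n → Carrier
  size = weight (λ _ → 1#)

  ∣─∣≈ : ∀ {n} {K S : Subset n} → K ⊆ S → fromℕ ∣ S ─ K ∣ ≈ size S - size K
  ∣─∣≈ {K = []}          {[]}          _   = sym (-‿inverseʳ 0#)
  ∣─∣≈ {K = outside ∷ K} {outside ∷ S} K⊆S = ∣─∣≈ (drop-∷-⊆ K⊆S)
  ∣─∣≈ {K = outside ∷ K} {inside ∷ S}  K⊆S = trans (+-congˡ (∣─∣≈ (drop-∷-⊆ K⊆S))) (sym (+-assoc _ _ _))
  ∣─∣≈ {K = inside ∷ K}  {outside ∷ S} K⊆S with () ← K⊆S here
  ∣─∣≈ {K = inside ∷ K}  {inside ∷ S}  K⊆S = trans (∣─∣≈ (drop-∷-⊆ K⊆S))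
    (solve 3 (λ a p q → p :- q := (a :+ p) :- (a :+ q)) refl 1# (size S) (size K))

  size-≤ : ∀ {n} {K S : Subset n} → K ⊆ S → 0# ≤ size S - size K
  size-≤ {K = K} {S} K⊆S = ≤-respʳ (sym (weight-difference _ K⊆S))
    (0≤sum λ i → 0≤when (i ∈∖? S , K) λ _ → <⇒≤ 0<1)

  size-< : ∀ {n} {K S : Subset n} → K ⊂ S → 0# < size S - size K
  size-< {K = K} {S} (K⊆S , i , i∈S , i∉K) = <-respʳ (sym (weight-difference _ K⊆S))
    (0<sum (λ i → 0≤when (i ∈∖? S , K) λ _ → <⇒≤ 0<1) i
      (<-respʳ (sym (when-yes (i ∈∖? S , K) (i∈S , i∉K))) 0<1))

  between-≡ : ∀ {n} {K L : Subset n} {S T : Between K L} → set S ≡ set T → S ≡ T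
  between-≡ ≡.refl = ≡.refl

  -- The bounds inside `Between` are irrelevant and cannot be projected out; deciding the inclusions
  -- afresh recovers them.
  recompute : ∀ {n} {K L : Subset n} (S : Between K L) → K ⊂ set S × set S ⊂ L
  recompute {K = K} {L} (between S K⊂S S⊂L) with K ⊂? S | S ⊂? L
  ... | yes p | yes q = p , q
  ... | no ¬p | _     = Irrelevant.⊥-elim (¬p K⊂S)
  ... | yes _ | no ¬q = Irrelevant.⊥-elim (¬q S⊂L)

  StrictlySubmodular : ∀ {n} (K L : Subset n) → (Subset n → Carrier) → Set ℓ₂
  StrictlySubmodular K L f = ∀ S T → K ⊆ S → S ⊆ L → K ⊆ T → T ⊆ L → ¬ S ⊆ T → ¬ T ⊆ S →
                             f (S ∩ T) + f (S ∪ T) < f S + f T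

  private
    infixl 6 _⊟_
    _⊟_ : ∀ {n} → (Subset n → Carrier) → (Fin n → Carrier) → Subset n → Carrier
    (f ⊟ a) S = f S - weight a S

    restrict : ∀ {n} {K L : Subset n} {k l} b → (∀ {S} → K ⊆ S → k ∷ K ⊆ b ∷ S) → (∀ {S} → S ⊆ L → b ∷ S ⊆ l ∷ L) →
               ∀ {f} → StrictlySubmodular (k ∷ K) (l ∷ L) f → StrictlySubmodular K L (f ∘ (b ∷_))
    -- Both clauses have the same right side; fixing the head lets its meet and join with itself
    -- compute.
    restrict outside below above sub S T K⊆S S⊆L K⊆T T⊆L S⊈T T⊈S = sub _ _ (below K⊆S) (above S⊆L) (below K⊆T) (above T⊆L)
      (λ p → S⊈T (drop-∷-⊆ p)) (λ p → T⊈S (drop-∷-⊆ p))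
    restrict inside below above sub S T K⊆S S⊆L K⊆T T⊆L S⊈T T⊈S = sub _ _ (below K⊆S) (above S⊆L) (below K⊆T) (above T⊆L)
      (λ p → S⊈T (drop-∷-⊆ p)) (λ p → T⊈S (drop-∷-⊆ p))

    in⊈out : ∀ {n} {S T : Subset n} → ¬ inside ∷ S ⊆ outside ∷ T
    in⊈out p with () ← p here

    ⊆⇒∩≡ : ∀ {n} {S T : Subset n} → S ⊆ T → S ∩ T ≡ S
    ⊆⇒∩≡ {S = S} {T} S⊆T = ⊆-antisym (p∩q⊆p S T) λ x∈S → x∈p∩q⁺ (x∈S , S⊆T x∈S)

    ⊆⇒∪≡ : ∀ {n} {S T : Subset n} → S ⊆ T → S ∪ T ≡ T
    ⊆⇒∪≡ {S = S} {T} S⊆T = ⊆-antisym (λ x∈ → case x∈p∪q⁻ S T x∈ of λ { (inj₁ x∈S) → S⊆T x∈S ; (inj₂ x∈T) → x∈T }) (q⊆p∪q S T)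

    ⊇⇒∩≡ : ∀ {n} {S T : Subset n} → T ⊆ S → S ∩ T ≡ T
    ⊇⇒∩≡ {S = S} {T} T⊆S = ≡.trans (∩-comm S T) (⊆⇒∩≡ T⊆S)

    ⊇⇒∪≡ : ∀ {n} {S T : Subset n} → T ⊆ S → S ∪ T ≡ S
    ⊇⇒∪≡ {S = S} {T} T⊆S = ≡.trans (∪-comm S T) (⊆⇒∪≡ T⊆S)

    module _ {n} {K L : Subset n} {f : Subset (suc n) → Carrier}
             (sub : StrictlySubmodular (outside ∷ K) (inside ∷ L) f) where

      -- Diminishing returns: adding the head gains less at `L` than at `S`. The sets `inside ∷ S`
      -- and `outside ∷ L` have meet `outside ∷ S` and join `inside ∷ L`.
      upper-< : ∀ {S} → K ⊆ S → S ⊆ L → ¬ L ⊆ S → f (outside ∷ S) + f (inside ∷ L) < f (inside ∷ S) + f (outside ∷ L)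
      upper-< {S} K⊆S S⊆L L⊈S = ≡.subst₂ (λ A B → f (outside ∷ A) + f (inside ∷ B) < f (inside ∷ S) + f (outside ∷ L))
        (⊆⇒∩≡ S⊆L) (⊆⇒∪≡ S⊆L)
        (sub (inside ∷ S) (outside ∷ L) (out⊆ K⊆S) (in⊆in S⊆L) (out⊆ (λ x → S⊆L (K⊆S x))) (out⊆ ⊆-refl) in⊈out (λ p → L⊈S (drop-∷-⊆ p)))

      upper-≤ : ∀ {S} → K ⊆ S → S ⊆ L → f (outside ∷ S) + f (inside ∷ L) ≤ f (inside ∷ S) + f (outside ∷ L)
      upper-≤ {S} K⊆S S⊆L with ≡-dec Bool._≟_ S L
      ... | yes ≡.refl = ≤-reflexive (+-comm _ _)
      ... | no  S≢L    = <⇒≤ (upper-< K⊆S S⊆L λ L⊆S → S≢L (⊆-antisym S⊆L L⊆S))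

      lower-< : ∀ {S} → K ⊆ S → S ⊆ L → ¬ S ⊆ K → f (outside ∷ K) + f (inside ∷ S) < f (outside ∷ S) + f (inside ∷ K)
      lower-< {S} K⊆S S⊆L S⊈K = ≡.subst₂ (λ A B → f (outside ∷ A) + f (inside ∷ B) < f (outside ∷ S) + f (inside ∷ K))
        (⊇⇒∩≡ K⊆S) (⊇⇒∪≡ K⊆S)
        (sub (outside ∷ S) (inside ∷ K) (out⊆ K⊆S) (out⊆ S⊆L) (out⊆ ⊆-refl) (in⊆in (λ x → S⊆L (K⊆S x))) (λ p → S⊈K (drop-∷-⊆ p)) in⊈out)

      lower-≤ : ∀ {S} → K ⊆ S → S ⊆ L → f (outside ∷ K) + f (inside ∷ S) ≤ f (outside ∷ S) + f (inside ∷ K)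
      lower-≤ {S} K⊆S S⊆L with ≡-dec Bool._≟_ S K
      ... | yes ≡.refl = ≤-refl
      ... | no  S≢K    = <⇒≤ (lower-< K⊆S S⊆L λ S⊆K → S≢K (⊆-antisym S⊆K K⊆S))

    -- `a` is a greedy vertex of the base polytope of `f` on `L` minus `K`, with elements added in
    -- the order `≺`. `strict` says that a set at which `f ⊟ a` attains its minimum meets this
    -- ground set in an initial segment.
    record Greedy {n} (K L : Subset n) (f : Subset n → Carrier) (_≺_ : Fin n → Fin n → Set) : Set (c ⊔ ℓ₁ ⊔ ℓ₂) where
      field
        a      : Fin n → Carrier
        top    : (f ⊟ a) L ≈ (f ⊟ a) K
        weak   : ∀ {S} → K ⊆ S → S ⊆ L → (f ⊟ a) K ≤ (f ⊟ a) S
        strict : ∀ {S} → K ⊆ S → S ⊆ L → ∀ {i j} → i ≺ j → i ∈ L → i ∉ S → j ∈ S → j ∉ K → (f ⊟ a) K < (f ⊟ a) S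

    open Greedy

    drop-0 : ∀ f w → f - (0# + w) ≈ f - w
    drop-0 = solve 2 (λ f w → f :- (num (+ 0) :+ w) := f :- w) refl

    module _ (_≺_ : ∀ {n} → Fin n → Fin n → Set) (≺-suc : ∀ {n} {i j : Fin n} → suc i ≺ suc j → i ≺ j)
             {n} {K L : Subset n} {f : Subset (suc n) → Carrier} where

      -- The head is not an element of `L` minus `K`, so it takes no part in the greedy choice and
      -- receives weight zero.
      skip-outside : Greedy K L (f ∘ (outside ∷_)) _≺_ → Greedy (outside ∷ K) (outside ∷ L) f _≺_
      skip-outside G .a = 0# ◂ G .a
      skip-outside G .top = G .top
      skip-outside G .weak {outside ∷ S} K⊆S S⊆L = G .weak (drop-∷-⊆ K⊆S) (drop-∷-⊆ S⊆L)
      skip-outside G .weak {inside ∷ S}  K⊆S S⊆L = ⊥-elim (in⊈out S⊆L)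
      skip-outside G .strict {inside ∷ S} K⊆S S⊆L _ _ _ _ _ = ⊥-elim (in⊈out S⊆L)
      skip-outside G .strict {outside ∷ S} K⊆S S⊆L {suc i} {suc j} i≺j (there i∈L) i∉S (there j∈S) j∉K =
        G .strict (drop-∷-⊆ K⊆S) (drop-∷-⊆ S⊆L) (≺-suc i≺j) i∈L (i∉S ∘ there) j∈S (j∉K ∘ there)

      skip-inside : Greedy K L (f ∘ (inside ∷_)) _≺_ → Greedy (inside ∷ K) (inside ∷ L) f _≺_
      skip-inside G .a = 0# ◂ G .a
      skip-inside G .top = trans (drop-0 _ _) (trans (G .top) (sym (drop-0 _ _)))
      skip-inside G .weak {inside ∷ S}   K⊆S S⊆L = ≤-respˡ (sym (drop-0 _ _)) (≤-respʳ (sym (drop-0 _ _)) (G .weak (drop-∷-⊆ K⊆S) (drop-∷-⊆ S⊆L)))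
      skip-inside G .weak {outside ∷ S}  K⊆S S⊆L = ⊥-elim (in⊈out K⊆S)
      skip-inside G .strict {outside ∷ S} K⊆S S⊆L _ _ _ _ _ = ⊥-elim (in⊈out K⊆S)
      skip-inside G .strict {inside ∷ S} K⊆S S⊆L {i} {zero} i≺j i∈L i∉S j∈S j∉K = ⊥-elim (j∉K here)
      skip-inside G .strict {inside ∷ S} K⊆S S⊆L {zero} {suc j} i≺j i∈L i∉S j∈S j∉K = ⊥-elim (i∉S here)
      skip-inside G .strict {inside ∷ S} K⊆S S⊆L {suc i} {suc j} i≺j (there i∈L) i∉S (there j∈S) j∉K =
        <-respˡ (sym (drop-0 _ _)) (<-respʳ (sym (drop-0 _ _))
          (G .strict (drop-∷-⊆ K⊆S) (drop-∷-⊆ S⊆L) (≺-suc i≺j) i∈L (i∉S ∘ there) j∈S (j∉K ∘ there)))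

    -- The vertices of the base polytope for the increasing and for the decreasing order.

    increasing : ∀ {n} {K L : Subset n} → K ⊆ L → ∀ {f} → StrictlySubmodular K L f → Greedy K L f Fin._<_
    increasing {K = []} {[]} _ sub = record
      { a = λ () ; top = refl ; weak = λ { {[]} _ _ → ≤-refl } ; strict = λ { {[]} _ _ {()} } }
    increasing {K = outside ∷ K} {outside ∷ L} K⊆L {f} sub = skip-outside Fin._<_ ℕ.s≤s⁻¹ {f = f}
      (increasing (drop-∷-⊆ K⊆L) (restrict outside s⊆s s⊆s {f} sub))
    increasing {K = inside ∷ K} {inside ∷ L} K⊆L {f} sub = skip-inside Fin._<_ ℕ.s≤s⁻¹ {f = f}
      (increasing (drop-∷-⊆ K⊆L) (restrict inside s⊆s s⊆s {f} sub))
    increasing {K = inside ∷ K} {outside ∷ L} K⊆L _ = ⊥-elim (in⊈out K⊆L)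
    increasing {K = outside ∷ K} {inside ∷ L} K⊆L {f} sub = record
      { a = a₀ ◂ G .a
      ; top = trans (shift (f (inside ∷ L)) (w L)) (trans (+-congʳ (G .top)) (solve 3 (λ f₁ f₀ w → (f₁ :- w) :- (f₁ :- f₀) := f₀ :- w)
          refl (f (inside ∷ K)) (f (outside ∷ K)) (w K)))
      ; weak = λ { {outside ∷ S} K⊆S S⊆L → ≤-respˡ base (≤-trans (+-mono-≤ (G .weak (drop-∷-⊆ K⊆S) (drop-∷-⊆ S⊆L)) ≤-refl)
                     (diff⇒≤ (≤-respʳ (gap S) (0≤y-x (lower-≤ sub (drop-∷-⊆ K⊆S) (drop-∷-⊆ S⊆L))))))
                 ; {inside ∷ S} K⊆S S⊆L → ≤-respˡ base (≤-respʳ (sym (shift (f (inside ∷ S)) (w S)))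
                     (+-mono-≤ (G .weak (drop-∷-⊆ K⊆S) (drop-∷-⊆ S⊆L)) ≤-refl)) }
      ; strict = λ { {inside ∷ S} K⊆S S⊆L {zero} _ _ i∉S _ _ → ⊥-elim (i∉S here)
                   ; {inside ∷ S} K⊆S S⊆L {suc i} {suc j} i<j (there i∈L) i∉S (there j∈S) j∉K →
                       <-respˡ base (<-respʳ (sym (shift (f (inside ∷ S)) (w S)))
                         (+-mono-<-≤ (G .strict (drop-∷-⊆ K⊆S) (drop-∷-⊆ S⊆L) (ℕ.s≤s⁻¹ i<j) i∈L (i∉S ∘ there) j∈S (j∉K ∘ there)) ≤-refl))
                   ; {outside ∷ S} K⊆S S⊆L {i} {suc j} i<j i∈L i∉S (there j∈S) j∉K →
                       <-respˡ base (≤-<-trans (+-mono-≤ (G .weak (drop-∷-⊆ K⊆S) (drop-∷-⊆ S⊆L)) ≤-refl)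
                         (diff⇒< (<-respʳ (gap S) (0<y-x (lower-< sub (drop-∷-⊆ K⊆S) (drop-∷-⊆ S⊆L) λ S⊆K → j∉K (there (S⊆K j∈S))))))) } }
      where
      -- The head comes first: its weight is its gain at `K`, and the other elements are treated
      -- with the head already present.
      G = increasing (drop-∷-⊆ K⊆L) (restrict inside out⊆ in⊆in {f} sub)
      a₀ : Carrier
      a₀ = f (inside ∷ K) - f (outside ∷ K)
      w = weight (G .a)
      shift : ∀ f w → f - (a₀ + w) ≈ f - w - a₀
      shift = solve 3 (λ a f w → f :- (a :+ w) := f :- w :- a) refl a₀
      base : f (inside ∷ K) - w K - a₀ ≈ f (outside ∷ K) - w K
      base = solve 3 (λ f₁ f₀ w → (f₁ :- w) :- (f₁ :- f₀) := f₀ :- w) refl (f (inside ∷ K)) (f (outside ∷ K)) (w K)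
      gap : ∀ S → f (outside ∷ S) + f (inside ∷ K) - (f (outside ∷ K) + f (inside ∷ S)) ≈
                  f (outside ∷ S) - w S - (f (inside ∷ S) - w S - a₀)
      gap S = solve 5 (λ s₀ k₁ k₀ s₁ w → s₀ :+ k₁ :- (k₀ :+ s₁) := s₀ :- w :- (s₁ :- w :- (k₁ :- k₀)))
        refl (f (outside ∷ S)) (f (inside ∷ K)) (f (outside ∷ K)) (f (inside ∷ S)) (w S)

    decreasing : ∀ {n} {K L : Subset n} → K ⊆ L → ∀ {f} → StrictlySubmodular K L f → Greedy K L f Fin._>_
    decreasing {K = []} {[]} _ sub = record
      { a = λ () ; top = refl ; weak = λ { {[]} _ _ → ≤-refl } ; strict = λ { {[]} _ _ {()} } }
    decreasing {K = outside ∷ K} {outside ∷ L} K⊆L {f} sub = skip-outside Fin._>_ ℕ.s≤s⁻¹ {f = f}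
      (decreasing (drop-∷-⊆ K⊆L) (restrict outside s⊆s s⊆s {f} sub))
    decreasing {K = inside ∷ K} {inside ∷ L} K⊆L {f} sub = skip-inside Fin._>_ ℕ.s≤s⁻¹ {f = f}
      (decreasing (drop-∷-⊆ K⊆L) (restrict inside s⊆s s⊆s {f} sub))
    decreasing {K = inside ∷ K} {outside ∷ L} K⊆L _ = ⊥-elim (in⊈out K⊆L)
    decreasing {K = outside ∷ K} {inside ∷ L} K⊆L {f} sub = record
      { a = a₀ ◂ G .a
      ; top = trans (solve 3 (λ f₁ f₀ w → f₁ :- ((f₁ :- f₀) :+ w) := f₀ :- w) refl (f (inside ∷ L)) (f (outside ∷ L)) (w L)) (G .top)
      ; weak = λ { {outside ∷ S} K⊆S S⊆L → G .weak (drop-∷-⊆ K⊆S) (drop-∷-⊆ S⊆L)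
                 ; {inside ∷ S} K⊆S S⊆L → ≤-trans (G .weak (drop-∷-⊆ K⊆S) (drop-∷-⊆ S⊆L))
                     (diff⇒≤ (≤-respʳ (gap S) (0≤y-x (upper-≤ sub (drop-∷-⊆ K⊆S) (drop-∷-⊆ S⊆L))))) }
      ; strict = λ { {outside ∷ S} K⊆S S⊆L {zero} {suc j} ()
                   ; {outside ∷ S} K⊆S S⊆L {suc i} {suc j} i>j (there i∈L) i∉S (there j∈S) j∉K →
                       G .strict (drop-∷-⊆ K⊆S) (drop-∷-⊆ S⊆L) (ℕ.s≤s⁻¹ i>j) i∈L (i∉S ∘ there) j∈S (j∉K ∘ there)
                   ; {inside ∷ S} K⊆S S⊆L {suc i} i>j (there i∈L) i∉S _ _ →
                       ≤-<-trans (G .weak (drop-∷-⊆ K⊆S) (drop-∷-⊆ S⊆L))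
                         (diff⇒< (<-respʳ (gap S) (0<y-x (upper-< sub (drop-∷-⊆ K⊆S) (drop-∷-⊆ S⊆L) λ L⊆S → i∉S (there (L⊆S i∈L))))))
                   ; {inside ∷ S} K⊆S S⊆L {zero} _ _ i∉S _ _ → ⊥-elim (i∉S here) } }
      where
      -- The head comes last: its weight is its gain at `L`, and the other elements are treated
      -- without it.
      G = decreasing (drop-∷-⊆ K⊆L) (restrict outside out⊆ out⊆ {f} sub)
      a₀ : Carrier
      a₀ = f (inside ∷ L) - f (outside ∷ L)
      w = weight (G .a)
      gap : ∀ S → f (inside ∷ S) + f (outside ∷ L) - (f (outside ∷ S) + f (inside ∷ L)) ≈
                  f (inside ∷ S) - (a₀ + w S) - (f (outside ∷ S) - w S)
      gap S = solve 5 (λ s₀ l₁ l₀ s₁ w → s₁ :+ l₀ :- (s₀ :+ l₁) := s₁ :- ((l₁ :- l₀) :+ w) :- (s₀ :- w))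
        refl (f (outside ∷ S)) (f (inside ∷ L)) (f (outside ∷ L)) (f (inside ∷ S)) (w S)

  -- The average of the two vertices: at most one of them is tight on a given S.
  positive-shift : ∀ {n} {K L : Subset n} → K ⊆ L → ∀ {f} → StrictlySubmodular K L f →
                   ∃ λ a → f L - weight a L ≈ f K - weight a K ×
                           (∀ {S} → K ⊂ S → S ⊂ L → f K - weight a K < f S - weight a S)
  positive-shift {n} {K} {L} K⊆L {f} sub = (λ i → half * (p i + q i)) , average-≈ (G .top) (H .top) , shift
    where
    G = increasing K⊆L sub
    H = decreasing K⊆L sub
    p = G .a
    q = H .a
    0<2 : 0# < 1# + 1#
    0<2 = 0<+ 0<1 (<⇒≤ 0<1)
    half : Carrier
    half = (1# + 1#) ⁻¹
    0<half : 0# < half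
    0<half = 0<⁻¹ 0<2
    average : ∀ S → f S - weight (λ i → half * (p i + q i)) S ≈ half * ((f ⊟ p) S + (f ⊟ q) S)
    average S = begin
      f S - weight (λ i → half * (p i + q i)) S
        ≈⟨ +-cong (trans (sym (*-identityˡ _)) (*-congʳ (sym (*-inverseˡ (>⇒≉ 0<2)))))
                  (-‿cong (trans (weight-* half (λ i → p i + q i) S) (*-congˡ (weight-+ p q S)))) ⟩
      half * (1# + 1#) * f S - half * (weight p S + weight q S)
        ≈⟨ solve 4 (λ h f a b → h :* num (+ 2) :* f :- h :* (a :+ b) := h :* ((f :- a) :+ (f :- b)))
             refl half (f S) (weight p S) (weight q S) ⟩
      half * ((f ⊟ p) S + (f ⊟ q) S) ∎
      where open ≈-Reasoning
    average-≈ : ∀ {S T} → (f ⊟ p) S ≈ (f ⊟ p) T → (f ⊟ q) S ≈ (f ⊟ q) T → _ ≈ _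
    average-≈ {S} {T} e e′ = trans (average S) (trans (*-congˡ (+-cong e e′)) (sym (average T)))
    average-< : ∀ {S T} → (f ⊟ p) S + (f ⊟ q) S < (f ⊟ p) T + (f ⊟ q) T → _ < _
    average-< {S} {T} l = <-respˡ (sym (average S)) (<-respʳ (sym (average T)) (*-monoˡ-< 0<half l))
    shift : ∀ {S} → K ⊂ S → S ⊂ L → _ < _
    -- In one of the two opposite orders the missing element `i` precedes the present element `j`,
    -- so there `S` is not an initial segment.
    shift {S} (K⊆S , j , j∈S , j∉K) (S⊆L , i , i∈L , i∉S) with Fin.<-cmp i j
    ... | tri< i<j _ _    = average-< {K} {S} (+-mono-<-≤ (G .strict K⊆S S⊆L i<j i∈L i∉S j∈S j∉K) (H .weak K⊆S S⊆L))
    ... | tri≈ _ ≡.refl _ = ⊥-elim (i∉S j∈S)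
    ... | tri> _ _ j<i    = average-< {K} {S} (+-mono-≤-< (G .weak K⊆S S⊆L) (H .strict K⊆S S⊆L j<i i∈L i∉S j∈S j∉K))

-- The polynomials as functions of all subsets.

module Derivatives {c ℓ₁ ℓ₂ p} (ℝ : RealNumbers c ℓ₁ ℓ₂) {n} {𝒫 : Pred (Subset n) p}
                   (𝒫? : Decidable 𝒫) (graded : IntervalsGraded 𝒫) where

  open OrderedField ℝ
  open LinearAlgebra ℝ hiding (e)
  open Lorentz ℝ
  open Polynomials ℝ
  open SubsetSums ℝ
  open IntervalsGraded graded
  open Pol 𝒫? graded

  fromℕ-+ : ∀ a b → fromℕ (a ℕ.+ b) ≈ fromℕ a + fromℕ b
  fromℕ-+ zero    b = sym (+-identityˡ _)
  fromℕ-+ (suc a) b = trans (+-congˡ (fromℕ-+ a b)) (sym (+-assoc _ _ _))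

  0<fromℕ′ : ∀ {m} → 0 ℕ.< m → 0# < fromℕ m
  0<fromℕ′ {suc m} _ = 0<fromℕ m

  ⊆⇒≡ : ∀ {K S : Subset n} → K ⊆ S → ¬ K ⊂ S → S ≡ K
  ⊆⇒≡ {K} {S} K⊆S K⊄S = ⊆-antisym S⊆K K⊆S
    where
    S⊆K : S ⊆ K
    S⊆K {x} x∈S with x ∈? K
    ... | yes x∈K = x∈K
    ... | no  x∉K = ⊥-elim (K⊄S (K⊆S , x , x∈S , x∉K))

  ratio : (K L S : Subset n) → Carrier
  ratio K L S = (size S - size K) * fromℕ ∣ L ─ K ∣ ⁻¹

  -- A coordinate of the projection onto the interval, for a function of arbitrary subsets whose
  -- values at `K` and `L` need not vanish: the interpolation between the ends that is affine in the
  -- cardinality is subtracted.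
  coef : (K L : Subset n) → (Subset n → Carrier) → Subset n → Carrier
  coef K L x S = x S - ratio K L S * x L - (1# - ratio K L S) * x K

  module _ {K L : Subset n} (K⊂L : K ⊂ L) where

    private
      ℓ = fromℕ ∣ L ─ K ∣
      ℓ≈ : ℓ ≈ size L - size K
      ℓ≈ = ∣─∣≈ (p⊂q⇒p⊆q K⊂L)
      ℓ≉0 : ¬ ℓ ≈ 0#
      ℓ≉0 = >⇒≉ (<-respʳ (sym ℓ≈) (size-< K⊂L))

    ratio-K : ratio K L K ≈ 0#
    ratio-K = trans (*-congʳ (-‿inverseʳ _)) (zeroˡ _)

    ratio-L : ratio K L L ≈ 1#
    ratio-L = trans (*-congʳ (sym ℓ≈)) (*-inverseʳ ℓ≉0)

    0≤ratio : ∀ {S} → K ⊆ S → 0# ≤ ratio K L S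
    0≤ratio K⊆S = 0≤* (size-≤ K⊆S) (<⇒≤ (0<⁻¹ (<-respʳ (sym ℓ≈) (size-< K⊂L))))

    ratio-lower : ∀ {S} → K ⊆ S → fromℕ ∣ S ─ K ∣ * ℓ ⁻¹ ≈ ratio K L S
    ratio-lower K⊆S = *-congʳ (∣─∣≈ K⊆S)

    ratio-upper : ∀ {S} → S ⊆ L → fromℕ ∣ L ─ S ∣ * ℓ ⁻¹ ≈ 1# - ratio K L S
    ratio-upper {S} S⊆L = begin
      fromℕ ∣ L ─ S ∣ * ℓ ⁻¹                  ≈⟨ *-congʳ (∣─∣≈ S⊆L) ⟩
      (size L - size S) * ℓ ⁻¹
        ≈⟨ solve 4 (λ l s k i → (l :- s) :* i := (l :- k) :* i :- (s :- k) :* i) refl (size L) (size S) (size K) (ℓ ⁻¹) ⟩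
      (size L - size K) * ℓ ⁻¹ - ratio K L S   ≈⟨ +-congʳ ratio-L ⟩
      1# - ratio K L S                         ∎
      where open ≈-Reasoning

    coef-linear : ∀ S → IsLinear (λ x → coef K L x S)
    coef-linear S = record
      { cong   = λ p → +-cong (+-cong (p S) (-‿cong (*-congˡ (p L)))) (-‿cong (*-congˡ (p K)))
      ; linear = λ s x r y → solve 9 (λ s r ρ xS xL xK yS yL yK →
          (s :* xS :+ r :* yS) :- ρ :* (s :* xL :+ r :* yL) :- (num (+ 1) :- ρ) :* (s :* xK :+ r :* yK) :=
          s :* (xS :- ρ :* xL :- (num (+ 1) :- ρ) :* xK) :+ r :* (yS :- ρ :* yL :- (num (+ 1) :- ρ) :* yK))
          refl s r (ratio K L S) (x S) (x L) (x K) (y S) (y L) (y K) }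

    -- The subtracted interpolation is itself affine in the cardinality, hence exact on such
    -- functions.
    coef-affine : ∀ α β S → coef K L (λ T → α + β * size T) S ≈ 0#
    coef-affine α β S = begin
      coef K L (λ T → α + β * size T) S
        ≈⟨ solve 6 (λ α β s l k i → (α :+ β :* s) :- (s :- k) :* i :* (α :+ β :* l) :- (num (+ 1) :- (s :- k) :* i) :* (α :+ β :* k) :=
             β :* (s :- k) :- β :* (s :- k) :* ((l :- k) :* i)) refl α β (size S) (size L) (size K) (ℓ ⁻¹) ⟩
      β * (size S - size K) - β * (size S - size K) * ratio K L L
        ≈⟨ +-congˡ (-‿cong (trans (*-congˡ ratio-L) (*-identityʳ _))) ⟩
      β * (size S - size K) - β * (size S - size K)
        ≈⟨ -‿inverseʳ _ ⟩
      0# ∎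
      where open ≈-Reasoning

    coef-K : ∀ x → coef K L x K ≈ 0#
    coef-K x = trans (+-cong (+-congˡ (-‿cong (*-congʳ ratio-K))) (-‿cong (*-congʳ (+-congˡ (-‿cong ratio-K)))))
      (solve 2 (λ k l → k :- num (+ 0) :* l :- (num (+ 1) :- num (+ 0)) :* k := num (+ 0)) refl (x K) (x L))

    coef-L : ∀ x → coef K L x L ≈ 0#
    coef-L x = trans (+-cong (+-congˡ (-‿cong (*-congʳ ratio-L))) (-‿cong (*-congʳ (+-congˡ (-‿cong ratio-L)))))
      (solve 2 (λ k l → l :- num (+ 1) :* l :- (num (+ 1) :- num (+ 1)) :* k := num (+ 0)) refl (x K) (x L))

    coef-ends : ∀ {x} S → x L ≈ 0# → x K ≈ 0# → coef K L x S ≈ x S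
    coef-ends {x} S xL≈0 xK≈0 = trans (+-cong (+-congˡ (-‿cong (*-congˡ xL≈0))) (-‿cong (*-congˡ xK≈0)))
      (solve 2 (λ s r → s :- r :* num (+ 0) :- (num (+ 1) :- r) :* num (+ 0) := s) refl (x S) (ratio K L S))

  -- The inner projection changes `x` by an affine function of the cardinality, which the outer one
  -- kills. Hence iterated projections collapse and all the polynomials can share one set of
  -- variables.
  coef-absorb : ∀ {A B K L : Subset n} → A ⊂ B → ∀ x S → coef A B (coef K L x) S ≈ coef A B x S
  coef-absorb {A} {B} {K} {L} A⊂B x S = begin
    coef A B (coef K L x) S
      ≈⟨ IsLinear.cong (coef-linear A⊂B S) (λ T → solve 6 (λ s t k i xL xK →
           s :- (t :- k) :* i :* xL :- (num (+ 1) :- (t :- k) :* i) :* xK :=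
           num (+ 1) :* s :+ (:- num (+ 1)) :* ((xK :- k :* i :* (xL :- xK)) :+ i :* (xL :- xK) :* t))
           refl (x T) (size T) (size K) i (x L) (x K)) ⟩
    coef A B (lin 1# x (- 1#) affine) S
      ≈⟨ IsLinear.linear (coef-linear A⊂B S) 1# x (- 1#) affine ⟩
    1# * coef A B x S + - 1# * coef A B affine S
      ≈⟨ +-congˡ (*-congˡ (coef-affine A⊂B _ _ S)) ⟩
    1# * coef A B x S + - 1# * 0#
      ≈⟨ solve 1 (λ a → num (+ 1) :* a :+ (:- num (+ 1)) :* num (+ 0) := a) refl (coef A B x S) ⟩
    coef A B x S ∎
    where
    open ≈-Reasoning
    i = fromℕ ∣ L ─ K ∣ ⁻¹
    affine : Subset n → Carrier
    affine T = (x K - size K * i * (x L - x K)) + i * (x L - x K) * size T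

  coefPoly : (K L S : Subset n) → Poly (Subset n)
  coefPoly K L S = var S ⊖ con (ratio K L S) ⊗ var L ⊖ con (1# - ratio K L S) ⊗ var K

  eval-coefPoly : ∀ K L S x → eval (coefPoly K L S) x ≈ coef K L x S
  eval-coefPoly K L S x = solve 4 (λ s r l k →
    s :+ (:- num (+ 1)) :* (r :* l) :+ (:- num (+ 1)) :* ((num (+ 1) :- r) :* k) :=
    s :- r :* l :- (num (+ 1) :- r) :* k) refl (x S) (ratio K L S) (x L) (x K)

  D-coefPoly : ∀ K L u S → D u (coefPoly K L S) ≋ con (coef K L u S)
  D-coefPoly K L u S x = solve 6 (λ s r l k xl xk →
    s :+ (num (+ 0) :* (r :* xl) :+ (:- num (+ 1)) :* (num (+ 0) :* xl :+ r :* l))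
      :+ (num (+ 0) :* ((num (+ 1) :- r) :* xk) :+ (:- num (+ 1)) :* (num (+ 0) :* xk :+ (num (+ 1) :- r) :* k)) :=
    s :- r :* l :- (num (+ 1) :- r) :* k) refl (u S) (ratio K L S) (u L) (u K) (x L) (x K)

  P : (K L : Subset n) → Poly (Subset n)
  P K L = pol K L [ (λ S → coefPoly K L (set S)) ]

  P≋1 : ∀ {K L} → degree K L ≡ 0 → P K L ≋ con 1#
  P≋1 {K} {L} eq x = reflexive (≡.cong (λ f → eval (f [ (λ S → coefPoly K L (set S)) ]) x) (pol-zero {K} {L} eq))

  Inner : (K L F : Subset n) → Set p
  Inner K L F = 𝒫 F × K ⊂ F × F ⊂ L

  inner? : ∀ K L F → Dec (Inner K L F)
  inner? K L F = 𝒫? F ×-dec ((K ⊂? F) ×-dec (F ⊂? L))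

  -- Ranks add along `K ⊂ F ⊂ L`, and each degree is one less than a positive rank, so one unit is
  -- left over.
  degree-sum : ∀ {K F L} → 𝒫 K → 𝒫 L → Inner K L F → degree K L ≡ suc (degree K F ℕ.+ degree F L)
  degree-sum {K} {F} {L} PK PL (PF , K⊂F , F⊂L)
    with rank K F | rank F L | rank K L | rank-positive PK PF K⊂F | rank-positive PF PL F⊂L | rank-additive PK PF PL K⊂F F⊂L
  ... | suc a | suc b | _ | _ | _ | ≡.refl = ≡.trans (ℕ.+-suc b a) (≡.cong suc (ℕ.+-comm b a))

  no-inner : ∀ {K L F} → 𝒫 K → 𝒫 L → degree K L ≡ 0 → ¬ Inner K L F
  no-inner PK PL d≡0 inner with ≡.trans (≡.sym d≡0) (degree-sum PK PL inner)
  ... | ()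

  ∑ᵢ : (K L : Subset n) → (Subset n → Carrier) → Carrier
  ∑ᵢ K L f = ∑ₛ λ F → when (inner? K L F) (f F)

  ∑ᵢ-cong : ∀ K L {f g : Subset n → Carrier} → (∀ F → Inner K L F → f F ≈ g F) → ∑ᵢ K L f ≈ ∑ᵢ K L g
  ∑ᵢ-cong K L e = ∑ₛ-cong {n} λ F → when-cong (inner? K L F) (e F)

  ∑ᵢ-zero : ∀ K L {f : Subset n → Carrier} → (∀ F → Inner K L F → f F ≈ 0#) → ∑ᵢ K L f ≈ 0#
  ∑ᵢ-zero K L e = ∑ₛ-zero {n} λ F → when-zero (inner? K L F) (e F)

  ∑ᵢ-+ : ∀ K L (f g : Subset n → Carrier) → ∑ᵢ K L (λ F → f F + g F) ≈ ∑ᵢ K L f + ∑ᵢ K L g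
  ∑ᵢ-+ K L f g = trans (∑ₛ-cong {n} λ F → when-+ (inner? K L F) (f F) (g F))
    (∑ₛ-+ (λ F → when (inner? K L F) (f F)) (λ F → when (inner? K L F) (g F)))

  ∑ᵢ-* : ∀ K L a (f : Subset n → Carrier) → ∑ᵢ K L (λ F → a * f F) ≈ a * ∑ᵢ K L f
  ∑ᵢ-* K L a f = trans (∑ₛ-cong {n} λ F → when-* (inner? K L F) a (f F))
    (∑ₛ-* a (λ F → when (inner? K L F) (f F)))

  eval-sumSubsets : ∀ {I : Set} {m} (f : Subset m → Poly I) x →
                    eval (sumSubsets _⊕_ f) x ≡ ∑ₛ (λ S → eval (f S) x)
  eval-sumSubsets {m = zero}  f x = ≡.refl
  eval-sumSubsets {m = suc m} f x = ≡.cong₂ _+_ (eval-sumSubsets (f ∘ (outside ∷_)) x) (eval-sumSubsets (f ∘ (inside ∷_)) x)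

  D-sumSubsets : ∀ {I : Set} {m} u (f : Subset m → Poly I) x →
                 eval (D u (sumSubsets _⊕_ f)) x ≡ ∑ₛ (λ S → eval (D u (f S)) x)
  D-sumSubsets {m = zero}  u f x = ≡.refl
  D-sumSubsets {m = suc m} u f x = ≡.cong₂ _+_ (D-sumSubsets u (f ∘ (outside ∷_)) x) (D-sumSubsets u (f ∘ (inside ∷_)) x)

  private
    eval-extend : ∀ {K L : Subset n} (f : Between K L → Poly (Between K L)) y S {v} →
                  (∀ K⊂S S⊂L → eval (f (between S K⊂S S⊂L)) y ≈ v) →
                  eval (extend (con 0#) f S) y ≈ when ((K ⊂? S) ×-dec (S ⊂? L)) v
    eval-extend {K} {L} f y S e with K ⊂? S | S ⊂? L
    ... | yes K⊂S | yes S⊂L = e K⊂S S⊂L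
    ... | yes _   | no _    = refl
    ... | no _    | _       = refl

    -- At the two ends `t` is zero by convention, and `coef` is zero there by computation.
    eval-t : ∀ {K L} → K ⊂ L → ∀ x {S} → K ⊆ S → S ⊆ L →
             eval (t {K = K} {L} S) (λ T → eval (coefPoly K L (set T)) x) ≈ coef K L x S
    eval-t {K} {L} K⊂L x {S} K⊆S S⊆L with K ⊂? S | S ⊂? L
    ... | yes _   | yes _   = eval-coefPoly K L S x
    ... | no K⊄S  | _       with ≡.refl ← ⊆⇒≡ K⊆S K⊄S = sym (coef-K K⊂L x)
    ... | yes _   | no S⊄L  with ≡.refl ← ⊆⇒≡ S⊆L S⊄L = sym (coef-L K⊂L x)

    eval-π : ∀ {K L A B} → K ⊂ L → K ⊆ A → A ⊂ B → B ⊆ L → ∀ x (S : Between A B) → A ⊂ set S → set S ⊂ B →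
             eval (π {K = K} {L} A B S) (λ T → eval (coefPoly K L (set T)) x) ≈ eval (coefPoly A B (set S)) x
    eval-π {K} {L} {A} {B} K⊂L K⊆A A⊂B B⊆L x S′ A⊂S S⊂B = begin
      eval (t S) y + - 1# * (fromℕ ∣ S ─ A ∣ * ℓ * eval (t B) y) + - 1# * (fromℕ ∣ B ─ S ∣ * ℓ * eval (t A) y)
        ≈⟨ +-cong (+-cong (eval-t K⊂L x K⊆S S⊆L)
             (*-congˡ (*-cong (ratio-lower A⊂B (p⊂q⇒p⊆q A⊂S)) (eval-t K⊂L x K⊆B B⊆L))))
             (*-congˡ (*-cong (ratio-upper A⊂B (p⊂q⇒p⊆q S⊂B)) (eval-t K⊂L x K⊆A A⊆L))) ⟩
      z S + - 1# * (ratio A B S * z B) + - 1# * ((1# - ratio A B S) * z A) ≈⟨ eval-coefPoly A B S z ⟩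
      coef A B z S                                                       ≈⟨ coef-absorb A⊂B x S ⟩
      coef A B x S                                                       ≈⟨ eval-coefPoly A B S x ⟨
      eval (coefPoly A B S) x                                            ∎
      where
      open ≈-Reasoning
      S = set S′
      ℓ = fromℕ ∣ B ─ A ∣ ⁻¹
      y : Between K L → Carrier
      y T = eval (coefPoly K L (set T)) x
      z = coef K L x
      K⊆S : K ⊆ S
      K⊆S = ⊆-trans K⊆A (p⊂q⇒p⊆q A⊂S)
      S⊆L : S ⊆ L
      S⊆L = ⊆-trans (p⊂q⇒p⊆q S⊂B) B⊆L
      K⊆B : K ⊆ B
      K⊆B = ⊆-trans K⊆A (p⊂q⇒p⊆q A⊂B)
      A⊆L : A ⊆ L
      A⊆L = ⊆-trans (p⊂q⇒p⊆q A⊂B) B⊆L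

    eval-pol[π] : ∀ {K L A B} → K ⊂ L → K ⊆ A → A ⊂ B → B ⊆ L → ∀ x →
                  eval (pol A B [ π {K = K} {L} A B ]) (λ T → eval (coefPoly K L (set T)) x) ≈ eval (P A B) x
    eval-pol[π] {K} {L} {A} {B} K⊂L K⊆A A⊂B B⊆L x = begin
      eval (pol A B [ π A B ]) y               ≡⟨ eval-[] (pol A B) (π A B) y ⟩
      eval (pol A B) (λ S → eval (π A B S) y)
        ≈⟨ eval-cong (pol A B) (λ S → eval-π K⊂L K⊆A A⊂B B⊆L x S (proj₁ (recompute S)) (proj₂ (recompute S))) ⟩
      eval (pol A B) (λ S → eval (coefPoly A B (set S)) x) ≡⟨ eval-[] (pol A B) _ x ⟨
      eval (P A B) x                           ∎
      where
      open ≈-Reasoning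
      y : Between K L → Carrier
      y T = eval (coefPoly K L (set T)) x

  P-recursion : ∀ {K L} → 𝒫 K → 𝒫 L → K ⊂ L → ∀ x → fromℕ (degree K L) * eval (P K L) x ≈
                ∑ᵢ K L (λ F → coef K L x F * (eval (P K F) x * eval (P F L) x))
  P-recursion {K} {L} PK PL K⊂L x = by-degree (degree K L) ≡.refl
    where
    y : Between K L → Carrier
    y T = eval (coefPoly K L (set T)) x
    term : ∀ F → eval (recursionTerm pol K L F) y ≈
           when (inner? K L F) (coef K L x F * (eval (P K F) x * eval (P F L) x))
    term F with 𝒫? F
    ... | no _   = refl
    ... | yes PF = eval-extend {K} {L} (λ G → var G ⊗ pol K F [ π K F ] ⊗ pol F L [ π F L ]) y F
      {coef K L x F * (eval (P K F) x * eval (P F L) x)} λ K⊂F F⊂L → trans (*-assoc _ _ _) (*-cong (eval-coefPoly K L F x)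
      (*-cong (eval-pol[π] K⊂L ⊆-refl K⊂F (p⊂q⇒p⊆q F⊂L) x) (eval-pol[π] K⊂L (p⊂q⇒p⊆q K⊂F) F⊂L ⊆-refl x)))
    by-degree : ∀ d → degree K L ≡ d → fromℕ (degree K L) * eval (P K L) x ≈
                ∑ᵢ K L (λ F → coef K L x F * (eval (P K F) x * eval (P F L) x))
    -- In degree zero the left side has the factor zero and the right side is an empty sum, although
    -- the polynomial itself is one.
    by-degree zero    d≡ = trans (trans (*-congʳ (reflexive (≡.cong fromℕ d≡))) (zeroˡ _))
      (sym (∑ᵢ-zero K L λ F inner → ⊥-elim (no-inner PK PL d≡ inner)))
    by-degree (suc d) d≡ = begin
      fromℕ (degree K L) * eval (P K L) x   ≡⟨ ≡.cong (fromℕ (degree K L) *_) (eval-[] (pol K L) _ x) ⟩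
      fromℕ (degree K L) * eval (pol K L) y ≈⟨ pol-recursion PK PL (≡.subst (0 ℕ.<_) (≡.sym d≡) (s≤s z≤n)) y ⟩
      eval (recursionSum pol K L) y         ≡⟨ eval-sumSubsets (recursionTerm pol K L) y ⟩
      ∑ₛ (λ F → eval (recursionTerm pol K L F) y) ≈⟨ ∑ₛ-cong {n} term ⟩
      ∑ᵢ K L (λ F → coef K L x F * (eval (P K F) x * eval (P F L) x)) ∎
      where open ≈-Reasoning

  -- A summand of the recursion kept as an expression, so that `D` applies to it. The coefficients
  -- are a parameter: coordinate forms in the recursion, constants in the formula for a first
  -- derivative.
  innerTerm : (K L : Subset n) → (Subset n → Poly (Subset n)) → Subset n → Poly (Subset n)
  innerTerm K L c F = if does (inner? K L F) then c F ⊗ (P K F ⊗ P F L) else con 0#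

  innerPoly : (K L : Subset n) → (Subset n → Poly (Subset n)) → Poly (Subset n)
  innerPoly K L c = sumSubsets _⊕_ (innerTerm K L c)

  eval-innerPoly : ∀ K L c x → eval (innerPoly K L c) x ≈ ∑ᵢ K L (λ F → eval (c F) x * (eval (P K F) x * eval (P F L) x))
  eval-innerPoly K L c x = trans (reflexive (eval-sumSubsets (innerTerm K L c) x)) (∑ₛ-cong {n} summand)
    where
    summand : ∀ F → eval (innerTerm K L c F) x ≈
              when (inner? K L F) (eval (c F) x * (eval (P K F) x * eval (P F L) x))
    summand F with does (inner? K L F)
    ... | true  = refl
    ... | false = refl

  D-innerPoly : ∀ K L c u x → eval (D u (innerPoly K L c)) x ≈
    ∑ᵢ K L (λ F → eval (D u (c F)) x * (eval (P K F) x * eval (P F L) x) +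
      eval (c F) x * (eval (D u (P K F)) x * eval (P F L) x + eval (P K F) x * eval (D u (P F L)) x))
  D-innerPoly K L c u x = trans (reflexive (D-sumSubsets u (innerTerm K L c) x)) (∑ₛ-cong {n} summand)
    where
    summand : ∀ F → eval (D u (innerTerm K L c F)) x ≈
      when (inner? K L F) (eval (D u (c F)) x * (eval (P K F) x * eval (P F L) x) +
        eval (c F) x * (eval (D u (P K F)) x * eval (P F L) x + eval (P K F) x * eval (D u (P F L)) x))
    summand F with does (inner? K L F)
    ... | true  = refl
    ... | false = refl

  D-P-recursion : ∀ {K L} → 𝒫 K → 𝒫 L → K ⊂ L → ∀ u x → fromℕ (degree K L) * eval (D u (P K L)) x ≈
    ∑ᵢ K L (λ F → coef K L u F * (eval (P K F) x * eval (P F L) x)) +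
    ∑ᵢ K L (λ F → coef K L x F * (eval (D u (P K F)) x * eval (P F L) x + eval (P K F) x * eval (D u (P F L)) x))
  D-P-recursion {K} {L} PK PL K⊂L u x = begin
    fromℕ (degree K L) * eval (D u (P K L)) x
      ≈⟨ trans (+-congʳ (zeroˡ _)) (+-identityˡ _) ⟨
    eval (D u (con (fromℕ (degree K L)) ⊗ P K L)) x
      ≈⟨ D-cong u {con (fromℕ (degree K L)) ⊗ P K L} {innerPoly K L (coefPoly K L)}
           (λ z → trans (P-recursion PK PL K⊂L z) (sym (trans (eval-innerPoly K L (coefPoly K L) z)
             (∑ᵢ-cong K L λ F _ → *-congʳ (eval-coefPoly K L F z))))) x ⟩
    eval (D u (innerPoly K L (coefPoly K L))) x
      ≈⟨ trans (D-innerPoly K L (coefPoly K L) u x) (∑ᵢ-cong K L λ F _ →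
           +-cong (*-congʳ (D-coefPoly K L u F x)) (*-congʳ (eval-coefPoly K L F x))) ⟩
    ∑ᵢ K L (λ F → coef K L u F * (eval (P K F) x * eval (P F L) x) +
      coef K L x F * (eval (D u (P K F)) x * eval (P F L) x + eval (P K F) x * eval (D u (P F L)) x))
      ≈⟨ ∑ᵢ-+ K L _ _ ⟩
    ∑ᵢ K L (λ F → coef K L u F * (eval (P K F) x * eval (P F L) x)) +
    ∑ᵢ K L (λ F → coef K L x F * (eval (D u (P K F)) x * eval (P F L) x + eval (P K F) x * eval (D u (P F L)) x)) ∎
    where open ≈-Reasoning

-- The formula for the derivative.

module DerivativeFormula {c ℓ₁ ℓ₂ p} (ℝ : RealNumbers c ℓ₁ ℓ₂) {n} {𝒫 : Pred (Subset n) p}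
                         (𝒫? : Decidable 𝒫) (graded : IntervalsGraded 𝒫) where

  open OrderedField ℝ
  open LinearAlgebra ℝ hiding (e)
  open Lorentz ℝ
  open Polynomials ℝ
  open SubsetSums ℝ
  open IntervalsGraded graded
  open Derivatives ℝ 𝒫? graded

  private
    pull : ∀ {a b} {A : Set a} {B : Subset n → Set b} (d : Dec A) (d′ : ∀ G → Dec (B G)) r s (f : Subset n → Carrier) →
           when d (r * (∑ₛ (λ G → when (d′ G) (f G)) * s)) ≈ ∑ₛ (λ G → when (d ×-dec d′ G) (r * (f G * s)))
    pull (no _)  d′ r s f = sym (∑ₛ-zero {n} λ G → refl)
    pull (yes _) d′ r s f = begin
      r * (∑ₛ (λ G → when (d′ G) (f G)) * s)
        ≈⟨ solve 3 (λ r z s → r :* (z :* s) := (r :* s) :* z) refl r (∑ₛ (λ G → when (d′ G) (f G))) s ⟩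
      r * s * ∑ₛ (λ G → when (d′ G) (f G))      ≈⟨ ∑ₛ-* (r * s) (λ G → when (d′ G) (f G)) ⟨
      ∑ₛ (λ G → r * s * when (d′ G) (f G))
        ≈⟨ ∑ₛ-cong {n} (λ G → trans (sym (when-* (d′ G) (r * s) (f G))) (when-cong (d′ G) λ _ →
             solve 3 (λ r z s → (r :* s) :* z := r :* (z :* s)) refl r (f G) s)) ⟩
      ∑ₛ (λ G → when (d′ G) (r * (f G * s)))    ∎
      where open ≈-Reasoning

  -- The double sum over K ⊂ G ⊂ F ⊂ L hidden in the derivative of the recursion is
  -- symmetric in the direction u and the point v.

  module _ {K L : Subset n} (K⊂L : K ⊂ L) (q : Subset n → Subset n → Carrier) where

    lower-sum upper-sum : (u v : Subset n → Carrier) → Carrier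
    lower-sum u v = ∑ᵢ K L λ F → coef K L v F * (∑ᵢ K F (λ G → coef K F u G * (q K G * q G F)) * q F L)
    upper-sum u v = ∑ᵢ K L λ F → coef K L v F * (q K F * ∑ᵢ F L (λ G → coef F L u G * (q F G * q G L)))

    private
      Chain : Subset n → Subset n → Set p
      Chain G F = Inner K L F × Inner K F G

      chain? : ∀ G F → Dec (Chain G F)
      chain? G F = inner? K L F ×-dec inner? K F G

      T : Subset n → Subset n → Carrier
      T G F = q K G * q G F * q F L

      lower-term upper-term : (u v : Subset n → Carrier) (G F : Subset n) → Carrier
      lower-term u v G F = coef K L v F * (coef K L u G - ratio K F G * coef K L u F) * T G F
      upper-term u v G F = coef K L v G * (coef K L u F - (1# - ratio G L F) * coef K L u G) * T G F

      lower≈ : ∀ u v → lower-sum u v ≈ ∑ₛ λ F → ∑ₛ λ G → when (chain? G F) (lower-term u v G F)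
      lower≈ u v = ∑ₛ-cong {n} λ F → trans
        (pull (inner? K L F) (inner? K F) (coef K L v F) (q F L) (λ G → coef K F u G * (q K G * q G F)))
        (∑ₛ-cong {n} λ G → when-cong (chain? G F) λ { ((_ , K⊂F , _) , _) → trans
          -- Passing to the projected `u` makes its value at `K` zero, so that of the interpolation
          -- only the part at `F` remains.
          (*-congˡ (*-congʳ (*-congʳ (trans (sym (coef-absorb {K = K} {L} K⊂F u G))
            (+-congˡ (-‿cong (*-congˡ (coef-K K⊂L u))))))))
          (solve 7 (λ vF uG α uF a b d →
              vF :* ((uG :- α :* uF :- (num (+ 1) :- α) :* num (+ 0)) :* (a :* b) :* d) :=
              vF :* (uG :- α :* uF) :* (a :* b :* d))
            refl (coef K L v F) (coef K L u G) (ratio K F G) (coef K L u F) (q K G) (q G F) (q F L)) })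

      upper≈ : ∀ u v → upper-sum u v ≈ ∑ₛ λ F → ∑ₛ λ G → when (chain? G F) (upper-term u v G F)
      upper≈ u v = trans (∑ₛ-cong {n} λ F → trans (when-cong (inner? K L F) λ _ → *-congˡ (*-comm _ _))
          (pull (inner? K L F) (inner? F L) (coef K L v F) (q K F) (λ G → coef F L u G * (q F G * q G L))))
        -- The sums are exchanged and the sets renamed, so that `G` is the smaller of the two here
        -- as well.
        (trans (∑ₛ-comm (λ F G → when (inner? K L F ×-dec inner? F L G)
            (coef K L v F * (coef F L u G * (q F G * q G L) * q K F))))
          (∑ₛ-cong {n} λ F → ∑ₛ-cong {n} λ G → trans
            (when-⇔ (inner? K L G ×-dec inner? G L F) (chain? G F)
              (λ { ((PG , K⊂G , _) , (PF , G⊂F , F⊂L)) → (PF , ⊂-trans K⊂G G⊂F , F⊂L) , (PG , K⊂G , G⊂F) })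
              (λ { ((PF , _ , F⊂L) , (PG , K⊂G , G⊂F)) → (PG , K⊂G , ⊂-trans G⊂F F⊂L) , (PF , G⊂F , F⊂L) }))
            (when-cong (chain? G F) λ { ((PF , _ , F⊂L) , (PG , K⊂G , G⊂F)) → trans
              (*-congˡ (*-congʳ (*-congʳ (trans (sym (coef-absorb {K = K} {L} (⊂-trans G⊂F F⊂L) u F))
                (+-congʳ (+-congˡ (-‿cong (*-congˡ (coef-L K⊂L u)))))))))
              (solve 7 (λ vG uF r uG a b d →
                  vG :* ((uF :- r :* num (+ 0) :- (num (+ 1) :- r) :* uG) :* (b :* d) :* a) :=
                  vG :* (uF :- (num (+ 1) :- r) :* uG) :* (a :* b :* d))
                refl (coef K L v G) (coef K L u F) (ratio G L F) (coef K L u G) (q K G) (q G F) (q F L)) })))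

    lower+upper-symmetric : ∀ u v → lower-sum u v + upper-sum u v ≈ lower-sum v u + upper-sum v u
    lower+upper-symmetric u v = trans (combine u v) (trans (∑ₛ-cong {n} λ F → ∑ₛ-cong {n} λ G → when-cong (chain? G F) λ _ →
        -- Exchanging `u` and `v` swaps the mixed products `vF * uG` and `vG * uF` and fixes the
        -- other two terms.
        solve 7 (λ vF vG uF uG α β t →
            vF :* (uG :- α :* uF) :* t :+ vG :* (uF :- β :* uG) :* t :=
            uF :* (vG :- α :* vF) :* t :+ uG :* (vF :- β :* vG) :* t)
          refl (coef K L v F) (coef K L v G) (coef K L u F) (coef K L u G) (ratio K F G) (1# - ratio G L F) (T G F))
      (sym (combine v u)))
      where
      combine : ∀ u v → lower-sum u v + upper-sum u v ≈
                ∑ₛ λ F → ∑ₛ λ G → when (chain? G F) (lower-term u v G F + upper-term u v G F)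
      combine u v = trans (+-cong (lower≈ u v) (upper≈ u v)) (sym (trans
        (∑ₛ-cong {n} λ F → trans (∑ₛ-cong {n} λ G → when-+ (chain? G F) (lower-term u v G F) (upper-term u v G F))
          (∑ₛ-+ (λ G → when (chain? G F) (lower-term u v G F)) (λ G → when (chain? G F) (upper-term u v G F))))
        (∑ₛ-+ (λ F → ∑ₛ λ G → when (chain? G F) (lower-term u v G F))
              (λ F → ∑ₛ λ G → when (chain? G F) (upper-term u v G F)))))

  -- Induction on the degree. The derivative of the recursion consists of the claimed sum and a
  -- double sum in which `u` and `x` may be exchanged. After the exchange the recursion itself
  -- evaluates the inner sums, and altogether the claimed sum occurs `1 + degree K F + degree F L`
  -- times, which is the factor `degree K L` on the left.
  D-P : ∀ {K L} → 𝒫 K → 𝒫 L → K ⊂ L → ∀ u x →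
        eval (D u (P K L)) x ≈ ∑ᵢ K L (λ F → coef K L u F * (eval (P K F) x * eval (P F L) x))
  D-P {K} {L} PK PL K⊂L u x = go (degree K L) PK PL K⊂L ℕ.≤-refl
    where
    q : Subset n → Subset n → Carrier
    q A B = eval (P A B) x
    go : ∀ m {K L} → 𝒫 K → 𝒫 L → K ⊂ L → degree K L ℕ.≤ m →
         eval (D u (P K L)) x ≈ ∑ᵢ K L (λ F → coef K L u F * (q K F * q F L))
    step : ∀ m {K L} → 𝒫 K → 𝒫 L → K ⊂ L → degree K L ℕ.≤ suc m → ∀ d → degree K L ≡ suc d →
           eval (D u (P K L)) x ≈ ∑ᵢ K L (λ F → coef K L u F * (q K F * q F L))
    degree-zero : ∀ {K L} → 𝒫 K → 𝒫 L → degree K L ≡ 0 →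
                  eval (D u (P K L)) x ≈ ∑ᵢ K L (λ F → coef K L u F * (q K F * q F L))
    degree-zero {K} {L} PK PL d≡0 = trans (D-cong u {P K L} {con 1#} (P≋1 d≡0) x)
      (sym (∑ᵢ-zero K L λ F inner → ⊥-elim (no-inner PK PL d≡0 inner)))
    go zero PK PL K⊂L d≤0 = degree-zero PK PL (ℕ.n≤0⇒n≡0 d≤0)
    go (suc m) {K} {L} PK PL K⊂L d≤ = by-degree (degree K L) ≡.refl
      where
      by-degree : ∀ d → degree K L ≡ d → eval (D u (P K L)) x ≈ ∑ᵢ K L (λ F → coef K L u F * (q K F * q F L))
      by-degree zero    d≡ = degree-zero PK PL d≡
      by-degree (suc d) d≡ = step m PK PL K⊂L d≤ d d≡
    step m {K} {L} PK PL K⊂L d≤ d d≡ = *-cancelˡ (>⇒≉ (0<fromℕ′ (≡.subst (0 ℕ.<_) (≡.sym d≡) (s≤s z≤n)))) (begin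
      fromℕ (degree K L) * eval (D u (P K L)) x
        ≈⟨ D-P-recursion PK PL K⊂L u x ⟩
      Σu + ∑ᵢ K L (λ F → coef K L x F * (eval (D u (P K F)) x * q F L + q K F * eval (D u (P F L)) x))
        ≈⟨ +-congˡ (∑ᵢ-cong K L λ F inner → trans (*-congˡ (+-cong (*-congʳ (below inner)) (*-congˡ (above inner)))) (distribˡ _ _ _)) ⟩
      Σu + ∑ᵢ K L (λ F → coef K L x F * (∑ᵢ K F (λ G → coef K F u G * (q K G * q G F)) * q F L) +
                         coef K L x F * (q K F * ∑ᵢ F L (λ G → coef F L u G * (q F G * q G L))))
        ≈⟨ +-congˡ (∑ᵢ-+ K L _ _) ⟩
      Σu + (lower-sum K⊂L q u x + upper-sum K⊂L q u x)
        ≈⟨ +-congˡ (lower+upper-symmetric K⊂L q u x) ⟩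
      Σu + (lower-sum K⊂L q x u + upper-sum K⊂L q x u)
        ≈⟨ +-congˡ (∑ᵢ-+ K L _ _) ⟨
      Σu + ∑ᵢ K L (λ F → coef K L u F * (∑ᵢ K F (λ G → coef K F x G * (q K G * q G F)) * q F L) +
                         coef K L u F * (q K F * ∑ᵢ F L (λ G → coef F L x G * (q F G * q G L))))
        ≈⟨ ∑ᵢ-+ K L _ _ ⟨
      ∑ᵢ K L (λ F → coef K L u F * (q K F * q F L) +
        (coef K L u F * (∑ᵢ K F (λ G → coef K F x G * (q K G * q G F)) * q F L) +
         coef K L u F * (q K F * ∑ᵢ F L (λ G → coef F L x G * (q F G * q G L)))))
        ≈⟨ ∑ᵢ-cong K L collect ⟩
      ∑ᵢ K L (λ F → fromℕ (degree K L) * (coef K L u F * (q K F * q F L)))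
        ≈⟨ ∑ᵢ-* K L _ _ ⟩
      fromℕ (degree K L) * Σu ∎)
      where
      open ≈-Reasoning
      Σu = ∑ᵢ K L (λ F → coef K L u F * (q K F * q F L))
      below : ∀ {F} → Inner K L F → _
      below (PF , K⊂F , F⊂L) = go m PK PF K⊂F (ℕ.s≤s⁻¹ (ℕ.≤-trans (degree-<ʳ PK PF PL K⊂F F⊂L) d≤))
      above : ∀ {F} → Inner K L F → _
      above (PF , K⊂F , F⊂L) = go m PF PL F⊂L (ℕ.s≤s⁻¹ (ℕ.≤-trans (degree-<ˡ PK PF PL K⊂F F⊂L) d≤))
      collect : ∀ F → Inner K L F →
        coef K L u F * (q K F * q F L) +
        (coef K L u F * (∑ᵢ K F (λ G → coef K F x G * (q K G * q G F)) * q F L) +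
         coef K L u F * (q K F * ∑ᵢ F L (λ G → coef F L x G * (q F G * q G L)))) ≈
        fromℕ (degree K L) * (coef K L u F * (q K F * q F L))
      collect F inner@(PF , K⊂F , F⊂L) = trans
        (+-congˡ (+-cong (*-congˡ (*-congʳ (sym (P-recursion PK PF K⊂F x)))) (*-congˡ (*-congˡ (sym (P-recursion PF PL F⊂L x))))))
        (trans (solve 5 (λ u a b d e → u :* (a :* b) :+ (u :* (d :* a :* b) :+ u :* (a :* (e :* b))) :=
            (num (+ 1) :+ (d :+ e)) :* (u :* (a :* b)))
          refl (coef K L u F) (q K F) (q F L) (fromℕ (degree K F)) (fromℕ (degree F L)))
        (*-congʳ (trans (+-congˡ (sym (fromℕ-+ (degree K F) (degree F L))))
          (reflexive (≡.cong fromℕ (≡.sym (degree-sum PK PL inner)))))))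

-- Atoms, modular directions and intervals of rank three.

module Flats {c ℓ₁ ℓ₂ p} (ℝ : RealNumbers c ℓ₁ ℓ₂) {n} {𝒫 : Pred (Subset n) p}
             (𝒫? : Decidable 𝒫) (graded : IntervalsGraded 𝒫) {K₀ L₀ : Subset n}
             (flats : IsLatticeOfFlats L₀ (Interval 𝒫 K₀ L₀)) where

  open OrderedField ℝ
  open LinearAlgebra ℝ hiding (e)
  open Lorentz ℝ
  open Polynomials ℝ
  open SubsetSums ℝ
  open IntervalsGraded graded
  open Derivatives ℝ 𝒫? graded
  open DerivativeFormula ℝ 𝒫? graded
  open IsLatticeOfFlats flats

  Flat : Pred (Subset n) p
  Flat = Interval 𝒫 K₀ L₀

  inner-flat : ∀ {K L F} → Flat K → Flat L → Inner K L F → Flat F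
  inner-flat (_ , K₀⊆K , _) (_ , _ , L⊆L₀) (PF , K⊂F , F⊂L) =
    PF , ⊆-trans K₀⊆K (p⊂q⇒p⊆q K⊂F) , ⊆-trans (p⊂q⇒p⊆q F⊂L) L⊆L₀

  -- The penultimate member of a maximal chain serves, since positive degree means at least two
  -- steps.
  inner-exists : ∀ {K L} → 𝒫 K → 𝒫 L → K ⊂ L → 0 ℕ.< degree K L → ∃ (Inner K L)
  inner-exists {K} {L} PK PL K⊂L 0<d = middle (chain PK PL (p⊂q⇒p⊆q K⊂L)) 0<d
    where
    chain-⊆ : ∀ {F r} → MaximalChain 𝒫 K F r → K ⊆ F
    chain-⊆ []                       = ⊆-refl
    chain-⊆ (ch ∷ (_ , _ , G⊂F , _)) = ⊆-trans (chain-⊆ ch) (p⊂q⇒p⊆q G⊂F)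
    middle : ∀ {r} → MaximalChain 𝒫 K L r → 0 ℕ.< r ℕ.∸ 1 → ∃ (Inner K L)
    middle ((ch ∷ (_ , PF , G⊂F , _)) ∷ (_ , _ , F⊂L , _)) _ = _ , PF , ⊆-⊂-trans (chain-⊆ ch) G⊂F , F⊂L

  -- `F` may equal `L`, so that the atoms cover `L` minus `K` in degree zero as well.
  Atom : (K L F : Subset n) → Set p
  Atom K L F = 𝒫 F × K ⊂ F × F ⊆ L × degree K F ≡ 0

  atom? : ∀ K L F → Dec (Atom K L F)
  atom? K L F = 𝒫? F ×-dec ((K ⊂? F) ×-dec ((F ⊆? L) ×-dec (degree K F ℕ.≟ 0)))

  atom-flat : ∀ {K L F} → Flat K → Flat L → Atom K L F → Flat F
  atom-flat (_ , K₀⊆K , _) (_ , _ , L⊆L₀) (PF , K⊂F , F⊆L , _) =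
    PF , ⊆-trans K₀⊆K (p⊂q⇒p⊆q K⊂F) , ⊆-trans F⊆L L⊆L₀

  atom-covers : ∀ {K L F} → Flat K → Flat L → Atom K L F → Covers Flat K F
  atom-covers FK FL atom@(PF , K⊂F , _ , d≡0) = FK , atom-flat FK FL atom , K⊂F ,
    λ B FB K⊂B B⊂F → no-inner (proj₁ FK) PF d≡0 (proj₁ FB , K⊂B , B⊂F)

  -- `F ∩ G` is a flat properly above `K`, because it contains `x`; as `F` covers `K`, it cannot be
  -- properly below `F`.
  cover-⊆ : ∀ {K F G x} → Covers Flat K F → Flat G → K ⊆ G → x ∈ F → x ∈ G → x ∉ K → F ⊆ G
  cover-⊆ {K} {F} {G} {x} (_ , FF , K⊂F , minimal) FG K⊆G x∈F x∈G x∉K {y} y∈F with y ∈? G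
  ... | yes y∈G = y∈G
  ... | no  y∉G = ⊥-elim (minimal (F ∩ G) (F2 FF FG)
          ((λ z∈K → x∈p∩q⁺ (p⊂q⇒p⊆q K⊂F z∈K , K⊆G z∈K)) , x , x∈p∩q⁺ (x∈F , x∈G) , x∉K)
          (p∩q⊆p F G , y , y∈F , λ y∈F∩G → y∉G (p∩q⊆q F G y∈F∩G)))

  -- `F3-cover` provides a cover in the whole lattice. It meets `L` in `x` outside `K`, so it lies
  -- inside `L`, and the chain of one step fixes its rank.
  atom-exists : ∀ {K L x} → Flat K → Flat L → K ⊆ L → x ∈ L → x ∉ K → ∃ λ A → Atom K L A × x ∈ A
  atom-exists {K} {L} {x} FK@(PK , K₀⊆K , _) FL K⊆L x∈L x∉K with F3-cover FK (proj₂ (proj₂ FL) x∈L) x∉K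
  ... | A , cover@(_ , (PA , _ , A⊆L₀) , K⊂A , minimal) , x∈A =
    A , (PA , K⊂A , cover-⊆ cover FL K⊆L x∈A x∈L x∉K , ≡.cong (ℕ._∸ 1) (≡.sym rank≡1)) , x∈A
    where
    rank≡1 : 1 ≡ rank K A
    rank≡1 = chain-length PK PA (p⊂q⇒p⊆q K⊂A) ([] ∷ (PK , PA , K⊂A , λ B PB K⊂B B⊂A →
      minimal B (PB , ⊆-trans K₀⊆K (p⊂q⇒p⊆q K⊂B) , ⊆-trans (p⊂q⇒p⊆q B⊂A) A⊆L₀) K⊂B B⊂A))

  atom-unique : ∀ {K L A B x} → Flat K → Flat L → Atom K L A → Atom K L B → x ∉ K → x ∈ A → x ∈ B → A ≡ B
  atom-unique FK FL atom-A atom-B = F3-disjoint (atom-covers FK FL atom-A) (atom-covers FK FL atom-B)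

  ∑ₐ : (K L : Subset n) → (Subset n → Carrier) → Carrier
  ∑ₐ K L f = ∑ₛ λ F → when (atom? K L F) (f F)

  ∑ₐ-cong : ∀ K L {f g : Subset n → Carrier} → (∀ F → Atom K L F → f F ≈ g F) → ∑ₐ K L f ≈ ∑ₐ K L g
  ∑ₐ-cong K L e = ∑ₛ-cong {n} λ F → when-cong (atom? K L F) (e F)

  ∑ₐ-+ : ∀ K L (f g : Subset n → Carrier) → ∑ₐ K L (λ F → f F + g F) ≈ ∑ₐ K L f + ∑ₐ K L g
  ∑ₐ-+ K L f g = trans (∑ₛ-cong {n} λ F → when-+ (atom? K L F) (f F) (g F))
    (∑ₛ-+ (λ F → when (atom? K L F) (f F)) (λ F → when (atom? K L F) (g F)))

  ∑ₐ-* : ∀ K L a (f : Subset n → Carrier) → ∑ₐ K L (λ F → a * f F) ≈ a * ∑ₐ K L f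
  ∑ₐ-* K L a f = trans (∑ₛ-cong {n} λ F → when-* (atom? K L F) a (f F))
    (∑ₛ-* a (λ F → when (atom? K L F) (f F)))

  ∑ₐ-at : ∀ {K L A i} → Flat K → Flat L → Atom K L A → i ∈ A → i ∉ K → ∀ (f : Subset n → Carrier) →
          ∑ₐ K L (λ F → when (i ∈∖? F , K) (f F)) ≈ f A
  ∑ₐ-at {K} {L} {A} {i} FK FL atom-A i∈A i∉K f = trans
    (∑ₛ-single A λ F F≢A → when-zero (atom? K L F) λ atom-F → when-no (i ∈∖? F , K) λ { (i∈F , _) →
      F≢A (atom-unique FK FL atom-F atom-A i∉K i∈F i∈A) })
    (trans (when-yes (atom? K L A) atom-A) (when-yes (i ∈∖? A , K) (i∈A , i∉K)))

  -- The additive form of (F3): after exchanging the sums, each element of `L` outside `K` is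
  -- counted for exactly one atom.
  partition : ∀ {K L} → Flat K → Flat L → K ⊆ L → ∀ a →
              ∑ₐ K L (λ F → weight a F - weight a K) ≈ weight a L - weight a K
  partition {K} {L} FK FL K⊆L a = begin
    ∑ₐ K L (λ F → weight a F - weight a K)
      ≈⟨ ∑ₐ-cong K L (λ { F (_ , K⊂F , _) → weight-difference a (p⊂q⇒p⊆q K⊂F) }) ⟩
    ∑ₐ K L (λ F → sum (λ i → when (i ∈∖? F , K) (a i)))
      ≈⟨ ∑ₛ-cong {n} (λ F → when-sum (atom? K L F) λ i → when (i ∈∖? F , K) (a i)) ⟩
    ∑ₛ (λ F → sum (λ i → when (atom? K L F) (when (i ∈∖? F , K) (a i))))
      ≈⟨ ∑ₛ-sum (λ F i → when (atom? K L F) (when (i ∈∖? F , K) (a i))) ⟩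
    sum (λ i → ∑ₐ K L (λ F → when (i ∈∖? F , K) (a i)))
      ≈⟨ sum-cong-≋ element ⟩
    sum (λ i → when (i ∈∖? L , K) (a i))
      ≈⟨ weight-difference a K⊆L ⟨
    weight a L - weight a K ∎
    where
    open ≈-Reasoning
    when-sum : ∀ {A : Set p} (d : Dec A) (f : Fin n → Carrier) → when d (sum f) ≈ sum (λ i → when d (f i))
    when-sum (yes _) f = refl
    when-sum (no _)  f = sym (sum-zero {n} λ i → refl)
    element : ∀ i → ∑ₐ K L (λ F → when (i ∈∖? F , K) (a i)) ≈ when (i ∈∖? L , K) (a i)
    element i = by (i ∈∖? L , K)
      where
      by : (d : Dec (i ∈ L × i ∉ K)) → ∑ₐ K L (λ F → when (i ∈∖? F , K) (a i)) ≈ when d (a i)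
      by (yes (i∈L , i∉K)) with atom-exists FK FL K⊆L i∈L i∉K
      ... | A , atom-A , i∈A = ∑ₐ-at FK FL atom-A i∈A i∉K (λ _ → a i)
      by (no ¬i) = ∑ₛ-zero {n} λ F → when-zero (atom? K L F) λ { (_ , _ , F⊆L , _) →
        when-no (i ∈∖? F , K) λ { (i∈F , i∉K) → ¬i (F⊆L i∈F , i∉K) } }

  inner⇒atom : ∀ {K L F} → 𝒫 K → 𝒫 L → degree K L ≡ 1 → Inner K L F → Atom K L F
  inner⇒atom PK PL d≡1 inner@(PF , K⊂F , F⊂L) = PF , K⊂F , p⊂q⇒p⊆q F⊂L ,
    ℕ.m+n≡0⇒m≡0 _ (ℕ.suc-injective (≡.trans (≡.sym (degree-sum PK PL inner)) d≡1))

  atom⇒inner : ∀ {K L F d} → degree K L ≡ suc d → Atom K L F → Inner K L F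
  atom⇒inner {K} {L} {F} d≡ (PF , K⊂F , F⊆L , d≡0) with F ⊂? L
  ... | yes F⊂L = PF , K⊂F , F⊂L
  ... | no  F⊄L with ≡.refl ← ⊆⇒≡ F⊆L F⊄L with () ← ≡.trans (≡.sym d≡0) d≡

  inner-degreeʳ : ∀ {K L F} → 𝒫 K → 𝒫 L → degree K L ≡ 1 → Inner K L F → degree F L ≡ 0
  inner-degreeʳ {K} {L} {F} PK PL d≡1 inner =
    ℕ.m+n≡0⇒n≡0 (degree K F) (ℕ.suc-injective (≡.trans (≡.sym (degree-sum PK PL inner)) d≡1))

  D-P-degree-one : ∀ {K L} → 𝒫 K → 𝒫 L → K ⊂ L → degree K L ≡ 1 → ∀ u x →
                   eval (D u (P K L)) x ≈ ∑ᵢ K L (coef K L u)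
  D-P-degree-one {K} {L} PK PL K⊂L d≡1 u x = trans (D-P PK PL K⊂L u x) (∑ᵢ-cong K L λ F inner → trans
    (*-congˡ (*-cong (P≋1 (proj₂ (proj₂ (proj₂ (inner⇒atom PK PL d≡1 inner)))) x) (P≋1 (inner-degreeʳ PK PL d≡1 inner) x)))
    (trans (*-congˡ (*-identityˡ _)) (*-identityʳ _)))

  -- In degree one the derivative is a sum of coordinates over the atoms, which vanishes by
  -- `partition`. In degree d at least two, differentiating the recursion yields d times the
  -- derivative; one part of the result is the derivative itself by `D-P`, the other is zero by
  -- induction, so d - 1 times the derivative is zero.
  D-weight : ∀ a {K L} → Flat K → Flat L → K ⊂ L → D (weight a) (P K L) ≋ con 0#
  D-weight a {K} {L} FK FL K⊂L x = go (degree K L) FK FL K⊂L ℕ.≤-refl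
    where
    w = weight a
    go : ∀ m {K L} → Flat K → Flat L → K ⊂ L → degree K L ℕ.≤ m → eval (D w (P K L)) x ≈ 0#
    by-degree : ∀ m {K L} → Flat K → Flat L → K ⊂ L → degree K L ℕ.≤ suc m → ∀ d → degree K L ≡ d →
                eval (D w (P K L)) x ≈ 0#
    go zero    {K} {L} FK FL K⊂L d≤0 = D-cong w {P K L} {con 1#} (P≋1 (ℕ.n≤0⇒n≡0 d≤0)) x
    go (suc m) {K} {L} FK FL K⊂L d≤  = by-degree m FK FL K⊂L d≤ (degree K L) ≡.refl
    by-degree m {K} {L} FK FL K⊂L d≤ zero d≡ = D-cong w {P K L} {con 1#} (P≋1 d≡) x
    by-degree m {K} {L} FK@(PK , _) FL@(PL , _) K⊂L d≤ (suc zero) d≡ = begin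
      eval (D w (P K L)) x         ≈⟨ D-P-degree-one PK PL K⊂L d≡ w x ⟩
      ∑ᵢ K L (coef K L w)
        ≈⟨ ∑ₛ-cong {n} (λ F → when-⇔ (inner? K L F) (atom? K L F) (inner⇒atom PK PL d≡) (atom⇒inner d≡)) ⟩
      ∑ₐ K L (coef K L w)
        ≈⟨ ∑ₐ-cong K L (λ F _ → solve 6 (λ wF wL wK s k i →
             wF :- (s :- k) :* i :* wL :- (num (+ 1) :- (s :- k) :* i) :* wK :=
             (wF :- wK) :+ (:- (i :* (wL :- wK))) :* (s :- k)) refl (w F) (w L) (w K) (size F) (size K) i) ⟩
      ∑ₐ K L (λ F → (w F - w K) + - (i * (w L - w K)) * (size F - size K))
        ≈⟨ trans (∑ₐ-+ K L _ _) (+-congˡ (∑ₐ-* K L _ _)) ⟩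
      ∑ₐ K L (λ F → w F - w K) + - (i * (w L - w K)) * ∑ₐ K L (λ F → size F - size K)
        ≈⟨ +-cong (partition FK FL K⊆L a) (*-congˡ (partition FK FL K⊆L _)) ⟩
      (w L - w K) + - (i * (w L - w K)) * (size L - size K)
        ≈⟨ solve 4 (λ d i l k → d :+ (:- (i :* d)) :* (l :- k) := d :- d :* ((l :- k) :* i)) refl (w L - w K) i (size L) (size K) ⟩
      (w L - w K) - (w L - w K) * ratio K L L
        ≈⟨ +-congˡ (-‿cong (trans (*-congˡ (ratio-L K⊂L)) (*-identityʳ _))) ⟩
      (w L - w K) - (w L - w K)    ≈⟨ -‿inverseʳ _ ⟩
      0#                           ∎
      where
      open ≈-Reasoning
      i = fromℕ ∣ L ─ K ∣ ⁻¹
      K⊆L : K ⊆ L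
      K⊆L = p⊂q⇒p⊆q K⊂L
    by-degree m {K} {L} FK@(PK , _) FL@(PL , _) K⊂L d≤ (suc (suc d)) d≡ = *-zero-cancel (fromℕ≉0 d) (begin
      fromℕ (suc d) * DP
        ≈⟨ solve 2 (λ d z → d :* z := (num (+ 1) :+ d) :* z :- z) refl (fromℕ (suc d)) DP ⟩
      fromℕ (suc (suc d)) * DP - DP       ≡⟨ ≡.cong (λ d → fromℕ d * DP - DP) d≡ ⟨
      fromℕ (degree K L) * DP - DP        ≈⟨ +-congʳ (D-P-recursion PK PL K⊂L w x) ⟩
      ∑ᵢ K L (λ F → coef K L w F * (q K F * q F L)) +
        ∑ᵢ K L (λ F → coef K L x F * (eval (D w (P K F)) x * q F L + q K F * eval (D w (P F L)) x)) - DP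
        ≈⟨ +-congʳ (+-cong (sym (D-P PK PL K⊂L w x)) (∑ᵢ-zero K L λ F inner → trans (*-congˡ (+-cong
             (trans (*-congʳ (below inner)) (zeroˡ _)) (trans (*-congˡ (above inner)) (zeroʳ _))))
             (trans (*-congˡ (+-identityˡ 0#)) (zeroʳ _)))) ⟩
      DP + 0# - DP                        ≈⟨ solve 1 (λ z → z :+ num (+ 0) :- z := num (+ 0)) refl DP ⟩
      0#                                  ∎)
      where
      open ≈-Reasoning
      q : Subset n → Subset n → Carrier
      q A B = eval (P A B) x
      DP = eval (D w (P K L)) x
      below : ∀ {F} → Inner K L F → eval (D w (P K F)) x ≈ 0#
      below inner@(PF , K⊂F , F⊂L) = go m FK (inner-flat FK FL inner) K⊂F
        (ℕ.s≤s⁻¹ (ℕ.≤-trans (degree-<ʳ PK PF PL K⊂F F⊂L) d≤))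
      above : ∀ {F} → Inner K L F → eval (D w (P F L)) x ≈ 0#
      above inner@(PF , K⊂F , F⊂L) = go m (inner-flat FK FL inner) FL F⊂L
        (ℕ.s≤s⁻¹ (ℕ.≤-trans (degree-<ˡ PK PF PL K⊂F F⊂L) d≤))

  -- Every flat lies above an atom, so it is enough to join two atoms `A` and `B`. An atom over `A`
  -- that contains a point of `B` outside `K` contains all of `B`, and lies above both.
  inner-connected : ∀ {K L} → Flat K → Flat L → 2 ℕ.≤ degree K L → ∀ (ξ : Subset n → Carrier) →
                    (∀ F G → Inner K L F → Inner K L G → F ⊂ G → ξ F ≈ ξ G) →
                    ∀ F G → Inner K L F → Inner K L G → ξ F ≈ ξ G
  inner-connected {K} {L} FK@(PK , _) FL@(PL , _) 2≤d ξ along F G inner-F inner-G =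
    to-atoms (below inner-F) (below inner-G)
    where
    along-⊆ : ∀ {F G} → Inner K L F → Inner K L G → F ⊆ G → ξ F ≈ ξ G
    along-⊆ {F} {G} inner-F inner-G F⊆G with F ⊂? G
    ... | yes F⊂G = along F G inner-F inner-G F⊂G
    ... | no  F⊄G = reflexive (≡.cong ξ (≡.sym (⊆⇒≡ F⊆G F⊄G)))
    below : ∀ {F} → Inner K L F → ∃ λ A → Atom K L A × Inner K L A × A ⊆ F
    below inner@(PF , (K⊆F , x , x∈F , x∉K) , F⊂L) with atom-exists FK (inner-flat FK FL inner) K⊆F x∈F x∉K
    ... | A , (PA , K⊂A , A⊆F , d≡0) , _ =
      A , (PA , K⊂A , ⊆-trans A⊆F (p⊂q⇒p⊆q F⊂L) , d≡0) , (PA , K⊂A , ⊆-⊂-trans A⊆F F⊂L) , A⊆F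
    atoms : ∀ {A B} → Atom K L A → Inner K L A → Atom K L B → Inner K L B → ξ A ≈ ξ B
    atoms {A} {B} atom-A@(PA , K⊂A , A⊆L , dA≡0) inner-A atom-B@(PB , (K⊆B , j , j∈B , j∉K) , B⊆L , _) inner-B
      with j ∈? A
    ... | yes j∈A = reflexive (≡.cong ξ (atom-unique FK FL atom-A atom-B j∉K j∈A j∈B))
    ... | no  j∉A with atom-exists (atom-flat FK FL atom-A) FL A⊆L (B⊆L j∈B) j∉A
    ...   | C , atom-C@(PC , A⊂C , C⊆L , dC≡0) , j∈C = trans (along-⊆ inner-A inner-C (p⊂q⇒p⊆q A⊂C)) (sym (along-⊆ inner-B inner-C
              (cover-⊆ (atom-covers FK FL atom-B) (atom-flat (atom-flat FK FL atom-A) FL atom-C)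
                (⊆-trans (p⊂q⇒p⊆q K⊂A) (p⊂q⇒p⊆q A⊂C)) j∈B j∈C j∉K)))
      where
      inner-C : Inner K L C
      inner-C with C ⊂? L
      ... | yes C⊂L = PC , ⊂-trans K⊂A A⊂C , C⊂L
      -- If the join of the two atoms were `L`, the degree would be one.
      ... | no  C⊄L with ≡.refl ← ⊆⇒≡ C⊆L C⊄L = ⊥-elim (ℕ.<⇒≢ 2≤d (≡.sym
              (≡.trans (degree-sum PK PL inner-A) (≡.cong₂ (λ a b → suc (a ℕ.+ b)) dA≡0 dC≡0))))
    to-atoms : (∃ λ A → Atom K L A × Inner K L A × A ⊆ F) → (∃ λ B → Atom K L B × Inner K L B × B ⊆ G) → ξ F ≈ ξ G
    to-atoms (A , atom-A , inner-A , A⊆F) (B , atom-B , inner-B , B⊆G) =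
      trans (sym (along-⊆ inner-A inner-F A⊆F)) (trans (atoms atom-A inner-A atom-B inner-B) (along-⊆ inner-B inner-G B⊆G))

  D-P-cong : ∀ {K L} → 𝒫 K → 𝒫 L → K ⊂ L → ∀ {u v} → (∀ F → Inner K L F → coef K L u F ≈ coef K L v F) →
             D u (P K L) ≋ D v (P K L)
  D-P-cong {K} {L} PK PL K⊂L {u} {v} e x = trans (D-P PK PL K⊂L u x)
    (trans (∑ᵢ-cong K L λ F inner → *-congʳ (e F inner)) (sym (D-P PK PL K⊂L v x)))

  D-D-P : ∀ {K L} → 𝒫 K → 𝒫 L → K ⊂ L → ∀ u v x → eval (D u (D v (P K L))) x ≈
          ∑ᵢ K L (λ F → coef K L v F * (eval (D u (P K F)) x * eval (P F L) x + eval (P K F) x * eval (D u (P F L)) x))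
  D-D-P {K} {L} PK PL K⊂L u v x = trans
    (D-cong u {D v (P K L)} {innerPoly K L coefficient} (λ z → trans (D-P PK PL K⊂L v z) (sym (eval-innerPoly K L coefficient z))) x)
    (trans (D-innerPoly K L coefficient u x) (∑ᵢ-cong K L λ F _ → trans (+-congʳ (zeroˡ _)) (+-identityˡ _)))
    where
    coefficient : Subset n → Poly (Subset n)
    coefficient F = con (coef K L v F)

  -- On the hyperplane where the atoms' coordinates sum to zero, a modular function
  -- removes these coordinates; what remains is minus a sum of squares over the lines.
  rank-three : ∀ {K L} → Flat K → Flat L → K ⊂ L → degree K L ≡ 2 →
               AtMostOnePositive (λ x y → constant (D x (D y (P K L))))
  rank-three {K} {L} FK@(PK , _) FL@(PL , _) K⊂L d≡2 = (λ x → ∑ₐ K L (coef K L x)) , atoms-linear , nonpositive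
    where
    atoms-linear : IsLinear (λ x → ∑ₐ K L (coef K L x))
    atoms-linear = record
      { cong   = λ e → ∑ₐ-cong K L λ F _ → IsLinear.cong (coef-linear K⊂L F) e
      ; linear = λ s x r y → trans (∑ₐ-cong K L λ F _ → IsLinear.linear (coef-linear K⊂L F) s x r y)
          (trans (∑ₐ-+ K L _ _) (+-cong (∑ₐ-* K L s (coef K L x)) (∑ₐ-* K L r (coef K L y)))) }

    weight-zero : ∀ {m} (a : Fin m → Carrier) S → (∀ i → i ∈ S → a i ≈ 0#) → weight a S ≈ 0#
    weight-zero a []            z = refl
    weight-zero a (outside ∷ S) z = weight-zero (a ∘ suc) S λ i i∈S → z (suc i) (there i∈S)
    weight-zero a (inside ∷ S)  z = trans (+-cong (z zero here) (weight-zero (a ∘ suc) S λ i i∈S → z (suc i) (there i∈S)))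
      (+-identityˡ 0#)

    module _ (x : Subset n → Carrier) (sum≈0 : ∑ₐ K L (coef K L x) ≈ 0#) where

      -- The density obtained by spreading the coordinate of an atom evenly over its elements
      -- outside `K`. Since atoms are disjoint there, the densities define one weight `a`, whose
      -- modular function agrees with the projected `x` on all atoms.
      κ : Subset n → Carrier
      κ F = coef K L x F * (size F - size K) ⁻¹
      a : Fin n → Carrier
      a i = ∑ₐ K L (λ F → when (i ∈∖? F , K) (κ F))
      weight-K : weight a K ≈ 0#
      weight-K = weight-zero a K λ i i∈K → ∑ₛ-zero {n} λ F → when-zero (atom? K L F) λ _ →
        when-no (i ∈∖? F , K) λ { (_ , i∉K) → i∉K i∈K }
      weight-atom : ∀ F → Atom K L F → weight a F - weight a K ≈ coef K L x F
      weight-atom F atom-F@(_ , K⊂F , _) = begin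
        weight a F - weight a K                            ≈⟨ weight-difference a (p⊂q⇒p⊆q K⊂F) ⟩
        sum (λ i → when (i ∈∖? F , K) (a i))
          ≈⟨ sum-cong-≋ {n} (λ i → when-cong (i ∈∖? F , K) λ { (i∈F , i∉K) →
               trans (∑ₐ-at FK FL atom-F i∈F i∉K κ) (sym (*-identityʳ _)) }) ⟩
        sum (λ i → when (i ∈∖? F , K) (κ F * 1#))          ≈⟨ weight-difference (λ _ → κ F * 1#) (p⊂q⇒p⊆q K⊂F) ⟨
        weight (λ _ → κ F * 1#) F - weight (λ _ → κ F * 1#) K
          ≈⟨ +-cong (weight-* (κ F) (λ _ → 1#) F) (-‿cong (weight-* (κ F) (λ _ → 1#) K)) ⟩
        κ F * size F - κ F * size K
          ≈⟨ solve 4 (λ c i s k → c :* i :* s :- c :* i :* k := c :* (i :* (s :- k))) refl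
               (coef K L x F) ((size F - size K) ⁻¹) (size F) (size K) ⟩
        coef K L x F * ((size F - size K) ⁻¹ * (size F - size K))
          ≈⟨ trans (*-congˡ (*-inverseˡ (>⇒≉ (size-< K⊂F)))) (*-identityʳ _) ⟩
        coef K L x F                                       ∎
        where open ≈-Reasoning
      weight-F : ∀ F → Atom K L F → weight a F ≈ coef K L x F
      weight-F F atom-F = trans (trans (solve 1 (λ w → w := w :- num (+ 0)) refl (weight a F)) (+-congˡ (-‿cong (sym weight-K))))
        (weight-atom F atom-F)
      weight-L : weight a L ≈ 0#
      weight-L = trans (-≈0⇒≈ (trans (sym (partition FK FL (p⊂q⇒p⊆q K⊂L) a)) (trans (∑ₐ-cong K L weight-atom) sum≈0))) weight-K

      y : Subset n → Carrier
      y = lin 1# (coef K L x) (- 1#) (weight a)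
      difference : ∀ {S v} → coef K L x S ≈ v → weight a S ≈ v → y S ≈ 0#
      difference {S} {v} p q = trans (+-cong (*-congˡ p) (*-congˡ q)) (solve 1 (λ v → num (+ 1) :* v :+ (:- num (+ 1)) :* v := num (+ 0)) refl v)
      y-K : y K ≈ 0#
      y-K = difference (coef-K K⊂L x) weight-K
      y-L : y L ≈ 0#
      y-L = difference (coef-L K⊂L x) weight-L
      y-atom : ∀ F → Atom K L F → y F ≈ 0#
      y-atom F atom-F = difference refl (weight-F F atom-F)

      Dx≋Dy : D x (P K L) ≋ D y (P K L)
      Dx≋Dy z = sym (begin
        eval (D y (P K L)) z
          ≈⟨ IsLinear.linear (D-linear (P K L) z) 1# (coef K L x) (- 1#) (weight a) ⟩
        1# * eval (D (coef K L x) (P K L)) z + - 1# * eval (D (weight a) (P K L)) z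
          ≈⟨ +-cong (*-congˡ (D-P-cong PK PL K⊂L (λ F _ → coef-absorb K⊂L x F) z)) (*-congˡ (D-weight a FK FL K⊂L z)) ⟩
        1# * eval (D x (P K L)) z + - 1# * 0#
          ≈⟨ solve 1 (λ d → num (+ 1) :* d :+ (:- num (+ 1)) :* num (+ 0) := d) refl (eval (D x (P K L)) z) ⟩
        eval (D x (P K L)) z ∎)
        where open ≈-Reasoning

      z₀ : Subset n → Carrier
      z₀ _ = 0#
      R : Subset n → Carrier
      R F = ∑ᵢ K F (ratio K F)
      0≤R : ∀ F → 0# ≤ R F
      0≤R F = 0≤∑ₛ {n} λ G → 0≤when (inner? K F G) λ { (_ , K⊂G , G⊂F) → 0≤ratio (⊂-trans K⊂G G⊂F) (p⊂q⇒p⊆q K⊂G) }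
      -- In degree two `F` is an atom or a line. At an atom `y` is zero. At a line `y` vanishes on
      -- all atoms below it, so each of them contributes only the interpolation `- y F` times its
      -- ratio to the derivative of the polynomial of `[K , F]`.
      term : ∀ F → Inner K L F →
             coef K L y F * (eval (D y (P K F)) z₀ * eval (P F L) z₀ + eval (P K F) z₀ * eval (D y (P F L)) z₀) ≈
             - 1# * (y F * y F * R F)
      term F inner@(PF , K⊂F , F⊂L) = by (degree K F) (degree F L) ≡.refl ≡.refl
             (ℕ.suc-injective (≡.trans (≡.sym d≡2) (degree-sum PK PL inner)))
        where
        open ≈-Reasoning
        rest = eval (D y (P K F)) z₀ * eval (P F L) z₀ + eval (P K F) z₀ * eval (D y (P F L)) z₀
        by : ∀ i j → degree K F ≡ i → degree F L ≡ j → 1 ≡ i ℕ.+ j → coef K L y F * rest ≈ - 1# * (y F * y F * R F)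
        by zero j d≡0 _ _ = begin
          coef K L y F * rest       ≈⟨ *-congʳ (trans (coef-ends K⊂L F y-L y-K) yF≈0) ⟩
          0# * rest                 ≈⟨ solve 2 (λ s r → num (+ 0) :* s := (:- num (+ 1)) :* (num (+ 0) :* num (+ 0) :* r)) refl rest (R F) ⟩
          - 1# * (0# * 0# * R F)    ≈⟨ *-congˡ (*-congʳ (*-cong yF≈0 yF≈0)) ⟨
          - 1# * (y F * y F * R F)  ∎
          where
          yF≈0 : y F ≈ 0#
          yF≈0 = y-atom F (PF , K⊂F , p⊂q⇒p⊆q F⊂L , d≡0)
        by (suc zero) zero d≡1 e≡0 _ = begin
          coef K L y F * rest
            ≈⟨ *-cong (coef-ends K⊂L F y-L y-K) (+-cong (*-cong D-below (P≋1 e≡0 z₀))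
                 (*-congˡ (D-cong y {P F L} {con 1#} (P≋1 e≡0) z₀))) ⟩
          y F * (- y F * R F * 1# + eval (P K F) z₀ * 0#)
            ≈⟨ solve 3 (λ y r p → y :* ((:- y) :* r :* num (+ 1) :+ p :* num (+ 0)) := (:- num (+ 1)) :* (y :* y :* r))
                 refl (y F) (R F) (eval (P K F) z₀) ⟩
          - 1# * (y F * y F * R F)  ∎
          where
          D-below : eval (D y (P K F)) z₀ ≈ - y F * R F
          D-below = begin
            eval (D y (P K F)) z₀      ≈⟨ D-P-degree-one PK PF K⊂F d≡1 y z₀ ⟩
            ∑ᵢ K F (coef K F y)
              ≈⟨ ∑ᵢ-cong K F (λ G inner-G → trans (+-cong (+-congʳ (y-atom G (above (inner⇒atom PK PF d≡1 inner-G)))) (-‿cong (*-congˡ y-K)))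
                   (solve 2 (λ y r → num (+ 0) :- r :* y :- (num (+ 1) :- r) :* num (+ 0) := (:- y) :* r) refl (y F) (ratio K F G))) ⟩
            ∑ᵢ K F (λ G → - y F * ratio K F G) ≈⟨ ∑ᵢ-* K F (- y F) (ratio K F) ⟩
            - y F * R F                ∎
            where
            above : ∀ {G} → Atom K F G → Atom K L G
            above (PG , K⊂G , G⊆F , d≡0) = PG , K⊂G , ⊆-trans G⊆F (p⊂q⇒p⊆q F⊂L) , d≡0
        by (suc zero) (suc j) _ _ ()
        by (suc (suc i)) j _ _ ()

      nonpositive : constant (D x (D x (P K L))) ≤ 0#
      nonpositive = ≤-trans (≤-reflexive (begin
        constant (D x (D x (P K L)))   ≈⟨ D-cong x {D x (P K L)} {D y (P K L)} Dx≋Dy z₀ ⟩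
        constant (D x (D y (P K L)))   ≈⟨ D-comm x y (P K L) z₀ ⟩
        constant (D y (D x (P K L)))   ≈⟨ D-cong y {D x (P K L)} {D y (P K L)} Dx≋Dy z₀ ⟩
        constant (D y (D y (P K L)))   ≈⟨ D-D-P PK PL K⊂L y y z₀ ⟩
        _                              ≈⟨ ∑ᵢ-cong K L term ⟩
        ∑ᵢ K L (λ F → - 1# * (y F * y F * R F)) ≈⟨ ∑ᵢ-* K L (- 1#) (λ F → y F * y F * R F) ⟩
        - 1# * ∑ᵢ K L (λ F → y F * y F * R F)   ≈⟨ solve 1 (λ s → (:- num (+ 1)) :* s := :- s) refl _ ⟩
        - ∑ᵢ K L (λ F → y F * y F * R F)        ∎))
        (-≤0 (0≤∑ₛ {n} λ F → 0≤when (inner? K L F) λ _ → 0≤* (0≤² (y F)) (0≤R F)))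
        where open ≈-Reasoning

-- Enumerating decidable families of subsets.

module Enumerations {c ℓ₁ ℓ₂} (ℝ : RealNumbers c ℓ₁ ℓ₂) where

  open OrderedField ℝ
  open LinearAlgebra ℝ
  open SubsetSums ℝ

  -- The linear algebra is carried out on `Fin N`, the coordinates are labelled by sets; `sum-enum`
  -- identifies the two kinds of sums.
  record Enumeration {n p} {Q : Pred (Subset n) p} (Q? : Decidable Q) : Set (c ⊔ ℓ₁ ⊔ p) where
    field
      {N}        : ℕ
      enum       : Fin N → Subset n
      enum-Q     : ∀ k → Q (enum k)
      injective  : ∀ {j k} → enum j ≡ enum k → j ≡ k
      index      : ∀ {S} → Q S → Fin N
      enum-index : ∀ {S} (q : Q S) → enum (index q) ≡ S
      sum-enum   : ∀ (f : Subset n → Carrier) → ∑ₛ (λ S → when (Q? S) (f S)) ≈ sum (f ∘ enum)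

  private
    sum-splitAt : ∀ a {b} {A : Set} (f : A → Carrier) (g : Fin a → A) (h : Fin b → A) →
                  sum (λ i → f ([ g , h ]′ (splitAt a i))) ≈ sum (f ∘ g) + sum (f ∘ h)
    sum-splitAt zero    f g h = sym (+-identityˡ _)
    sum-splitAt (suc a) {b} f g h = trans (+-congˡ (trans (sum-cong-≋ {a ℕ.+ b} λ i → step i) (sum-splitAt a f (g ∘ suc) h))) (sym (+-assoc _ _ _))
      where
      step : ∀ i → f ([ g , h ]′ (splitAt (suc a) (suc i))) ≈ f ([ g ∘ suc , h ]′ (splitAt a i))
      step i with splitAt a i
      ... | inj₁ _ = refl
      ... | inj₂ _ = refl

  enumerate : ∀ {n p} {Q : Pred (Subset n) p} (Q? : Decidable Q) → Enumeration Q?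
  enumerate {zero} Q? with Q? [] in eq
  ... | yes q = record
    { N = 1 ; enum = λ _ → [] ; enum-Q = λ _ → q ; injective = λ { {zero} {zero} _ → ≡.refl } ; index = λ _ → zero
    ; enum-index = λ { {[]} _ → ≡.refl }
    ; sum-enum = λ f → trans (reflexive (≡.cong (λ d → when d (f [])) eq)) (sym (+-identityʳ _)) }
  ... | no ¬q = record
    { N = 0 ; enum = λ () ; enum-Q = λ () ; injective = λ { {()} } ; index = λ { {[]} q → ⊥-elim (¬q q) }
    ; enum-index = λ { {[]} q → ⊥-elim (¬q q) }
    ; sum-enum = λ f → reflexive (≡.cong (λ d → when d (f [])) eq) }
  enumerate {suc n} {Q = Q} Q? = record
    { N = O.N ℕ.+ I.N ; enum = λ i → choose (splitAt O.N i) ; enum-Q = λ i → choose-Q (splitAt O.N i)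
    ; injective = λ {i} {j} → injective i j ; index = λ { {outside ∷ S} q → O.index q ↑ˡ I.N ; {inside ∷ S} q → O.N ↑ʳ I.index q }
    ; enum-index = λ { {outside ∷ S} q → ≡.trans (≡.cong choose (Fin.splitAt-↑ˡ O.N (O.index q) I.N)) (≡.cong (outside ∷_) (O.enum-index q))
                     ; {inside ∷ S} q → ≡.trans (≡.cong choose (Fin.splitAt-↑ʳ O.N I.N (I.index q))) (≡.cong (inside ∷_) (I.enum-index q)) }
    ; sum-enum = λ f → trans (+-cong (O.sum-enum (f ∘ (outside ∷_))) (I.sum-enum (f ∘ (inside ∷_))))
        (sym (sum-splitAt O.N f (λ k → outside ∷ O.enum k) (λ k → inside ∷ I.enum k))) }
    where
    module O = Enumeration (enumerate {Q = Q ∘ (outside ∷_)} (λ S → Q? (outside ∷ S)))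
    module I = Enumeration (enumerate {Q = Q ∘ (inside ∷_)} (λ S → Q? (inside ∷ S)))
    choose : Fin O.N ⊎ Fin I.N → Subset (suc n)
    choose = [ (λ k → outside ∷ O.enum k) , (λ k → inside ∷ I.enum k) ]′
    choose-Q : ∀ s → Q (choose s)
    choose-Q (inj₁ k) = O.enum-Q k
    choose-Q (inj₂ k) = I.enum-Q k
    injective : ∀ i j → choose (splitAt O.N i) ≡ choose (splitAt O.N j) → i ≡ j
    injective i j with splitAt O.N i in eqᵢ | splitAt O.N j in eqⱼ
    ... | inj₁ k | inj₁ l = λ e → ≡.trans (≡.sym (Fin.splitAt⁻¹-↑ˡ eqᵢ))
            (≡.trans (≡.cong (_↑ˡ I.N) (O.injective (∷-injectiveʳ e))) (Fin.splitAt⁻¹-↑ˡ eqⱼ))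
    ... | inj₁ k | inj₂ l = λ ()
    ... | inj₂ k | inj₁ l = λ ()
    ... | inj₂ k | inj₂ l = λ e → ≡.trans (≡.sym (Fin.splitAt⁻¹-↑ʳ eqᵢ))
            (≡.trans (≡.cong (O.N ↑ʳ_) (I.injective (∷-injectiveʳ e))) (Fin.splitAt⁻¹-↑ʳ eqⱼ))

  e-diagonal : ∀ {n} (k : Fin n) → e k k ≈ 1#
  e-diagonal zero    = refl
  e-diagonal (suc k) = e-diagonal k

  e-off-diagonal : ∀ {n} (j k : Fin n) → ¬ j ≡ k → e j k ≈ 0#
  e-off-diagonal zero    zero    j≢k = ⊥-elim (j≢k ≡.refl)
  e-off-diagonal zero    (suc k) j≢k = refl
  e-off-diagonal (suc j) zero    j≢k = refl
  e-off-diagonal (suc j) (suc k) j≢k = e-off-diagonal j k (j≢k ∘ ≡.cong suc)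

  δ : ∀ {n} → Subset n → Subset n → Carrier
  δ G S = when (≡-dec Bool._≟_ S G) 1#

  module ExtendByZero {n p} {Q : Pred (Subset n) p} {Q? : Decidable Q} (E : Enumeration Q?) where

    open Enumeration E

    hat : (Fin N → Carrier) → Subset n → Carrier
    hat y S with Q? S
    ... | yes q = y (index q)
    ... | no  _ = 0#

    hat-lin : ∀ s x r y S → hat (lin s x r y) S ≈ lin s (hat x) r (hat y) S
    hat-lin s x r y S with Q? S
    ... | yes q = refl
    ... | no  _ = sym (trans (+-cong (zeroʳ s) (zeroʳ r)) (+-identityˡ 0#))

    hat-cong : ∀ {x y} → (∀ k → x k ≈ y k) → ∀ S → hat x S ≈ hat y S
    hat-cong x≈y S with Q? S
    ... | yes q = x≈y (index q)
    ... | no  _ = refl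

    -- The predicate may have several proofs, but injectivity of `enum` makes the index depend on
    -- the set alone.
    index-enum : ∀ k (q : Q (enum k)) → index q ≡ k
    index-enum k q = injective (enum-index q)

    hat-enum : ∀ y k → hat y (enum k) ≈ y k
    hat-enum y k with Q? (enum k)
    ... | yes q = reflexive (≡.cong y (index-enum k q))
    ... | no ¬q = ⊥-elim (¬q (enum-Q k))

    hat-restrict : ∀ x → (∀ S → ¬ Q S → x S ≈ 0#) → ∀ S → hat (x ∘ enum) S ≈ x S
    hat-restrict x support S with Q? S
    ... | yes q = reflexive (≡.cong x (enum-index q))
    ... | no ¬q = sym (support S ¬q)

    hat-e : ∀ k S → hat (e k) S ≈ δ (enum k) S
    hat-e k S with Q? S | ≡-dec Bool._≟_ S (enum k)
    ... | no ¬q | yes ≡.refl = ⊥-elim (¬q (enum-Q k))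
    ... | no _  | no _       = refl
    ... | yes q | yes ≡.refl = trans (reflexive (≡.cong (e k) (index-enum k q))) (e-diagonal k)
    ... | yes q | no S≢      = e-off-diagonal k (index q) λ { ≡.refl → S≢ (≡.sym (enum-index q)) }

    hat-linear : ∀ {f} → IsLinear f → IsLinear (f ∘ hat)
    hat-linear f-linear = record
      { cong   = λ x≈y → IsLinear.cong f-linear (hat-cong x≈y)
      ; linear = λ s x r y → trans (IsLinear.cong f-linear (hat-lin s x r y)) (IsLinear.linear f-linear s _ r _) }

    hat-form : ∀ {B} → IsForm B → IsForm (λ x y → B (hat x) (hat y))
    hat-form form = record
      { symmetric = λ x y → IsForm.symmetric form _ _
      ; linearˡ   = λ y → hat-linear (IsForm.linearˡ form (hat y)) }

-- Flags of intervals and the directions acting on them.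

module Flags {c ℓ₁ ℓ₂ p} (ℝ : RealNumbers c ℓ₁ ℓ₂) {n} {𝒫 : Pred (Subset n) p}
             (𝒫? : Decidable 𝒫) (graded : IntervalsGraded 𝒫) {K₀ L₀ : Subset n}
             (flats : IsLatticeOfFlats L₀ (Interval 𝒫 K₀ L₀)) where

  open OrderedField ℝ
  open LinearAlgebra ℝ
  open Lorentz ℝ
  open Polynomials ℝ
  open SubsetSums ℝ
  open Enumerations ℝ
  open IntervalsGraded graded
  open Derivatives ℝ 𝒫? graded
  open DerivativeFormula ℝ 𝒫? graded
  open Flats ℝ 𝒫? graded flats
  open Signature ℝ using (connected-bochner)

  record FlatInterval : Set p where
    field
      lo hi   : Subset n
      lo-flat : Flat lo
      hi-flat : Flat hi
      lo⊂hi   : lo ⊂ hi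

  open FlatInterval

  In : FlatInterval → Subset n → Set p
  In I = Inner (lo I) (hi I)

  in? : ∀ I G → Dec (In I G)
  in? I = inner? (lo I) (hi I)

  left right : ∀ I {G} → In I G → FlatInterval
  left I inner@(_ , lo⊂G , _) = record
    { lo-flat = lo-flat I ; hi-flat = inner-flat (lo-flat I) (hi-flat I) inner ; lo⊂hi = lo⊂G }
  right I inner@(_ , _ , G⊂hi) = record
    { lo-flat = inner-flat (lo-flat I) (hi-flat I) inner ; hi-flat = hi-flat I ; lo⊂hi = G⊂hi }

  Pᵢ : FlatInterval → Poly (Subset n)
  Pᵢ I = P (lo I) (hi I)

  degᵢ : FlatInterval → ℕ
  degᵢ I = degree (lo I) (hi I)

  Flag : Set p
  Flag = List FlatInterval

  g : Flag → Poly (Subset n)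
  g []      = con 1#
  g (I ∷ J) = Pᵢ I ⊗ g J

  deg : Flag → ℕ
  deg []      = 0
  deg (I ∷ J) = degᵢ I ℕ.+ deg J

  InFlag : Flag → Subset n → Set p
  InFlag J G = Any (λ I → In I G) J

  inFlag? : ∀ J → Decidable (InFlag J)
  inFlag? J G = any? (λ I → in? I G) J

  child : ∀ J {G} → InFlag J G → Flag
  child (I ∷ J) (here inner) = left I inner ∷ right I inner ∷ J
  child (I ∷ J) (there p)    = I ∷ child J p

  deg-child : ∀ J {G} (p : InFlag J G) → deg J ≡ suc (deg (child J p))
  deg-child (I ∷ J) (here inner) = ≡.trans (≡.cong (ℕ._+ deg J) (degree-sum (proj₁ (lo-flat I)) (proj₁ (hi-flat I)) inner))
    (≡.cong suc (ℕ.+-assoc (degᵢ (left I inner)) (degᵢ (right I inner)) (deg J)))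
  deg-child (I ∷ J) (there p) = ≡.trans (≡.cong (degᵢ I ℕ.+_) (deg-child J p)) (ℕ.+-suc (degᵢ I) _)

  -- The inclusions are not strict because the two halves of a split interval share an end.
  Apart : FlatInterval → FlatInterval → Set
  Apart I J = hi I ⊆ lo J ⊎ hi J ⊆ lo I

  Separated : Flag → Set p
  Separated = AllPairs Apart

  NotEnd : Subset n → FlatInterval → Set
  NotEnd G I = ¬ G ≡ lo I × ¬ G ≡ hi I

  -- Lying outside the interior is not enough for a coordinate derivative to kill `Pᵢ I`: the
  -- projection also reads the values at the two ends.
  Away : Subset n → FlatInterval → Set p
  Away G I = ¬ In I G × NotEnd G I

  in⇒not-end : ∀ I {G} → In I G → NotEnd G I
  in⇒not-end I (_ , lo⊂G , G⊂hi) = (λ eq → ⊂-irref (≡.sym eq) lo⊂G) , (λ eq → ⊂-irref eq G⊂hi)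

  apart⇒away : ∀ {I J G} → Apart I J → In I G → Away G J
  apart⇒away {I} {J} {G} (inj₁ hi⊆lo) (_ , _ , G⊂hi) = (λ { (_ , lo⊂G , _) → ⊂-irref ≡.refl (⊂-trans G⊂lo lo⊂G) }) ,
      (λ { ≡.refl → ⊂-irref ≡.refl G⊂lo }) , (λ { ≡.refl → ⊂-irref ≡.refl (⊂-trans G⊂lo (lo⊂hi J)) })
    where
    G⊂lo : G ⊂ lo J
    G⊂lo = ⊂-⊆-trans G⊂hi hi⊆lo
  apart⇒away {I} {J} {G} (inj₂ hi⊆lo) (_ , lo⊂G , _) = (λ { (_ , _ , G⊂hi) → ⊂-irref ≡.refl (⊂-trans hi⊂G G⊂hi) }) ,
      (λ { ≡.refl → ⊂-irref ≡.refl (⊂-trans (lo⊂hi J) hi⊂G) }) , (λ { ≡.refl → ⊂-irref ≡.refl hi⊂G })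
    where
    hi⊂G : hi J ⊂ G
    hi⊂G = ⊆-⊂-trans hi⊆lo lo⊂G

  apart-sym : ∀ {I J} → Apart I J → Apart J I
  apart-sym = swap

  apart-all⇒away : ∀ I {J G} → All.All (Apart I) J → InFlag J G → Away G I
  apart-all⇒away I {J ∷ _} (apart ∷ _) (here inner) = apart⇒away {J} {I} (apart-sym {I} {J} apart) inner
  apart-all⇒away I (_ ∷ aparts) (there p)   = apart-all⇒away I aparts p

  apart-left : ∀ {I J G} (inner : In J G) → Apart I J → Apart I (left J inner)
  apart-left (_ , lo⊂G , _) (inj₁ q) = inj₁ q
  apart-left (_ , _ , G⊂hi) (inj₂ q) = inj₂ (⊆-trans (p⊂q⇒p⊆q G⊂hi) q)

  apart-right : ∀ {I J G} (inner : In J G) → Apart I J → Apart I (right J inner)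
  apart-right (_ , lo⊂G , _) (inj₁ q) = inj₁ (⊆-trans q (p⊂q⇒p⊆q lo⊂G))
  apart-right (_ , _ , G⊂hi) (inj₂ q) = inj₂ q

  apart-child : ∀ I J {G} (p : InFlag J G) → All.All (Apart I) J → All.All (Apart I) (child J p)
  apart-child I (I′ ∷ J) (here inner) (apart ∷ aparts) =
    apart-left {I} {I′} inner apart ∷ apart-right {I} {I′} inner apart ∷ aparts
  apart-child I (I′ ∷ J) (there p) (apart ∷ aparts) = apart ∷ apart-child I J p aparts

  -- Membership carries proofs of `𝒫`, so `child` depends on the proof given; its members do not.
  -- Separation rules out that one set lies inside two intervals of the flag.
  child-irrelevant : ∀ J {G H} → Separated J → (p q : InFlag J G) → InFlag (child J p) H → InFlag (child J q) H
  child-irrelevant (I ∷ J) _              (here _)     (here _)     (here r)          = here r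
  child-irrelevant (I ∷ J) _              (here _)     (here _)     (there (here r))  = there (here r)
  child-irrelevant (I ∷ J) _              (here _)     (here _)     (there (there r)) = there (there r)
  child-irrelevant (I ∷ J) (aparts ∷ _)   (here inner) (there q)    _ = ⊥-elim (proj₁ (apart-all⇒away I aparts q) inner)
  child-irrelevant (I ∷ J) (aparts ∷ _)   (there p)    (here inner) _ = ⊥-elim (proj₁ (apart-all⇒away I aparts p) inner)
  child-irrelevant (I ∷ J) _              (there p)    (there q)    (here r)          = here r
  child-irrelevant (I ∷ J) (_ ∷ sep)      (there p)    (there q)    (there r)         = there (child-irrelevant J sep p q r)

  separated-child : ∀ J {G} (p : InFlag J G) → Separated J → Separated (child J p)
  separated-child (I ∷ J) (here inner) (aparts ∷ sep) =
    (inj₁ ⊆-refl ∷ All.map (λ {I′} a → apart-sym {I′} {left I inner} (apart-left {I′} {I} inner (apart-sym {I} {I′} a))) aparts) ∷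
    All.map (λ {I′} a → apart-sym {I′} {right I inner} (apart-right {I′} {I} inner (apart-sym {I} {I′} a))) aparts ∷ sep
  separated-child (I ∷ J) (there p) (aparts ∷ sep) = apart-child I J p aparts ∷ separated-child J p sep

  inFlag⇒not-end : ∀ {J G} → Separated J → InFlag J G → All.All (NotEnd G) J
  inFlag⇒not-end {I ∷ J} (aparts ∷ sep) (here inner) =
    in⇒not-end I inner ∷ All.map (λ {I′} a → proj₂ (apart⇒away {I} {I′} a inner)) aparts
  inFlag⇒not-end {I ∷ J} (aparts ∷ sep) (there p) = proj₂ (apart-all⇒away I aparts p) ∷ inFlag⇒not-end sep p

  not-end-child : ∀ J {G H} (p : InFlag J G) → ¬ H ≡ G → All.All (NotEnd H) J → All.All (NotEnd H) (child J p)
  not-end-child (I ∷ J) (here inner) H≢G ((≢lo , ≢hi) ∷ rest) =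
    (≢lo , H≢G) ∷ (H≢G , ≢hi) ∷ rest
  not-end-child (I ∷ J) (there p) H≢G (ne ∷ rest) = ne ∷ not-end-child J p H≢G rest

  away-all : ∀ J {G} → ¬ InFlag J G → All.All (NotEnd G) J → All.All (Away G) J
  away-all []      _   []          = []
  away-all (I ∷ J) G∉J (ne ∷ rest) = (G∉J ∘ here , ne) ∷ away-all J (G∉J ∘ there) rest

  δ-off : ∀ (G S : Subset n) → ¬ S ≡ G → δ G S ≈ 0#
  δ-off G S S≢G = when-no (≡-dec Bool._≟_ S G) S≢G

  coef-δ : ∀ I {G} F → NotEnd G I → coef (lo I) (hi I) (δ G) F ≈ δ G F
  coef-δ I {G} F (≢lo , ≢hi) = coef-ends (lo⊂hi I) {δ G} F (δ-off G (hi I) (≢hi ∘ ≡.sym)) (δ-off G (lo I) (≢lo ∘ ≡.sym))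

  D-δ-in : ∀ I {G} (inner : In I G) → D (δ G) (Pᵢ I) ≋ Pᵢ (left I inner) ⊗ Pᵢ (right I inner)
  D-δ-in I {G} inner x = trans (D-P (proj₁ (lo-flat I)) (proj₁ (hi-flat I)) (lo⊂hi I) (δ G) x)
    (trans (∑ₛ-single G λ F F≢G → when-zero (in? I F) λ _ →
        trans (*-congʳ (trans (coef-δ I F (in⇒not-end I inner)) (δ-off G F F≢G))) (zeroˡ _))
      (trans (when-yes (in? I G) inner) (trans (*-congʳ (trans (coef-δ I G (in⇒not-end I inner))
        (when-yes (≡-dec Bool._≟_ G G) ≡.refl))) (*-identityˡ _))))

  D-δ-away : ∀ I {G} → Away G I → D (δ G) (Pᵢ I) ≋ con 0#
  D-δ-away I {G} (¬inner , not-end) x = trans (D-P (proj₁ (lo-flat I)) (proj₁ (hi-flat I)) (lo⊂hi I) (δ G) x)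
    (∑ᵢ-zero (lo I) (hi I) λ F inner → trans (*-congʳ (trans (coef-δ I F not-end)
      (δ-off G F λ { ≡.refl → ¬inner inner }))) (zeroˡ _))

  D-δ-g-away : ∀ J {G} → All.All (Away G) J → D (δ G) (g J) ≋ con 0#
  D-δ-g-away []      []           x = refl
  D-δ-g-away (I ∷ J) (away ∷ all) x = trans
    (+-cong (trans (*-congʳ (D-δ-away I away x)) (zeroˡ _)) (trans (*-congˡ (D-δ-g-away J all x)) (zeroʳ _)))
    (+-identityˡ 0#)

  D-δ-g : ∀ J {G} (p : InFlag J G) → Separated J → D (δ G) (g J) ≋ g (child J p)
  D-δ-g (I ∷ J) {G} (here inner) (aparts ∷ sep) x = trans
    (+-cong (*-congʳ (D-δ-in I inner x))
      (trans (*-congˡ (D-δ-g-away J (All.map (λ {I′} a → apart⇒away {I} {I′} a inner) aparts) x)) (zeroʳ _)))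
    (trans (+-identityʳ _) (*-assoc _ _ _))
  D-δ-g (I ∷ J) {G} (there p) (aparts ∷ sep) x = trans
    (+-cong (trans (*-congʳ (D-δ-away I (apart-all⇒away I aparts p) x)) (zeroˡ _)) (*-congˡ (D-δ-g J p sep x)))
    (+-identityˡ _)

  D-g-cong : ∀ J {u v} → All.All (λ I → D u (Pᵢ I) ≋ D v (Pᵢ I)) J → D u (g J) ≋ D v (g J)
  D-g-cong []      []       x = refl
  D-g-cong (I ∷ J) (e ∷ es) x = +-cong (*-congʳ (e x)) (*-congˡ (D-g-cong J es x))

  -- Two directions with the same action on `f` may be exchanged after further derivatives too, as
  -- derivatives commute.
  D-replace : ∀ {f u v} → D u f ≋ D v f → ∀ {m} (ws : Vec (Subset n → Carrier) m) → D u (Ds ws f) ≋ D v (Ds ws f)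
  D-replace {f} {u} {v} e ws x = trans (D-Ds u ws f x)
    (trans (Ds-cong ws {D u f} {D v f} e x) (sym (D-Ds v ws f x)))

  -- Glues one function per interval into a single direction. In a separated flag at most one
  -- summand is present at a given set, and none at the ends of the intervals.
  assemble : (FlatInterval → Subset n → Carrier) → Flag → Subset n → Carrier
  assemble φ []      G = 0#
  assemble φ (I ∷ J) G = when (in? I G) (φ I G) + assemble φ J G

  assemble-zero : ∀ φ J {G} → ¬ InFlag J G → assemble φ J G ≈ 0#
  assemble-zero φ []      _   = refl
  assemble-zero φ (I ∷ J) {G} G∉J = trans (+-cong (when-no (in? I G) (G∉J ∘ here)) (assemble-zero φ J (G∉J ∘ there))) (+-identityˡ 0#)

  private
    Agrees : (FlatInterval → Subset n → Carrier) → (Subset n → Carrier) → FlatInterval → Set _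
    Agrees φ v I = v (lo I) ≈ 0# × v (hi I) ≈ 0# × (∀ F → In I F → v F ≈ φ I F)

  assemble-agrees : ∀ φ J → Separated J → All.All (Agrees φ (assemble φ J)) J
  assemble-agrees φ []      []             = []
  assemble-agrees φ (I ∷ J) (aparts ∷ sep) =
    ( trans (+-cong (when-no (in? I (lo I)) λ { (_ , lo⊂lo , _) → ⊂-irref ≡.refl lo⊂lo })
        (assemble-zero φ J λ p → proj₁ (proj₂ (apart-all⇒away I aparts p)) ≡.refl)) (+-identityˡ 0#)
    , trans (+-cong (when-no (in? I (hi I)) λ { (_ , _ , hi⊂hi) → ⊂-irref ≡.refl hi⊂hi })
        (assemble-zero φ J λ p → proj₂ (proj₂ (apart-all⇒away I aparts p)) ≡.refl)) (+-identityˡ 0#)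
    , λ F inner → trans (+-cong (when-yes (in? I F) inner) (assemble-zero φ J λ p → proj₁ (apart-all⇒away I aparts p) inner)) (+-identityʳ _))
    ∷ All.zipWith (λ {I′} → extend-agrees {I′}) (aparts , assemble-agrees φ J sep)
    where
    extend-agrees : ∀ {I′} → Apart I I′ × Agrees φ (assemble φ J) I′ → Agrees φ (assemble φ (I ∷ J)) I′
    extend-agrees {I′} (apart , at-lo , at-hi , at-inner) =
      trans (+-cong (when-no (in? I (lo I′)) λ inner → proj₁ (proj₂ (apart⇒away {I} {I′} apart inner)) ≡.refl) at-lo) (+-identityˡ 0#) ,
      trans (+-cong (when-no (in? I (hi I′)) λ inner → proj₂ (proj₂ (apart⇒away {I} {I′} apart inner)) ≡.refl) at-hi) (+-identityˡ 0#) ,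
      λ F inner′ → trans (+-cong (when-no (in? I F) λ inner → proj₁ (apart⇒away {I} {I′} apart inner) inner′) (at-inner F inner′)) (+-identityˡ _)

  -- The glued direction is zero at all ends, hence equals its own projection to each interval. A
  -- different representative of `u` may therefore be prescribed for each factor.
  assemble-D : ∀ φ J → Separated J → ∀ {u} → (∀ I v → (∀ F → In I F → coef (lo I) (hi I) v F ≈ φ I F) → D v (Pᵢ I) ≋ D u (Pᵢ I)) →
               D u (g J) ≋ D (assemble φ J) (g J)
  assemble-D φ J sep {u} e = D-g-cong J (All.map (λ {I} → λ { (at-lo , at-hi , at-inner) x →
    sym (e I (assemble φ J) (λ F inner → trans (coef-ends (lo⊂hi I) F at-hi at-lo) (at-inner F inner)) x) }) (assemble-agrees φ J sep))

  restrict : Flag → (Subset n → Carrier) → Subset n → Carrier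
  restrict J x = assemble (λ I → coef (lo I) (hi I) x) J

  D-restrict : ∀ J → Separated J → ∀ x → D x (g J) ≋ D (restrict J x) (g J)
  D-restrict J sep x = assemble-D _ J sep λ I v e → D-P-cong (proj₁ (lo-flat I)) (proj₁ (hi-flat I)) (lo⊂hi I) e

  restrict-linear : ∀ J G → IsLinear (λ x → restrict J x G)
  restrict-linear []      G = record { cong = λ _ → refl ; linear = λ s x r y → sym (trans (+-cong (zeroʳ s) (zeroʳ r)) (+-identityˡ 0#)) }
  restrict-linear (I ∷ J) G = record
    { cong   = λ e → +-cong (when-cong (in? I G) λ _ → IsLinear.cong (coef-linear (lo⊂hi I) G) e) (IsLinear.cong (restrict-linear J G) e)
    ; linear = λ s x r y → trans (+-cong
        (trans (when-cong (in? I G) λ _ → IsLinear.linear (coef-linear (lo⊂hi I) G) s x r y)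
          (trans (when-+ (in? I G) _ _) (+-cong (when-* (in? I G) s _) (when-* (in? I G) r _))))
        (IsLinear.linear (restrict-linear J G) s x r y))
        (solve 6 (λ s r a b d e → (s :* a :+ r :* b) :+ (s :* d :+ r :* e) := s :* (a :+ d) :+ r :* (b :+ e))
          refl s r _ _ (restrict J x G) (restrict J y G)) }

  module _ {v : Subset n → Carrier} (sub : StrictlySubmodular K₀ L₀ v) where

    private
      shift : ∀ I → ∃ λ a → v (hi I) - weight a (hi I) ≈ v (lo I) - weight a (lo I) ×
                            (∀ {S} → lo I ⊂ S → S ⊂ hi I → v (lo I) - weight a (lo I) < v S - weight a S)
      shift I = positive-shift (p⊂q⇒p⊆q (lo⊂hi I)) {v} λ S T lo⊆S S⊆hi lo⊆T T⊆hi → sub S T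
        (⊆-trans (proj₁ (proj₂ (lo-flat I))) lo⊆S) (⊆-trans S⊆hi (proj₂ (proj₂ (hi-flat I))))
        (⊆-trans (proj₁ (proj₂ (lo-flat I))) lo⊆T) (⊆-trans T⊆hi (proj₂ (proj₂ (hi-flat I))))

      shifted : FlatInterval → Subset n → Carrier
      shifted I = lin 1# v (- 1#) (weight (proj₁ (shift I)))

      φ : FlatInterval → Subset n → Carrier
      φ I = coef (lo I) (hi I) (shifted I)

      0<φ : ∀ I F → In I F → 0# < φ I F
      0<φ I F (_ , lo⊂F , F⊂hi) = <-respʳ (sym (begin
          φ I F
            -- The shifted function has equal values at both ends, so the interpolation to be
            -- subtracted is constant.
            ≈⟨ +-congʳ (+-congˡ (-‿cong (*-congˡ (trans (shifted≈ (hi I)) (trans (proj₁ (proj₂ (shift I))) (sym (shifted≈ (lo I)))))))) ⟩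
          shifted I F - r * shifted I (lo I) - (1# - r) * shifted I (lo I)
            ≈⟨ solve 3 (λ s r k → s :- r :* k :- (num (+ 1) :- r) :* k := s :- k) refl (shifted I F) r (shifted I (lo I)) ⟩
          shifted I F - shifted I (lo I)   ≈⟨ +-cong (shifted≈ F) (-‿cong (shifted≈ (lo I))) ⟩
          v F - weight (proj₁ (shift I)) F - (v (lo I) - weight (proj₁ (shift I)) (lo I)) ∎))
          (0<y-x (proj₂ (proj₂ (shift I)) lo⊂F F⊂hi))
        where
        open ≈-Reasoning
        r = ratio (lo I) (hi I) F
        shifted≈ : ∀ S → shifted I S ≈ v S - weight (proj₁ (shift I)) S
        shifted≈ S = solve 2 (λ a b → num (+ 1) :* a :+ (:- num (+ 1)) :* b := a :- b) refl (v S) (weight (proj₁ (shift I)) S)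

    -- The modular shift that makes `v` positive depends on the interval, so the projected shifts
    -- are glued. The result stands for `v` only through its action on the polynomial of the flag.
    positive-representative : Flag → Subset n → Carrier
    positive-representative = assemble φ

    0<positive-representative : ∀ J → Separated J → ∀ {G} → InFlag J G → 0# < positive-representative J G
    0<positive-representative (I ∷ J) (aparts ∷ sep) {G} (here inner) = <-respʳ (sym (trans (+-cong (when-yes (in? I G) inner)
      (assemble-zero φ J λ p → proj₁ (apart-all⇒away I aparts p) inner)) (+-identityʳ _))) (0<φ I G inner)
    0<positive-representative (I ∷ J) (aparts ∷ sep) {G} (there p) = <-respʳ (sym (trans (+-congʳ
      (when-no (in? I G) (proj₁ (apart-all⇒away I aparts p)))) (+-identityˡ _))) (0<positive-representative J sep p)

    D-positive-representative : ∀ J → Separated J → D v (g J) ≋ D (positive-representative J) (g J)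
    D-positive-representative J sep = assemble-D φ J sep λ I u e x → begin
      eval (D u (Pᵢ I)) x
        ≈⟨ D-P-cong (proj₁ (lo-flat I)) (proj₁ (hi-flat I)) (lo⊂hi I) e x ⟩
      eval (D (shifted I) (Pᵢ I)) x
        ≈⟨ IsLinear.linear (D-linear (Pᵢ I) x) 1# v (- 1#) (weight (proj₁ (shift I))) ⟩
      1# * eval (D v (Pᵢ I)) x + - 1# * eval (D (weight (proj₁ (shift I))) (Pᵢ I)) x
        ≈⟨ +-congˡ (*-congˡ (D-weight (proj₁ (shift I)) (lo-flat I) (hi-flat I) (lo⊂hi I) x)) ⟩
      1# * eval (D v (Pᵢ I)) x + - 1# * 0#
        ≈⟨ solve 1 (λ d → num (+ 1) :* d :+ (:- num (+ 1)) :* num (+ 0) := d) refl (eval (D v (Pᵢ I)) x) ⟩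
      eval (D v (Pᵢ I)) x ∎
      where open ≈-Reasoning

  g≋1 : ∀ J → deg J ≡ 0 → g J ≋ con 1#
  g≋1 []      _   x = refl
  g≋1 (I ∷ J) d≡0 x = trans (*-cong (P≋1 (ℕ.m+n≡0⇒m≡0 (degᵢ I) d≡0) x) (g≋1 J (ℕ.m+n≡0⇒n≡0 (degᵢ I) d≡0) x)) (*-identityˡ 1#)

  g-tail : ∀ I J → degᵢ I ≡ 0 → g (I ∷ J) ≋ g J
  g-tail I J d≡0 x = trans (*-congʳ (P≋1 d≡0 x)) (*-identityˡ _)

  g-head : ∀ I J → deg J ≡ 0 → g (I ∷ J) ≋ Pᵢ I
  g-head I J d≡0 x = trans (*-congˡ (g≋1 J d≡0 x)) (*-identityʳ _)

  D-D-cong : ∀ u v {f h : Poly (Subset n)} → f ≋ h → D u (D v f) ≋ D u (D v h)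
  D-D-cong u v {f} {h} e = D-cong u {D v f} {D v h} (D-cong v {f} {h} e)

  affine : ∀ J → deg J ≡ 1 → ∀ u v → D u (D v (g J)) ≋ con 0#
  affine (I ∷ J) d≡1 u v = by (degᵢ I) ≡.refl d≡1
    where
    by : ∀ d → degᵢ I ≡ d → d ℕ.+ deg J ≡ 1 → D u (D v (g (I ∷ J))) ≋ con 0#
    by zero          dI dJ x = trans (D-D-cong u v {g (I ∷ J)} {g J} (g-tail I J dI) x) (affine J dJ u v x)
    by (suc zero)    dI dJ x = trans (D-D-cong u v {g (I ∷ J)} {Pᵢ I} (g-head I J (ℕ.suc-injective dJ)) x)
      (D-cong u {D v (Pᵢ I)} {con (∑ᵢ (lo I) (hi I) (coef (lo I) (hi I) v))}
        (D-P-degree-one (proj₁ (lo-flat I)) (proj₁ (hi-flat I)) (lo⊂hi I) dI v) x)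
    by (suc (suc d)) dI ()

  quadratic-cong : ∀ f h → f ≋ h → AtMostOnePositive {Subset n} (λ x y → constant (D x (D y f))) →
                   AtMostOnePositive {Subset n} (λ x y → constant (D x (D y h)))
  quadratic-cong f h e (l , l-linear , nonpos) = l , l-linear , λ x lx≈0 → ≤-respˡ (D-D-cong x x {f} {h} e _) (nonpos x lx≈0)

  -- Factors of degree zero are one. Otherwise there is a single factor of degree two, treated by
  -- `rank-three`, or a product of two parts of degree one. In that case the second derivative along
  -- `x` is twice the product of their derivatives, which is zero once the first one is.
  quadratic : ∀ J → deg J ≡ 2 → AtMostOnePositive (λ x y → constant (D x (D y (g J))))
  quadratic (I ∷ J) d≡2 = by (degᵢ I) ≡.refl d≡2
    where
    by : ∀ d → degᵢ I ≡ d → d ℕ.+ deg J ≡ 2 → AtMostOnePositive (λ x y → constant (D x (D y (g (I ∷ J)))))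
    by zero dI dJ = quadratic-cong (g J) (g (I ∷ J)) (λ z → sym (g-tail I J dI z)) (quadratic J dJ)
    by (suc zero) dI dJ = (λ x → constant (D x (Pᵢ I))) , D-linear (Pᵢ I) _ , λ x DxP≈0 → ≤-reflexive (trans
      (+-cong (+-cong (*-congʳ (trans (D-D-cong x x {Pᵢ I} {g (I ∷ [])} (λ z → sym (*-identityʳ _)) _) (affine (I ∷ []) (≡.trans (ℕ.+-identityʳ _) dI) x x _))) (*-congʳ DxP≈0))
              (+-cong (*-congʳ DxP≈0) (*-congˡ (affine J (ℕ.suc-injective dJ) x x _))))
      (solve 3 (λ h k f → num (+ 0) :* h :+ num (+ 0) :* k :+ (num (+ 0) :* k :+ f :* num (+ 0)) := num (+ 0))
        refl (constant (g J)) (constant (D x (g J))) (constant (Pᵢ I))))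
    by (suc (suc zero)) dI dJ = quadratic-cong (Pᵢ I) (g (I ∷ J))
      (λ z → sym (g-head I J (ℕ.suc-injective (ℕ.suc-injective dJ)) z))
      (rank-three (lo-flat I) (hi-flat I) (lo⊂hi I) dI)
    by (suc (suc (suc d))) dI ()

  inFlag-exists : ∀ J → 0 ℕ.< deg J → ∃ (InFlag J)
  inFlag-exists (I ∷ J) 0<d = by (degᵢ I) ≡.refl 0<d
    where
    by : ∀ d → degᵢ I ≡ d → 0 ℕ.< d ℕ.+ deg J → ∃ (InFlag (I ∷ J))
    by zero dI 0<d with inFlag-exists J 0<d
    ... | G , p = G , there p
    by (suc d) dI _ with inner-exists (proj₁ (lo-flat I)) (proj₁ (hi-flat I)) (lo⊂hi I) (≡.subst (0 ℕ.<_) (≡.sym dI) (s≤s z≤n))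
    ... | G , inner = G , here inner

  -- Members of different intervals survive each other's refinement and are adjacent. Two members of
  -- one interval are therefore joined through any member of another, and if there is none, by
  -- connectedness inside the interval.
  flag-connected : ∀ J → 2 ℕ.≤ deg J → ∀ (ξ : Subset n → Carrier) →
                   (∀ G H (p : InFlag J G) → InFlag J H → InFlag (child J p) H → ξ G ≈ ξ H) →
                   ∀ G H → InFlag J G → InFlag J H → ξ G ≈ ξ H
  flag-connected (I ∷ J) 2≤d ξ adjacent G H = connect
    where
    cross : ∀ {F G} → In I F → InFlag J G → ξ F ≈ ξ G
    cross inner p = adjacent _ _ (here inner) (there p) (there (there p))
    both-in-I : ∀ d → deg J ≡ d → In I G → In I H → ξ G ≈ ξ H
    both-in-I zero dJ = inner-connected (lo-flat I) (hi-flat I)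
      (≡.subst (2 ℕ.≤_) (≡.trans (≡.cong (degᵢ I ℕ.+_) dJ) (ℕ.+-identityʳ _)) 2≤d) ξ
      (λ F F′ inner inner′@(PF′ , _ , F′⊂hi) F⊂F′ → adjacent F F′ (here inner) (here inner′) (there (here (PF′ , F⊂F′ , F′⊂hi)))) G H
    both-in-I (suc d) dJ p q with inFlag-exists J (≡.subst (0 ℕ.<_) (≡.sym dJ) (s≤s z≤n))
    ... | _ , r = trans (cross p r) (sym (cross q r))
    both-in-J : ∀ d → degᵢ I ≡ d → InFlag J G → InFlag J H → ξ G ≈ ξ H
    both-in-J zero dI = flag-connected J (≡.subst (λ d → 2 ℕ.≤ d ℕ.+ deg J) dI 2≤d) ξ
      (λ G H p q r → adjacent G H (there p) (there q) (there r)) G H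
    both-in-J (suc d) dI p q with inner-exists (proj₁ (lo-flat I)) (proj₁ (hi-flat I)) (lo⊂hi I) (≡.subst (0 ℕ.<_) (≡.sym dI) (s≤s z≤n))
    ... | _ , r = trans (sym (cross r p)) (cross r q)
    connect : InFlag (I ∷ J) G → InFlag (I ∷ J) H → ξ G ≈ ξ H
    connect (here p)  (here q)  = both-in-I (deg J) ≡.refl p q
    connect (here p)  (there q) = cross p q
    connect (there p) (here q)  = sym (cross q p)
    connect (there p) (there q) = both-in-J (degᵢ I) ≡.refl p q

-- Positivity and signature for flags.

module FlagPolynomials {c ℓ₁ ℓ₂ p} (ℝ : RealNumbers c ℓ₁ ℓ₂) {n} {𝒫 : Pred (Subset n) p}
             (𝒫? : Decidable 𝒫) (graded : IntervalsGraded 𝒫) {K₀ L₀ : Subset n}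
             (flats : IsLatticeOfFlats L₀ (Interval 𝒫 K₀ L₀)) where

  open OrderedField ℝ
  open LinearAlgebra ℝ
  open Lorentz ℝ
  open Polynomials ℝ
  open SubsetSums ℝ
  open Enumerations ℝ
  open Flags ℝ 𝒫? graded flats
  open Signature ℝ using (connected-bochner)

  private
    V : Set c
    V = Subset n → Carrier

    Cone : Pred V ℓ₂
    Cone = StrictlySubmodular K₀ L₀

  module Children (J : Flag) (sep : Separated J) where

    open Enumeration (enumerate (inFlag? J)) public
    open ExtendByZero (enumerate (inFlag? J)) public

    D-hat-e : ∀ {m} (ws : Vec V m) k →
              constant (D (hat (e k)) (Ds ws (g J))) ≈ constant (Ds ws (g (child J (enum-Q k))))
    D-hat-e ws k = trans (IsLinear.cong (D-linear (Ds ws (g J)) _) (hat-e k))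
      (trans (D-Ds (δ (enum k)) ws (g J) _) (Ds-cong ws {D (δ (enum k)) (g J)} {g (child J (enum-Q k))} (D-δ-g J (enum-Q k) sep) _))

  module Expansion (J : Flag) (sep : Separated J) {v : V} (v∈C : Cone v) where

    open Children J sep public

    w : Fin N → Carrier
    w k = positive-representative v∈C J (enum k)

    0<w : ∀ k → 0# < w k
    0<w k = 0<positive-representative v∈C J sep (enum-Q k)

    D-w : ∀ x {m} (ws : Vec V m) → eval (D (hat w) (Ds ws (g J))) x ≈ eval (D v (Ds ws (g J))) x
    D-w x ws = trans (IsLinear.cong (D-linear (Ds ws (g J)) x)
        (hat-restrict (positive-representative v∈C J) (λ S S∉J → assemble-zero _ J S∉J)))
      (sym (D-replace {g J} {v} {positive-representative v∈C J} (D-positive-representative v∈C J sep) ws x))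

    -- The positive representative acts like `v` and is a combination of coordinate directions, each
    -- of which refines the flag. Thus a cone derivative is a positive combination of flag
    -- polynomials of one degree less.
    expansion : ∀ {m} (ws : Vec V m) → constant (D v (Ds ws (g J))) ≈
                sum (λ k → w k * constant (Ds ws (g (child J (enum-Q k)))))
    expansion ws = trans (sym (D-w _ ws)) (trans (linear-basis (hat-linear (D-linear (Ds ws (g J)) _)) w)
      (sum-cong-≋ {N} λ k → *-congˡ (D-hat-e ws k)))

  positivity : ∀ d J → Separated J → deg J ≡ d → (vs : Vec V d) → All Cone vs → 0# < constant (Ds vs (g J))
  positivity zero J sep d≡ [] [] = <-respʳ (sym (g≋1 J d≡ _)) 0<1
  positivity (suc d) J sep d≡ (v ∷ vs) (v∈C ∷ vs∈C) = <-respʳ (sym (expansion vs))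
      (0<sum (λ k → <⇒≤ (0<term k)) (index (proj₂ inner)) (0<term (index (proj₂ inner))))
    where
    open Expansion J sep v∈C
    0<term : ∀ k → 0# < w k * constant (Ds vs (g (child J (enum-Q k))))
    0<term k = *-pos (0<w k) (positivity d (child J (enum-Q k)) (separated-child J (enum-Q k) sep)
      (ℕ.suc-injective (≡.trans (≡.sym (deg-child J (enum-Q k))) d≡)) vs vs∈C)
    inner : ∃ (InFlag J)
    inner = inFlag-exists J (≡.subst (0 ℕ.<_) (≡.sym d≡) (s≤s z≤n))

  signature : ∀ d J → Separated J → deg J ≡ suc (suc d) → (vs : Vec V d) → All Cone vs →
              AtMostOnePositive (λ x y → constant (D x (D y (Ds vs (g J)))))
  signature zero J sep d≡ [] [] = quadratic J d≡
  signature (suc d) J sep d≡ (v ∷ vs) (v∈C ∷ vs∈C) = transfer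
      (connected-bochner (hat-form B-form) 0<w 0<Bw off-diagonal connected bochner)
    where
    open Expansion J sep v∈C
    B : V → V → Carrier
    B x y = constant (D x (D y (Ds (v ∷ vs) (g J))))
    B-form : IsForm B
    B-form = D-form (Ds (v ∷ vs) (g J))

    J/ : Fin N → Flag
    J/ k = child J (enum-Q k)
    sep/ : ∀ k → Separated (J/ k)
    sep/ k = separated-child J (enum-Q k) sep
    deg/ : ∀ k → deg (J/ k) ≡ suc (suc d)
    deg/ k = ℕ.suc-injective (≡.trans (≡.sym (deg-child J (enum-Q k))) d≡)
    B/ : Fin N → V → V → Carrier
    B/ k x y = constant (D x (D y (Ds vs (g (J/ k)))))
    0<B/ : ∀ k → 0# < B/ k v v
    0<B/ k = positivity (suc (suc d)) (J/ k) (sep/ k) (deg/ k) (v ∷ v ∷ vs) (v∈C ∷ v∈C ∷ vs∈C)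

    -- The coordinate direction is spent on refining the flag, which frees `v` to become an argument
    -- of the refined Hessian. This is how the rows of `B` meet the reverse Cauchy-Schwarz
    -- inequality.
    B-e : ∀ k y → B (hat (e k)) (hat y) ≈ B/ k (hat y) v
    B-e k y = D-hat-e (hat y ∷ v ∷ vs) k

    B-e-w : ∀ k → B (hat (e k)) (hat w) ≈ B/ k v v
    B-e-w k = trans (D-cong (hat (e k)) {D (hat w) (Ds (v ∷ vs) (g J))} {D v (Ds (v ∷ vs) (g J))} (λ x → D-w x (v ∷ vs)) _)
      (D-hat-e (v ∷ v ∷ vs) k)

    0<Bw : ∀ k → 0# < B (hat (e k)) (hat w)
    0<Bw k = <-respʳ (sym (B-e-w k)) (0<B/ k)

    B-e-e : ∀ j k → B (hat (e j)) (hat (e k)) ≈ constant (D (δ (enum k)) (Ds (v ∷ vs) (g (J/ j))))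
    B-e-e j k = trans (B-e j (e k)) (IsLinear.cong (D-linear (Ds (v ∷ vs) (g (J/ j))) _) (hat-e k))

    0<adjacent : ∀ j k → InFlag (J/ j) (enum k) → 0# < B (hat (e j)) (hat (e k))
    0<adjacent j k q = <-respʳ (sym (trans (B-e-e j k)
        (trans (D-Ds (δ (enum k)) (v ∷ vs) (g (J/ j)) _)
          (Ds-cong (v ∷ vs) {D (δ (enum k)) (g (J/ j))} {g (child (J/ j) q)} (D-δ-g (J/ j) q (sep/ j)) _))))
      (positivity (suc d) (child (J/ j) q) (separated-child (J/ j) q (sep/ j))
        (ℕ.suc-injective (≡.trans (≡.sym (deg-child (J/ j) q)) (deg/ j))) (v ∷ vs) (v∈C ∷ vs∈C))

    Ds-zero : ∀ {m} (ws : Vec V m) → Ds ws (con 0#) ≋ con 0#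
    Ds-zero []       x = refl
    Ds-zero (u ∷ ws) x = D-cong u {Ds ws (con 0#)} {con 0#} (Ds-zero ws) x

    -- If `enum k` is not a member of the refined flag, it is not an end either: the only new end is
    -- `enum j`, and separation excludes the old ones. So the entry is zero.
    off-diagonal : ∀ j k → ¬ j ≡ k → 0# ≤ B (hat (e j)) (hat (e k))
    off-diagonal j k j≢k with inFlag? (J/ j) (enum k)
    ... | yes q = <⇒≤ (0<adjacent j k q)
    ... | no ¬q = ≤-reflexive (sym (trans (B-e-e j k) (trans (D-Ds (δ (enum k)) (v ∷ vs) (g (J/ j)) _)
        (trans (Ds-cong (v ∷ vs) {D (δ (enum k)) (g (J/ j))} {con 0#} (D-δ-g-away (J/ j) (away-all (J/ j) ¬q
          (not-end-child J (enum-Q j) (λ eq → j≢k (injective (≡.sym eq))) (inFlag⇒not-end sep (enum-Q k))))) _)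
          (Ds-zero (v ∷ vs) _)))))

    connected : ∀ (ξ : Fin N → Carrier) → (∀ j k → ¬ j ≡ k → 0# < B (hat (e j)) (hat (e k)) → ξ j ≈ ξ k) →
                ∀ j k → ξ j ≈ ξ k
    connected ξ along j k = trans (sym (hat-enum ξ j)) (trans
        (flag-connected J (≡.subst (2 ℕ.≤_) (≡.sym d≡) (s≤s (s≤s z≤n))) (hat ξ) adjacent (enum j) (enum k) (enum-Q j) (enum-Q k))
        (hat-enum ξ k))
      where
      at : ∀ {S} (q : InFlag J S) → hat ξ S ≈ ξ (index q)
      at {S} q = trans (reflexive (≡.cong (hat ξ) (≡.sym (enum-index q)))) (hat-enum ξ (index q))
      joined : ∀ {G H} j k → enum j ≡ G → enum k ≡ H → (q : InFlag J G) → InFlag (child J q) H → ξ j ≈ ξ k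
      joined j k ≡.refl ≡.refl q r with j Fin.≟ k
      ... | yes ≡.refl = refl
      ... | no  j≢k    = along j k j≢k (0<adjacent j k (child-irrelevant J sep q (enum-Q j) r))
      adjacent : ∀ G H (q : InFlag J G) → InFlag J H → InFlag (child J q) H → hat ξ G ≈ hat ξ H
      adjacent G H q q′ r = trans (at q)
        (trans (joined (index q) (index q′) (enum-index q) (enum-index q′) q r) (sym (at q′)))

    term : ∀ y k → B/ k (hat y) (hat y) ≤ B (hat (e k)) (hat w) ⁻¹ * (B (hat (e k)) (hat y) * B (hat (e k)) (hat y))
    term y k = diff⇒≤ (0≤*-cancel (0<Bw k) (≤-respʳ (begin
        b * b - B/ k v v * B/ k (hat y) (hat y)
          ≈⟨ +-cong (*-cong (B-e k y) (B-e k y)) (-‿cong (*-congʳ (B-e-w k))) ⟨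
        B (hat (e k)) (hat y) * B (hat (e k)) (hat y) - u * B/ k (hat y) (hat y)
          ≈⟨ +-congʳ (trans (*-congʳ (*-inverseʳ (>⇒≉ (0<Bw k)))) (*-identityˡ _)) ⟨
        u * u ⁻¹ * (B (hat (e k)) (hat y) * B (hat (e k)) (hat y)) - u * B/ k (hat y) (hat y)
          ≈⟨ solve 4 (λ u i b z → u :* i :* b :- u :* z := u :* (i :* b :- z)) refl u (u ⁻¹) _ (B/ k (hat y) (hat y)) ⟩
        u * (u ⁻¹ * (B (hat (e k)) (hat y) * B (hat (e k)) (hat y)) - B/ k (hat y) (hat y)) ∎)
        -- The induction hypothesis enters here, for the refined flag, with the cone direction `v`
        -- as the vector of positive value.
        (0≤y-x (reverse-Cauchy-Schwarz (D-form (Ds vs (g (J/ k)))) (signature d (J/ k) (sep/ k) (deg/ k) vs vs∈C) {v} (0<B/ k) (hat y)))))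
      where
      open ≈-Reasoning
      u = B (hat (e k)) (hat w)
      b = B/ k (hat y) v

    bochner : ∀ y → B (hat y) (hat y) ≤
              sum (λ k → w k * B (hat (e k)) (hat w) ⁻¹ * B (hat (e k)) (hat y) * B (hat (e k)) (hat y))
    -- `v` is moved to the outermost place, where `expansion` applies.
    bochner y = ≤-trans (≤-reflexive (trans (sym (D-Ds v (hat y ∷ hat y ∷ []) (Ds vs (g J)) _)) (expansion (hat y ∷ hat y ∷ vs))))
      (sum-mono {N} λ k → ≤-trans (*-monoˡ-≤ (<⇒≤ (0<w k)) (term y k)) (≤-reflexive
        (solve 3 (λ w u b → w :* (u :* (b :* b)) := w :* u :* b :* b) refl (w k) (B (hat (e k)) (hat w) ⁻¹) (B (hat (e k)) (hat y)))))

    -- Every direction acts on `g J` like its restriction to the members of the flag, so the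
    -- hyperplane found in these finitely many coordinates pulls back.
    transfer : AtMostOnePositive (λ x y → B (hat x) (hat y)) → AtMostOnePositive B
    transfer (f , f-linear , nonpos) = (λ x → f (restrict J x ∘ enum)) ,
      record { cong = λ x≈y → IsLinear.cong f-linear λ k → IsLinear.cong (restrict-linear J (enum k)) x≈y
             ; linear = λ s x r y → trans (IsLinear.cong f-linear λ k → IsLinear.linear (restrict-linear J (enum k)) s x r y)
                                          (IsLinear.linear f-linear s _ r _) } ,
      λ x fx≈0 → ≤-respˡ (sym (B-restrict x)) (nonpos (restrict J x ∘ enum) fx≈0)
      where
      D-x : ∀ x {m} (ws : Vec V m) → D x (Ds ws (g J)) ≋ D (hat (restrict J x ∘ enum)) (Ds ws (g J))
      D-x x ws z = trans (D-replace {g J} {x} {restrict J x} (D-restrict J sep x) ws z)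
        (sym (IsLinear.cong (D-linear (Ds ws (g J)) z) (hat-restrict (restrict J x) λ S S∉J → assemble-zero _ J S∉J)))
      B-restrict : ∀ x → B x x ≈ B (hat (restrict J x ∘ enum)) (hat (restrict J x ∘ enum))
      B-restrict x = trans (D-x x (x ∷ v ∷ vs) _)
        (D-cong (hat (restrict J x ∘ enum)) {D x (Ds (v ∷ vs) (g J))} {D (hat (restrict J x ∘ enum)) (Ds (v ∷ vs) (g J))} (D-x x (v ∷ vs)) _)

-- From forms to eigenvalues of the coordinate matrix.

module Eigenvalues {c ℓ₁ ℓ₂} (ℝ : RealNumbers c ℓ₁ ℓ₂) {n} {K L : Subset n} where

  open OrderedField ℝ
  open LinearAlgebra ℝ
  open Lorentz ℝ hiding (D)
  open Signature ℝ
  open SubsetSums ℝ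
  open Enumerations ℝ

  private
    between? : ∀ S → Dec (K ⊂ S × S ⊂ L)
    between? S = (K ⊂? S) ×-dec (S ⊂? L)

    open Enumeration (enumerate between?)

    element : Fin N → Between K L
    element k = between (enum k) (proj₁ (enum-Q k)) (proj₂ (enum-Q k))

    position : Between K L → Fin N
    position S = index (recompute S)

    element-position : ∀ S → element (position S) ≡ S
    element-position S = between-≡ (enum-index (recompute S))

    position-element : ∀ k → position (element k) ≡ k
    position-element k = injective (enum-index (recompute (element k)))

    _↑ : (Fin N → Carrier) → 𝓔 K L
    (x ↑) S = x (position S)

    _↓ : 𝓔 K L → Fin N → Carrier
    (x ↓) k = x (element k)

    ↓↑ : ∀ x S → (x ↓ ↑) S ≈ x S
    ↓↑ x S = reflexive (≡.cong x (element-position S))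

    extend-when : ∀ (f : 𝓔 K L) S → extend 0# f S ≈ when (between? S) (extend 0# f S)
    extend-when f S with K ⊂? S | S ⊂? L
    ... | yes _ | yes _ = refl
    ... | yes _ | no _  = refl
    ... | no _  | _     = refl

    extend-element : ∀ (f : 𝓔 K L) S K⊂S S⊂L → extend 0# f S ≈ f (between S K⊂S S⊂L)
    extend-element f S K⊂S S⊂L with K ⊂? S | S ⊂? L
    ... | yes _   | yes _   = refl
    ... | yes _   | no S⊄L  = ⊥-elim (S⊄L S⊂L)
    ... | no K⊄S  | _       = ⊥-elim (K⊄S K⊂S)

    ∑≈sum : ∀ (f : 𝓔 K L) → ∑ f ≈ sum (f ↓)
    ∑≈sum f = trans (∑ₛ-cong {n} (extend-when f)) (trans (sum-enum (extend 0# f))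
      (sum-cong-≋ {N} λ k → extend-element f (enum k) (proj₁ (enum-Q k)) (proj₂ (enum-Q k))))

    basis-e : ∀ S k → basis S (element k) ≈ e k (position S)
    basis-e S k with ≡-dec Bool._≟_ (set S) (enum k)
    ... | yes eq = sym (trans (reflexive (≡.cong (e k) (≡.trans (≡.cong position (between-≡ {S = S} {element k} eq)) (position-element k)))) (e-diagonal k))
    ... | no neq = sym (e-off-diagonal k (position S) λ { ≡.refl → neq (≡.sym (≡.cong set (element-position S))) })

    basis-sym : ∀ (S T : Between K L) → basis S T ≈ basis T S
    basis-sym S T with ≡-dec Bool._≟_ (set S) (set T) | ≡-dec Bool._≟_ (set T) (set S)
    ... | yes _ | yes _ = refl
    ... | no _  | no _  = refl
    ... | yes p | no ¬q = ⊥-elim (¬q (≡.sym p))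
    ... | no ¬p | yes q = ⊥-elim (¬p (≡.sym q))

    e↑ : ∀ k T → (e k ↑) T ≈ basis (element k) T
    e↑ k T = trans (sym (basis-e T k)) (basis-sym T (element k))

  module _ {B : 𝓔 K L → 𝓔 K L → Carrier} (form : IsForm B) where

    private
      BF : (x y : Fin N → Carrier) → Carrier
      BF x y = B (x ↑) (y ↑)

      ↑-linear : ∀ {f : 𝓔 K L → Carrier} → IsLinear f → IsLinear (λ x → f (x ↑))
      ↑-linear f-linear = record
        { cong = λ p → IsLinear.cong f-linear λ S → p (position S)
        ; linear = λ s x r y → IsLinear.linear f-linear s (x ↑) r (y ↑) }

      BF-form : IsForm BF
      BF-form = record { symmetric = λ x y → IsForm.symmetric form (x ↑) (y ↑) ; linearˡ = λ y → ↑-linear (IsForm.linearˡ form (y ↑)) }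

      dot : (x y : Fin N → Carrier) → Carrier
      dot x y = sum (λ i → x i * (1# * y i))

      dot-form : IsForm dot
      dot-form = diagonal-form (λ _ → 1#)

      dot-positive : ∀ x → 0# < ∥ x ∥² → 0# < dot x x
      dot-positive = diagonal-positive (λ _ → 1#) (λ _ → 0<1)

      EigenvectorF : Carrier → (Fin N → Carrier) → Set (c ⊔ ℓ₁)
      EigenvectorF = Eigenvector BF-form dot-form dot-positive

      matrix-row : ∀ S (w : 𝓔 K L) → ∑ (λ T → matrixOf B S T * w T) ≈ B (basis S) w
      matrix-row S w = begin
        ∑ (λ T → B (basis S) (basis T) * w T)                    ≈⟨ ∑≈sum _ ⟩
        sum (λ k → B (basis S) (basis (element k)) * w (element k))
          ≈⟨ sum-cong-≋ {N} (λ k → trans (*-comm _ _) (*-congˡ (IsLinear.cong (IsForm.linearʳ form (basis S)) λ T → sym (e↑ k T)))) ⟩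
        sum (λ k → (w ↓) k * B (basis S) (e k ↑))                 ≈⟨ linear-basis (↑-linear (IsForm.linearʳ form (basis S))) (w ↓) ⟨
        B (basis S) (w ↓ ↑)                                      ≈⟨ IsLinear.cong (IsForm.linearʳ form (basis S)) (↓↑ w) ⟩
        B (basis S) w                                            ∎
        where open ≈-Reasoning

      dot-basis : ∀ w S → dot w (basis S ↓) ≈ w (position S)
      dot-basis w S = trans (sum-cong-≋ {N} λ k → *-congˡ (trans (*-identityˡ _) (basis-e S k)))
        (sym (linear-basis {N} {λ x → x (position S)} (record { cong = λ p → p (position S) ; linear = λ s x r y → refl }) w))

      eigenspace : ∀ {μ w} → EigenvectorF μ w → InEigenspace (matrixOf B) μ (w ↑)
      eigenspace {μ} {w} eigen S = begin
        ∑ (λ T → matrixOf B S T * (w ↑) T)   ≈⟨ matrix-row S (w ↑) ⟩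
        B (basis S) (w ↑)                    ≈⟨ IsForm.symmetric form _ _ ⟩
        B (w ↑) (basis S)                    ≈⟨ IsLinear.cong (IsForm.linearʳ form (w ↑)) (↓↑ (basis S)) ⟨
        BF w (basis S ↓)                     ≈⟨ eigen (basis S ↓) ⟩
        μ * dot w (basis S ↓)                ≈⟨ *-congˡ (dot-basis w S) ⟩
        μ * w (position S)                   ∎
        where open ≈-Reasoning

      -- The matrix equation tests against basis vectors only; linearity in `z` supplies the rest.
      eigenvector : ∀ {ν w} → InEigenspace (matrixOf B) ν w →
                    EigenvectorF ν (w ↓)
      eigenvector {ν} {w} in-space z = begin
        B (w ↓ ↑) (z ↑)                      ≈⟨ IsLinear.cong (IsForm.linearˡ form (z ↑)) (↓↑ w) ⟩
        B w (z ↑)                            ≈⟨ IsForm.symmetric form _ _ ⟩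
        B (z ↑) w                            ≈⟨ linear-basis (↑-linear (IsForm.linearˡ form w)) z ⟩
        sum (λ k → z k * B (e k ↑) w)
          ≈⟨ sum-cong-≋ {N} (λ k → trans (*-congˡ (trans (IsLinear.cong (IsForm.linearˡ form w) (e↑ k))
               (trans (sym (matrix-row (element k) w)) (in-space (element k)))))
               (solve 3 (λ z n w → z :* (n :* w) := n :* (w :* (num (+ 1) :* z))) refl (z k) ν (w (element k)))) ⟩
        sum (λ k → ν * (w (element k) * (1# * z k))) ≈⟨ *-distribˡ-sum ν (λ k → w (element k) * (1# * z k)) ⟨
        ν * dot (w ↓) z                      ∎
        where open ≈-Reasoning

      transfer : (∃₂ λ μ w → 0# < μ × 0# < ∥ w ∥² × EigenvectorF μ w ×
                   (∀ x → EigenvectorF μ x → ∃ λ a → ∀ i → x i ≈ a * w i) ×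
                   (∀ ν x → 0# < ν → 0# < ∥ x ∥² → EigenvectorF ν x → ν ≈ μ)) →
                 ExactlyOnePositiveEigenvalue (matrixOf B)
      transfer (μ , w , 0<μ , 0<w , eigen , multiplicity , unique) =
        μ , 0<μ , (w ↑ , nonzero , eigenspace {μ} {w} eigen , multiple) , only
        where
        nonzero : NonZero (w ↑)
        nonzero w≈0 = >⇒≉ 0<w (zero⇒∥∥²≈0 w λ k → trans (reflexive (≡.cong w (≡.sym (position-element k)))) (w≈0 (element k)))
        multiple : ∀ x → InEigenspace (matrixOf B) μ x → ∃ λ a → ∀ S → x S ≈ a * (w ↑) S
        multiple x in-space = proj₁ scalar , λ S → trans (sym (↓↑ x S)) (proj₂ scalar (position S))
          where
          scalar : ∃ λ a → ∀ i → (x ↓) i ≈ a * w i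
          scalar = multiplicity (x ↓) (eigenvector {μ} {x} in-space)
        only : ∀ ν → 0# < ν → IsEigenvalue (matrixOf B) ν → ν ≈ μ
        only ν 0<ν (x , x≉0 , in-space) = unique ν (x ↓) 0<ν
          (∥∥²-positive {x = x ↓} λ x≈0 → x≉0 λ S → trans (sym (↓↑ x S)) (x≈0 (position S))) (eigenvector {ν} {x} in-space)

    -- On `Fin N` the hyperplane pulls back along `_↑`, and `v` read in coordinates keeps its
    -- positive value, so the count for the standard inner product applies.
    exactly-one-positive-eigenvalue : AtMostOnePositive B → ∀ {v} → 0# < B v v →
                                      ExactlyOnePositiveEigenvalue (matrixOf B)
    exactly-one-positive-eigenvalue (f , f-linear , nonpos) {v} 0<Bvv =
      transfer (one-positive-eigenvalue BF-form dot-form dot-positive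
        ((λ x → f (x ↑)) , ↑-linear f-linear , λ x → nonpos (x ↑)) {v ↓} (<-respʳ (sym (IsForm.cong₂ form (↓↑ v) (↓↑ v))) 0<Bvv))

-- Return to the coordinates of a single interval.

module MainTheorem {c ℓ₁ ℓ₂ p} (ℝ : RealNumbers c ℓ₁ ℓ₂) {n} {𝒫 : Pred (Subset n) p}
                   (𝒫? : Decidable 𝒫) (graded : IntervalsGraded 𝒫) where

  open OrderedField ℝ
  open LinearAlgebra ℝ
  open Lorentz ℝ
  open Polynomials ℝ
  open SubsetSums ℝ
  open IntervalsGraded graded
  open Pol 𝒫? graded
  open Derivatives ℝ 𝒫? graded
  open Exp semiring using (^-homo-*)

  -- Each summand of the recursion scales with exponent `1 + degree K F + degree F L`, the one
  -- coming from its coordinate, and this is `degree K L`.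
  P-homogeneous : ∀ {K L} → 𝒫 K → 𝒫 L → K ⊂ L → Homogeneous (degree K L) (P K L)
  P-homogeneous {K} {L} PK PL K⊂L a x = go (degree K L) PK PL K⊂L ℕ.≤-refl
    where
    ax : Subset n → Carrier
    ax S = a * x S
    go : ∀ m {K L} → 𝒫 K → 𝒫 L → K ⊂ L → degree K L ℕ.≤ m → eval (P K L) ax ≈ a ^ degree K L * eval (P K L) x
    by-degree : ∀ m {K L} → 𝒫 K → 𝒫 L → K ⊂ L → degree K L ℕ.≤ suc m → ∀ d → degree K L ≡ d →
                eval (P K L) ax ≈ a ^ degree K L * eval (P K L) x
    degree-zero : ∀ {K L} → degree K L ≡ 0 → eval (P K L) ax ≈ a ^ degree K L * eval (P K L) x
    degree-zero d≡0 = trans (P≋1 d≡0 ax) (sym (trans (*-cong (reflexive (≡.cong (a ^_) d≡0)) (P≋1 d≡0 x)) (*-identityˡ 1#)))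
    go zero    PK PL K⊂L d≤0 = degree-zero (ℕ.n≤0⇒n≡0 d≤0)
    go (suc m) {K} {L} PK PL K⊂L d≤ = by-degree m PK PL K⊂L d≤ (degree K L) ≡.refl
    by-degree m PK PL K⊂L d≤ zero    d≡ = degree-zero d≡
    by-degree m {K} {L} PK PL K⊂L d≤ (suc d) d≡ = *-cancelˡ (>⇒≉ (0<fromℕ′ (≡.subst (0 ℕ.<_) (≡.sym d≡) (s≤s z≤n)))) (begin
      fromℕ (degree K L) * eval (P K L) ax          ≈⟨ P-recursion PK PL K⊂L ax ⟩
      ∑ᵢ K L (λ F → coef K L ax F * (eval (P K F) ax * eval (P F L) ax))
        ≈⟨ ∑ᵢ-cong K L (λ F inner@(PF , K⊂F , F⊂L) → trans
             (*-cong (IsLinear.scale (coef-linear K⊂L F) a x)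
               (*-cong (go m PK PF K⊂F (ℕ.s≤s⁻¹ (ℕ.≤-trans (degree-<ʳ PK PF PL K⊂F F⊂L) d≤)))
                       (go m PF PL F⊂L (ℕ.s≤s⁻¹ (ℕ.≤-trans (degree-<ˡ PK PF PL K⊂F F⊂L) d≤)))))
             (trans (solve 6 (λ a c i p j q → a :* c :* (i :* p :* (j :* q)) := a :* (i :* j) :* (c :* (p :* q)))
                 refl a (coef K L x F) (a ^ degree K F) (eval (P K F) x) (a ^ degree F L) (eval (P F L) x))
               (*-congʳ (trans (*-congˡ (sym (^-homo-* a (degree K F) (degree F L))))
                 (reflexive (≡.cong (a ^_) (≡.sym (degree-sum PK PL inner)))))))) ⟩
      ∑ᵢ K L (λ F → a ^ degree K L * (coef K L x F * (eval (P K F) x * eval (P F L) x)))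
        ≈⟨ ∑ᵢ-* K L _ _ ⟩
      a ^ degree K L * ∑ᵢ K L (λ F → coef K L x F * (eval (P K F) x * eval (P F L) x))
        ≈⟨ *-congˡ (P-recursion PK PL K⊂L x) ⟨
      a ^ degree K L * (fromℕ (degree K L) * eval (P K L) x)
        ≈⟨ solve 3 (λ a d p → a :* (d :* p) := d :* (a :* p)) refl (a ^ degree K L) (fromℕ (degree K L)) (eval (P K L) x) ⟩
      fromℕ (degree K L) * (a ^ degree K L * eval (P K L) x) ∎)
      where open ≈-Reasoning

  module _ {K L : Subset n} (PK : 𝒫 K) (PL : 𝒫 L) (K⊂L : K ⊂ L) where

    private
      ⟨⟩-cong : ∀ {x y : 𝓔 K L} → (∀ S → x S ≈ y S) → ∀ S → x ⟨ S ⟩ ≈ y ⟨ S ⟩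
      ⟨⟩-cong p S with K ⊂? S | S ⊂? L
      ... | yes _ | yes _ = p _
      ... | yes _ | no _  = refl
      ... | no _  | _     = refl

      ⟨⟩-lin : ∀ s (x : 𝓔 K L) r y S → lin s x r y ⟨ S ⟩ ≈ lin s (x ⟨_⟩) r (y ⟨_⟩) S
      ⟨⟩-lin s x r y S with K ⊂? S | S ⊂? L
      ... | yes _ | yes _ = refl
      ... | yes _ | no _  = sym (trans (+-cong (zeroʳ s) (zeroʳ r)) (+-identityˡ 0#))
      ... | no _  | _     = sym (trans (+-cong (zeroʳ s) (zeroʳ r)) (+-identityˡ 0#))

      ⟨⟩-set : ∀ (x : 𝓔 K L) T → K ⊂ set T → set T ⊂ L → x ⟨ set T ⟩ ≈ x T
      ⟨⟩-set x T K⊂T T⊂L with K ⊂? set T | set T ⊂? L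
      ... | yes _  | yes _  = refl
      ... | yes _  | no T⊄L = ⊥-elim (T⊄L T⊂L)
      ... | no K⊄T | _      = ⊥-elim (K⊄T K⊂T)

      ⟨L⟩ : ∀ (x : 𝓔 K L) → x ⟨ L ⟩ ≈ 0#
      ⟨L⟩ x with K ⊂? L | L ⊂? L
      ... | _     | yes L⊂L = ⊥-elim (⊂-irref ≡.refl L⊂L)
      ... | yes _ | no _    = refl
      ... | no _  | no _    = refl

      ⟨K⟩ : ∀ (x : 𝓔 K L) → x ⟨ K ⟩ ≈ 0#
      ⟨K⟩ x with K ⊂? K | K ⊂? L
      ... | yes K⊂K | _ = ⊥-elim (⊂-irref ≡.refl K⊂K)
      ... | no _    | _ = refl

      eval-t≈ : ∀ (x : 𝓔 K L) S → eval (t S) x ≈ x ⟨ S ⟩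
      eval-t≈ x S with K ⊂? S | S ⊂? L
      ... | yes _ | yes _ = refl
      ... | yes _ | no _  = refl
      ... | no _  | _     = refl

      D-t : ∀ (u : 𝓔 K L) S → D u (t S) ≋ con (u ⟨ S ⟩)
      D-t u S x with K ⊂? S | S ⊂? L
      ... | yes _ | yes _ = refl
      ... | yes _ | no _  = refl
      ... | no _  | _     = refl

    -- Extension by zero vanishes at `K` and `L`, so the projection built into `P` leaves it
    -- unchanged.
    pol≈P : ∀ (x : 𝓔 K L) → eval (pol K L) x ≈ eval (P K L) (x ⟨_⟩)
    pol≈P x = trans (eval-cong (pol K L) λ T → sym (trans (eval-coefPoly K L (set T) (x ⟨_⟩))
        (trans (coef-ends K⊂L {x ⟨_⟩} (set T) (⟨L⟩ x) (⟨K⟩ x)) (⟨⟩-set x T (proj₁ (recompute T)) (proj₂ (recompute T))))))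
      (reflexive (≡.sym (eval-[] (pol K L) _ (x ⟨_⟩))))

    pol-homogeneous : Homogeneous (degree K L) (pol K L)
    pol-homogeneous a x = trans (pol≈P (λ S → a * x S)) (trans (eval-cong (P K L) scale)
        (trans (P-homogeneous PK PL K⊂L a (x ⟨_⟩)) (*-congˡ (sym (pol≈P x)))))
      where
      scale : ∀ S → (λ T → a * x T) ⟨ S ⟩ ≈ a * x ⟨ S ⟩
      scale S with K ⊂? S | S ⊂? L
      ... | yes _ | yes _ = refl
      ... | yes _ | no _  = sym (zeroʳ a)
      ... | no _  | _     = sym (zeroʳ a)

    -- `pol K L` is `P K L` with the variables `t` substituted, which is linear; the chain rule
    -- turns each direction into its extension by zero.
    constant-Ds : ∀ {m} (vs : Vec (𝓔 K L) m) → constant (Ds vs (pol K L)) ≈ constant (Ds (map _⟨_⟩ vs) (P K L))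
    constant-Ds vs = trans
      (Ds-cong vs {pol K L} {P K L [ t ]} (λ x → trans (pol≈P x) (trans (eval-cong (P K L) λ S → sym (eval-t≈ x S))
        (reflexive (≡.sym (eval-[] (P K L) t x))))) _)
      (trans (Ds-chain-rule (P K L) t _⟨_⟩ D-t vs _) (trans (reflexive (eval-[] (Ds (map _⟨_⟩ vs) (P K L)) t _))
        (eval-cong (Ds (map _⟨_⟩ vs) (P K L)) λ S → trans (eval-t≈ _ S) (zero-extended S))))
      where
      zero-extended : ∀ S → _⟨_⟩ {K = K} {L} (λ _ → 0#) S ≈ 0#
      zero-extended S with K ⊂? S | S ⊂? L
      ... | yes _ | yes _ = refl
      ... | yes _ | no _  = refl
      ... | no _  | _     = refl

    -- A set equal to `K` or `L` is comparable with every set of the interval, so incomparable sets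
    -- satisfy the strict bounds asked for by `𝓒`.
    cone⇒submodular : ∀ {v : 𝓔 K L} → 𝓒 K L v → StrictlySubmodular K L (v ⟨_⟩)
    cone⇒submodular v∈C S T K⊆S S⊆L K⊆T T⊆L S⊈T T⊈S =
      v∈C S T (strict K⊆S S⊈T K⊆T) (strictʳ S⊆L T⊈S T⊆L) (strict K⊆T T⊈S K⊆S) (strictʳ T⊆L S⊈T S⊆L) S⊈T T⊈S
      where
      strict : ∀ {S T : Subset n} → K ⊆ S → ¬ S ⊆ T → K ⊆ T → K ⊂ S
      strict {S} {T} K⊆S S⊈T K⊆T with K ⊂? S
      ... | yes K⊂S = K⊂S
      ... | no  K⊄S = ⊥-elim (S⊈T (≡.subst (_⊆ T) (≡.sym (⊆⇒≡ K⊆S K⊄S)) K⊆T))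
      strictʳ : ∀ {S T : Subset n} → S ⊆ L → ¬ T ⊆ S → T ⊆ L → S ⊂ L
      strictʳ {S} {T} S⊆L T⊈S T⊆L with S ⊂? L
      ... | yes S⊂L = S⊂L
      ... | no  S⊄L = ⊥-elim (T⊈S (≡.subst (T ⊆_) (⊆⇒≡ S⊆L S⊄L) T⊆L))

    module _ (flats : IsLatticeOfFlats L (Interval 𝒫 K L)) where

      open Flags ℝ 𝒫? graded flats
      open FlagPolynomials ℝ 𝒫? graded flats

      private
        whole : FlatInterval
        whole = record { lo = K ; hi = L ; lo-flat = PK , ⊆-refl , p⊂q⇒p⊆q K⊂L ; hi-flat = PL , p⊂q⇒p⊆q K⊂L , ⊆-refl ; lo⊂hi = K⊂L }

        constant-g : ∀ {m} (vs : Vec (𝓔 K L) m) → constant (Ds (map _⟨_⟩ vs) (g (whole ∷ []))) ≈ constant (Ds vs (pol K L))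
        constant-g vs = trans (Ds-cong (map _⟨_⟩ vs) {g (whole ∷ [])} {P K L} (λ x → *-identityʳ _) _) (sym (constant-Ds vs))

        submodular : ∀ {m} {vs : Vec (𝓔 K L) m} → All (𝓒 K L) vs → All (StrictlySubmodular K L) (map _⟨_⟩ vs)
        submodular []           = []
        submodular (v∈C ∷ vs∈C) = cone⇒submodular v∈C ∷ submodular vs∈C

        pol-positive : ∀ {d} → degree K L ≡ d → (vs : Vec (𝓔 K L) d) → All (𝓒 K L) vs → PropertyP (pol K L) vs
        pol-positive {d} d≡ vs vs∈C = <-respʳ (constant-g vs)
          (positivity d (whole ∷ []) ([] ∷ []) (≡.trans (ℕ.+-identityʳ _) d≡) (map _⟨_⟩ vs) (submodular vs∈C))

        pol-signature : ∀ {d} → degree K L ≡ d → (vs : Vec (𝓔 K L) d) → All (𝓒 K L) vs → PropertyH (pol K L) vs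
        pol-signature d≡ []       _ = _
        pol-signature d≡ (_ ∷ []) _ = _
        pol-signature {suc (suc d)} d≡ (v ∷ _ ∷ vs) (v∈C ∷ _ ∷ vs∈C) =
          Eigenvalues.exactly-one-positive-eigenvalue ℝ (D-form (Ds vs (pol K L)))
            (restrict-amop (signature d (whole ∷ []) ([] ∷ []) (≡.trans (ℕ.+-identityʳ _) d≡) (map _⟨_⟩ vs) (submodular vs∈C)))
            -- Property (P) with `v` taken twice gives a vector of positive value, so that a
            -- positive eigenvalue exists; the second direction of the list plays the part of a
            -- Hessian argument.
            {v} (pol-positive d≡ (v ∷ v ∷ vs) (v∈C ∷ v∈C ∷ vs∈C))
          where
          restrict-amop : AtMostOnePositive (λ x y → constant (D x (D y (Ds (map _⟨_⟩ vs) (g (whole ∷ [])))))) →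
                          AtMostOnePositive (λ x y → constant (D x (D y (Ds vs (pol K L)))))
          restrict-amop (f , f-linear , nonpos) = (λ x → f (x ⟨_⟩)) ,
            record { cong = λ p → IsLinear.cong f-linear (⟨⟩-cong p)
                   ; linear = λ s x r y → trans (IsLinear.cong f-linear (⟨⟩-lin s x r y)) (IsLinear.linear f-linear s _ r _) } ,
            λ x fx≈0 → ≤-respˡ (constant-g (x ∷ x ∷ vs)) (nonpos (x ⟨_⟩) fx≈0)

      pol-lorentzian : Lorentzian (𝓒 K L) (degree K L) (pol K L)
      pol-lorentzian = pol-homogeneous , inj₂ λ vs vs∈C → pol-positive ≡.refl vs vs∈C , pol-signature ≡.refl vs vs∈C

theorem3p7 : ∀ {c ℓ₁ ℓ₂ p : Level} (ℝ : RealNumbers c ℓ₁ ℓ₂) {n : ℕ}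
    (𝒫 : Pred (Subset n) p) (𝒫? : Decidable 𝒫) (graded : IntervalsGraded 𝒫)
    (K L : Subset n) → 𝒫 K → 𝒫 L → K ⊂ L →
    IsLatticeOfFlats L (Interval 𝒫 K L) →
    Lorentz.Lorentzian ℝ (Lorentz.𝓒 ℝ K L) (IntervalsGraded.degree graded K L)
    (Lorentz.Pol.pol ℝ 𝒫? graded K L)
theorem3p7 ℝ 𝒫 𝒫? graded K L PK PL K⊂L flats =
  MainTheorem.pol-lorentzian ℝ 𝒫? graded PK PL K⊂L flats
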